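{- The chromatic number of the plane is at least $5$. That is, there exists a finite set $P\subset\mathbb{R}^2$ whose unit-distance graph is not $4$-colourable; consequently, for every colouring of $\mathbb{R}^2$ with $4$ colours, there are two points at Euclidean distance exactly $1$ that receive the same colour.
   Context: For a set $P\subset\mathbb{R}^2$, the unit-distance graph on $P$ is the graph with vertex set $P$ in which two points are adjacent if and only if their Euclidean distance is exactly $1$. A $k$-colouring of a graph is a map from its vertex set to a set of $k$ colours such that adjacent vertices receive different colours. The chromatic number of the plane is the least $k$ such that $\mathbb{R}^2$ can be coloured with $k$ colours with no two points at distance exactly $1$ receiving the same colour. -}

module Defs where

open import Data.Fin.Base using (Fin)
open import Data.List.Base using (List)
open import Data.List.Membership.Setoid using () renaming (_∈_ to Member)
open import Data.Nat.Base as ℕ using (ℕ)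
import Data.Nat.Properties as ℕ
open import Data.Product.Base using (Σ; ∃-syntax; _×_; _,_; proj₁; proj₂)
open import Data.Product.Relation.Binary.Pointwise.NonDependent using (×-setoid)
open import Data.Rational.Base as ℚ using (ℚ; 0ℚ; 1ℚ; ½; ∣_∣)
import Data.Rational.Properties as ℚ
open import Data.Rational.Solver using (module +-*-Solver)
open import Function.Bundles using (Func; _⟨$⟩_; _⇔_; mk⇔)
open import Level using (0ℓ)
open import Relation.Binary.Bundles using (Setoid)
import Relation.Binary.Construct.On as On
open import Relation.Binary.PropositionalEquality
  using (_≡_; _≢_; refl; sym; trans; cong; cong₂; subst; setoid)
open import Relation.Unary using (Pred; U)

------------------------------------------------------------------------
-- Rational estimates

private
  module Estimates where

    half>0 : ∀ {ε} → 0ℚ ℚ.< ε → 0ℚ ℚ.< ½ ℚ.* ε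
    half>0 {ε} ε>0 = subst (ℚ._< ½ ℚ.* ε) (ℚ.*-zeroʳ ½) (ℚ.*-monoʳ-<-pos ½ ε>0)

    halves : ∀ ε → ½ ℚ.* ε ℚ.+ ½ ℚ.* ε ≡ ε
    halves ε = trans (sym (ℚ.*-distribʳ-+ ε ½ ½)) (ℚ.*-identityˡ ε)

    +-<-halves : ∀ {a b ε} → a ℚ.< ½ ℚ.* ε → b ℚ.< ½ ℚ.* ε → a ℚ.+ b ℚ.< ε
    +-<-halves {ε = ε} a< b< = subst (_ ℚ.<_) (halves ε) (ℚ.+-mono-< a< b<)

    ∣∣-sym : ∀ p q → ∣ p ℚ.- q ∣ ≡ ∣ q ℚ.- p ∣
    ∣∣-sym p q = trans (sym (ℚ.∣-p∣≡∣p∣ (p ℚ.- q)))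
      (cong ∣_∣ (solve 2 (λ p q → :- (p :- q) := q :- p) refl p q))
      where open +-*-Solver

    ∣p-p∣≡0 : ∀ p → ∣ p ℚ.- p ∣ ≡ 0ℚ
    ∣p-p∣≡0 p = cong ∣_∣ (ℚ.+-inverseʳ p)

    ∣∣≤-resp : ∀ {s t u v} → s ≡ t → u ≡ v → ∣ s ∣ ℚ.≤ u → ∣ t ∣ ℚ.≤ v
    ∣∣≤-resp refl refl h = h

    triangle : ∀ p q r → ∣ p ℚ.- r ∣ ℚ.≤ ∣ p ℚ.- q ∣ ℚ.+ ∣ q ℚ.- r ∣
    triangle p q r = ∣∣≤-resp
      (solve 3 (λ p q r → (p :- q) :+ (q :- r) := p :- r) refl p q r) refl
      (ℚ.∣p+q∣≤∣p∣+∣q∣ (p ℚ.- q) (q ℚ.- r))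
      where open +-*-Solver

    ∣+∣-diff : ∀ a b c d →
      ∣ (a ℚ.+ b) ℚ.- (c ℚ.+ d) ∣ ℚ.≤ ∣ a ℚ.- c ∣ ℚ.+ ∣ b ℚ.- d ∣
    ∣+∣-diff a b c d = ∣∣≤-resp
      (solve 4 (λ a b c d → (a :- c) :+ (b :- d) := (a :+ b) :- (c :+ d)) refl a b c d) refl
      (ℚ.∣p+q∣≤∣p∣+∣q∣ (a ℚ.- c) (b ℚ.- d))
      where open +-*-Solver

    ∣-∣-diff : ∀ a b → ∣ (ℚ.- a) ℚ.- (ℚ.- b) ∣ ≡ ∣ a ℚ.- b ∣
    ∣-∣-diff a b = trans
      (cong ∣_∣ (solve 2 (λ a b → (:- a) :- (:- b) := :- (a :- b)) refl a b))
      (ℚ.∣-p∣≡∣p∣ (a ℚ.- b))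
      where open +-*-Solver

    ∣*∣-diff : ∀ a b c d →
      ∣ (a ℚ.* b) ℚ.- (c ℚ.* d) ∣ ℚ.≤ ∣ a ∣ ℚ.* ∣ b ℚ.- d ∣ ℚ.+ ∣ d ∣ ℚ.* ∣ a ℚ.- c ∣
    ∣*∣-diff a b c d = ∣∣≤-resp
      (solve 4 (λ a b c d → a :* (b :- d) :+ d :* (a :- c) := (a :* b) :- (c :* d)) refl a b c d)
      (cong₂ ℚ._+_ (ℚ.∣p*q∣≡∣p∣*∣q∣ a (b ℚ.- d)) (ℚ.∣p*q∣≡∣p∣*∣q∣ d (a ℚ.- c)))
      (ℚ.∣p+q∣≤∣p∣+∣q∣ (a ℚ.* (b ℚ.- d)) (d ℚ.* (a ℚ.- c)))
      where
      open +-*-Solver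

    shrink : ∀ B ε → 0ℚ ℚ.< B → 0ℚ ℚ.< ε → ∃[ δ ] (0ℚ ℚ.< δ × B ℚ.* δ ≡ ε)
    shrink B ε B>0 ε>0 = δ , δ>0 , Bδ≡ε
      where
      instance
        B⁺ : ℚ.Positive B
        B⁺ = ℚ.positive B>0
        ε⁺ : ℚ.Positive ε
        ε⁺ = ℚ.positive ε>0
        B≠0 : ℚ.NonZero B
        B≠0 = ℚ.pos⇒nonZero B
        B⁻¹⁺ : ℚ.Positive (ℚ.1/ B)
        B⁻¹⁺ = ℚ.1/pos⇒pos B
      δ : ℚ
      δ = ℚ.1/ B ℚ.* ε
      δ>0 : 0ℚ ℚ.< δ
      δ>0 = ℚ.positive⁻¹ δ {{ℚ.pos*pos⇒pos (ℚ.1/ B) ε}}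
      Bδ≡ε : B ℚ.* δ ≡ ε
      Bδ≡ε = trans (sym (ℚ.*-assoc B (ℚ.1/ B) ε))
        (trans (cong (ℚ._* ε) (ℚ.*-inverseʳ B)) (ℚ.*-identityˡ ε))

    *-< : ∀ {a B t δ η} → 0ℚ ℚ.< B → B ℚ.* δ ≡ η →
          ∣ a ∣ ℚ.≤ B → ∣ t ∣ ℚ.< δ → ∣ a ∣ ℚ.* ∣ t ∣ ℚ.< η
    *-< {a} {B} {t} B>0 refl a≤B t<δ = ℚ.≤-<-trans
      (ℚ.*-monoʳ-≤-nonNeg ∣ t ∣ {{ℚ.∣-∣-nonNeg t}} a≤B)
      (ℚ.*-monoʳ-<-pos B {{ℚ.positive B>0}} t<δ)

open Estimates

------------------------------------------------------------------------
-- ℝ as Cauchy sequences of rationals, identified when their difference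
-- tends to 0; arithmetic is termwise

IsCauchy : (ℕ → ℚ) → Set
IsCauchy x = ∀ ε → 0ℚ ℚ.< ε →
  ∃[ N ] ∀ m n → N ℕ.≤ m → N ℕ.≤ n → ∣ x m ℚ.- x n ∣ ℚ.< ε

record ℝ : Set where
  constructor mkℝ
  field
    seq    : ℕ → ℚ
    cauchy : IsCauchy seq

open ℝ public

infix  4 _≈_ _≤_
infixl 6 _+_ _-_
infixl 7 _*_
infix  8 -_

_≈_ : ℝ → ℝ → Set
x ≈ y = ∀ ε → 0ℚ ℚ.< ε →
  ∃[ N ] ∀ n → N ℕ.≤ n → ∣ seq x n ℚ.- seq y n ∣ ℚ.< ε

_≤_ : ℝ → ℝ → Set
x ≤ y = ∀ ε → 0ℚ ℚ.< ε →
  ∃[ N ] ∀ n → N ℕ.≤ n → seq x n ℚ.< seq y n ℚ.+ ε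

abstract
  const-cauchy : ∀ q → IsCauchy (λ _ → q)
  const-cauchy q ε ε>0 = 0 , λ _ _ _ _ → subst (ℚ._< ε) (sym (∣p-p∣≡0 q)) ε>0

  +-cauchy : ∀ {x y} → IsCauchy x → IsCauchy y → IsCauchy (λ n → x n ℚ.+ y n)
  +-cauchy {x} {y} cx cy ε ε>0 with cx (½ ℚ.* ε) (half>0 ε>0) | cy (½ ℚ.* ε) (half>0 ε>0)
  ... | M , hM | N , hN = M ℕ.⊔ N , λ m n p q → ℚ.≤-<-trans
    (∣+∣-diff (x m) (y m) (x n) (y n))
    (+-<-halves {ε = ε} (hM m n (ℕ.m⊔n≤o⇒m≤o M N p) (ℕ.m⊔n≤o⇒m≤o M N q))
                        (hN m n (ℕ.m⊔n≤o⇒n≤o M N p) (ℕ.m⊔n≤o⇒n≤o M N q)))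

  neg-cauchy : ∀ {x} → IsCauchy x → IsCauchy (λ n → ℚ.- x n)
  neg-cauchy {x} cx ε ε>0 with cx ε ε>0
  ... | N , h = N , λ m n p q → subst (ℚ._< ε) (sym (∣-∣-diff (x m) (x n))) (h m n p q)

  eventually-bounded : ∀ {x} → IsCauchy x →
    ∃[ B ] (0ℚ ℚ.< B × ∃[ N ] ∀ n → N ℕ.≤ n → ∣ x n ∣ ℚ.≤ B)
  eventually-bounded {x} cx with cx 1ℚ (ℚ.positive⁻¹ 1ℚ)
  ... | N , h = 1ℚ ℚ.+ ∣ x N ∣ , B>0 , N , bound
    where
    B>0 : 0ℚ ℚ.< 1ℚ ℚ.+ ∣ x N ∣
    B>0 = ℚ.+-mono-<-≤ (ℚ.positive⁻¹ 1ℚ)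
      (ℚ.nonNegative⁻¹ ∣ x N ∣ {{ℚ.∣-∣-nonNeg (x N)}})
    split : ∀ a b → (a ℚ.- b) ℚ.+ b ≡ a
    split = solve 2 (λ a b → (a :- b) :+ b := a) refl
      where open +-*-Solver
    bound : ∀ n → N ℕ.≤ n → ∣ x n ∣ ℚ.≤ 1ℚ ℚ.+ ∣ x N ∣
    bound n p = ℚ.≤-trans
      (∣∣≤-resp (split (x n) (x N)) refl (ℚ.∣p+q∣≤∣p∣+∣q∣ (x n ℚ.- x N) (x N)))
      (ℚ.+-monoˡ-≤ ∣ x N ∣ (ℚ.<⇒≤ (h n N p ℕ.≤-refl)))

  *-cauchy : ∀ {x y} → IsCauchy x → IsCauchy y → IsCauchy (λ n → x n ℚ.* y n)
  *-cauchy {x} {y} cx cy ε ε>0 =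
    let A , A>0 , K , hK = eventually-bounded cx
        B , B>0 , L , hL = eventually-bounded cy
        α , α>0 , Aα     = shrink A (½ ℚ.* ε) A>0 (half>0 ε>0)
        β , β>0 , Bβ     = shrink B (½ ℚ.* ε) B>0 (half>0 ε>0)
        M , hM           = cy α α>0
        N , hN           = cx β β>0
    in product-tail {x} {y} ε A>0 B>0 Aα Bβ K L M N hK hL hM hN
    where
    product-tail : ∀ {x y : ℕ → ℚ} ε {A B α β} → 0ℚ ℚ.< A → 0ℚ ℚ.< B →
      A ℚ.* α ≡ ½ ℚ.* ε → B ℚ.* β ≡ ½ ℚ.* ε → ∀ K L M N →
      (∀ n → K ℕ.≤ n → ∣ x n ∣ ℚ.≤ A) →
      (∀ n → L ℕ.≤ n → ∣ y n ∣ ℚ.≤ B) →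
      (∀ m n → M ℕ.≤ m → M ℕ.≤ n → ∣ y m ℚ.- y n ∣ ℚ.< α) →
      (∀ m n → N ℕ.≤ m → N ℕ.≤ n → ∣ x m ℚ.- x n ∣ ℚ.< β) →
      ∃[ R ] ∀ m n → R ℕ.≤ m → R ℕ.≤ n → ∣ x m ℚ.* y m ℚ.- x n ℚ.* y n ∣ ℚ.< ε
    product-tail {x} {y} ε {A} {B} A>0 B>0 Aα Bβ K L M N hK hL hM hN =
      (K ℕ.⊔ L) ℕ.⊔ (M ℕ.⊔ N) , bound
      where
      bound : ∀ m n → (K ℕ.⊔ L) ℕ.⊔ (M ℕ.⊔ N) ℕ.≤ m → (K ℕ.⊔ L) ℕ.⊔ (M ℕ.⊔ N) ℕ.≤ n →
              ∣ x m ℚ.* y m ℚ.- x n ℚ.* y n ∣ ℚ.< ε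
      bound m n p q = ℚ.≤-<-trans (∣*∣-diff (x m) (y m) (x n) (y n))
        (+-<-halves {ε = ε} first second)
        where
        KLm : K ℕ.⊔ L ℕ.≤ m
        KLm = ℕ.m⊔n≤o⇒m≤o (K ℕ.⊔ L) (M ℕ.⊔ N) p
        KLn : K ℕ.⊔ L ℕ.≤ n
        KLn = ℕ.m⊔n≤o⇒m≤o (K ℕ.⊔ L) (M ℕ.⊔ N) q
        MNm : M ℕ.⊔ N ℕ.≤ m
        MNm = ℕ.m⊔n≤o⇒n≤o (K ℕ.⊔ L) (M ℕ.⊔ N) p
        MNn : M ℕ.⊔ N ℕ.≤ n
        MNn = ℕ.m⊔n≤o⇒n≤o (K ℕ.⊔ L) (M ℕ.⊔ N) q
        first : ∣ x m ∣ ℚ.* ∣ y m ℚ.- y n ∣ ℚ.< ½ ℚ.* ε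
        first = *-< {x m} {A} {y m ℚ.- y n} A>0 Aα
          (hK m (ℕ.m⊔n≤o⇒m≤o K L KLm))
          (hM m n (ℕ.m⊔n≤o⇒m≤o M N MNm) (ℕ.m⊔n≤o⇒m≤o M N MNn))
        second : ∣ y n ∣ ℚ.* ∣ x m ℚ.- x n ∣ ℚ.< ½ ℚ.* ε
        second = *-< {y n} {B} {x m ℚ.- x n} B>0 Bβ
          (hL n (ℕ.m⊔n≤o⇒n≤o K L KLn))
          (hN m n (ℕ.m⊔n≤o⇒n≤o M N MNm) (ℕ.m⊔n≤o⇒n≤o M N MNn))

  ≈-refl : ∀ {x} → x ≈ x
  ≈-refl {x} ε ε>0 = 0 , λ n _ → subst (ℚ._< ε) (sym (∣p-p∣≡0 (seq x n))) ε>0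

  ≈-sym : ∀ {x y} → x ≈ y → y ≈ x
  ≈-sym {x} {y} x≈y ε ε>0 with x≈y ε ε>0
  ... | N , h = N , λ n p → subst (ℚ._< ε) (∣∣-sym (seq x n) (seq y n)) (h n p)

  ≈-trans : ∀ {x y z} → x ≈ y → y ≈ z → x ≈ z
  ≈-trans {x} {y} {z} x≈y y≈z ε ε>0
    with x≈y (½ ℚ.* ε) (half>0 ε>0) | y≈z (½ ℚ.* ε) (half>0 ε>0)
  ... | M , hM | N , hN = M ℕ.⊔ N , λ n p → ℚ.≤-<-trans
    (triangle (seq x n) (seq y n) (seq z n))
    (+-<-halves {ε = ε} (hM n (ℕ.m⊔n≤o⇒m≤o M N p)) (hN n (ℕ.m⊔n≤o⇒n≤o M N p)))

ℝ-setoid : Setoid 0ℓ 0ℓ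
ℝ-setoid = record
  { Carrier       = ℝ
  ; _≈_           = _≈_
  ; isEquivalence = record
    { refl  = λ {x} → ≈-refl {x}
    ; sym   = λ {x} {y} → ≈-sym {x} {y}
    ; trans = λ {x} {y} {z} → ≈-trans {x} {y} {z}
    }
  }

fromℚ : ℚ → ℝ
fromℚ q = mkℝ (λ _ → q) (const-cauchy q)

0ℝ 1ℝ : ℝ
0ℝ = fromℚ 0ℚ
1ℝ = fromℚ 1ℚ

_+_ _*_ : ℝ → ℝ → ℝ
x + y = mkℝ (λ n → seq x n ℚ.+ seq y n) (+-cauchy {seq x} {seq y} (cauchy x) (cauchy y))
x * y = mkℝ (λ n → seq x n ℚ.* seq y n) (*-cauchy {seq x} {seq y} (cauchy x) (cauchy y))

-_ : ℝ → ℝ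
- x = mkℝ (λ n → ℚ.- seq x n) (neg-cauchy {seq x} (cauchy x))

_-_ : ℝ → ℝ → ℝ
x - y = x + (- y)

------------------------------------------------------------------------
-- The Euclidean plane

ℝ² : Setoid 0ℓ 0ℓ
ℝ² = ×-setoid ℝ-setoid ℝ-setoid

Point : Set
Point = Setoid.Carrier ℝ²

-- d is the nonnegative square root of (p₁ - q₁)² + (p₂ - q₂)².
IsDistance : Point → Point → ℝ → Set
IsDistance (p₁ , p₂) (q₁ , q₂) d =
  0ℝ ≤ d × d * d ≈ (p₁ - q₁) * (p₁ - q₁) + (p₂ - q₂) * (p₂ - q₂)

UnitDistance : Point → Point → Set
UnitDistance p q = IsDistance p q 1ℝ

------------------------------------------------------------------------
-- Graphs and colourings

record Graph : Set₁ where
  field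
    vertices : Setoid 0ℓ 0ℓ
    Adjacent : Setoid.Carrier vertices → Setoid.Carrier vertices → Set

-- Maps from a set to k colours. Being a Func, such a map gives equal
-- elements (e.g. two sequences with the same limit) the same colour.
Colours : Setoid 0ℓ 0ℓ → ℕ → Set
Colours S k = Func S (setoid (Fin k))

IsProper : ∀ (G : Graph) {k} → Colours (Graph.vertices G) k → Set
IsProper G c = ∀ {u v} → Graph.Adjacent G u v → c ⟨$⟩ u ≢ c ⟨$⟩ v

Colourable : ℕ → Graph → Set
Colourable k G = Σ (Colours (Graph.vertices G) k) (IsProper G)

IsChromaticNumber : Graph → ℕ → Set
IsChromaticNumber G χ = Colourable χ G × (∀ k → Colourable k G → χ ℕ.≤ k)

-- "The chromatic number of G is at least m". The chromatic number is the
-- minimum of { k ∣ Colourable k G }, so this says that m is a lower bound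
-- of that set, without presupposing that a minimum can be exhibited
-- constructively; see ChromaticNumber≥-⇔.
ChromaticNumber≥ : Graph → ℕ → Set
ChromaticNumber≥ G m = ∀ k → Colourable k G → m ℕ.≤ k

ChromaticNumber≥-⇔ : ∀ {G χ m} → IsChromaticNumber G χ →
                     ChromaticNumber≥ G m ⇔ m ℕ.≤ χ
ChromaticNumber≥-⇔ {χ = χ} (col , least) =
  mk⇔ (λ h → h χ col) (λ m≤χ k c → ℕ.≤-trans m≤χ (least k c))

------------------------------------------------------------------------
-- Unit-distance graphs

unitDistanceGraph : Pred Point 0ℓ → Graph
unitDistanceGraph P = record
  { vertices = On.setoid {B = Σ Point P} ℝ² proj₁
  ; Adjacent = λ u v → UnitDistance (proj₁ u) (proj₁ v)
  }

-- The finite set { p₁ , … , pₙ } ⊂ ℝ² listed by [ p₁ , … , pₙ ].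
⟦_⟧ : List Point → Pred Point 0ℓ
⟦ ps ⟧ p = Member ℝ² p ps

planeGraph : Graph
planeGraph = unitDistanceGraph U

{-# OPTIONS --safe #-}
-- Let c be a proper 4-colouring, ω = (1 + √-3)/2 and ω₄ = (7 + √-15)/8. A finite set of
-- points around the origin, with coordinates in ℚ(√-3, √-11), shows that the triangle
-- {1, ω², ω⁴} with side √3 is not monochromatic; nor, therefore, is any other triangle with
-- side √3. Multiplication by ω₄ moves the points at distance 2 from 0 by exactly 1, and a second
-- finite argument, on a piece of ℤ[ω] and its image under ω₄, shows that c(2) = c(-2) when
-- there are no such triangles. Applied to other copies of the two lattices this gives
-- c(x) = c(x + 4 ζ) for ζ = 1, ω₄, ω₄⁻¹ and every x, hence c(0) = c(4 (2 - ω₄ - ω₄⁻¹)) = c(1),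
-- which is absurd. Only finitely many points occur. Both finite arguments are lists of partial
-- colourings that cannot be extended, each refuted by unit propagation with the help of the
-- images of earlier ones under rotations by 120° and the exchange of two colours.
module Submission where

open import Defs
open import Data.Bool.Base using (Bool; true; false; T; not; _∧_; _∨_; if_then_else_)
open import Data.Bool.ListAction using (all; any)
open import Data.Bool.Properties using (T-∧; T-≡)
open import Data.Empty using (⊥; ⊥-elim)
open import Data.Fin.Base using (Fin; inject≤)
open import Data.Fin.Patterns using (0F; 1F; 2F; 3F)
open import Data.Fin.Permutation.Components using (transpose; transpose-inverse)
import Data.Fin.Properties as Fin
open import Data.Integer.Base as ℤ using (ℤ; +_; -[1+_])
import Data.Integer.Properties as ℤ
open import Data.Integer.Solver using () renaming (module +-*-Solver to ℤ-Solver)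
open import Data.List.Base using (List)
open import Data.List.Base as List using ([]; _∷_; _++_; concatMap)
open import Data.List.Membership.DecPropositional using () renaming (_∈?_ to member?)
open import Data.List.Membership.Propositional using (_∈_; lose)
open import Data.List.Membership.Propositional.Properties using (∈-map⁺; ∈-concatMap⁺; ∈-++⁺ˡ; ∈-++⁺ʳ)
open import Data.List.Membership.Setoid using () renaming (_∈_ to Member)
open import Data.List.Relation.Unary.All as All using (All; []; _∷_)
open import Data.List.Relation.Unary.All.Properties using (map⁺; map⁻; concat⁺; all⁺)
open import Data.List.Relation.Unary.Any as Any using (here; there; any?)
open import Data.List.Relation.Unary.Any.Properties as Any using (any⁻)
open import Data.Maybe.Base using (Maybe; just; nothing; maybe)
open import Data.Nat.Base as ℕ using (ℕ; zero; suc; NonZero; _≡ᵇ_)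
import Data.Nat.Properties as ℕ
open import Data.Product.Base using (Σ-syntax; ∃-syntax; _×_)
open import Data.Product.Base using (_,_; proj₁; proj₂)
open import Data.Rational.Base as ℚ using (ℚ; 0ℚ; 1ℚ; ½; ∣_∣; toℚᵘ; mkℚ)
import Data.Rational.Properties as ℚ
open import Data.Rational.Solver using (module +-*-Solver)
open import Data.Rational.Unnormalised.Base as ℚᵘ using (mkℚᵘ; *≡*; *<*)
import Data.Rational.Unnormalised.Properties as ℚᵘ
open import Data.Sum.Base using (inj₁; inj₂)
open import Data.Unit.Base using (⊤; tt)
open import Data.Vec.Base as Vec using (Vec; []; _∷_; zipWith; replicate)
import Data.Vec.Properties as Vec
open import Function.Base using (_∘_)
open import Function.Bundles using (_⟨$⟩_)
open import Function.Bundles using (Func; Equivalence)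
open import Function.Definitions using (Injective)
open import Relation.Binary.Bundles using (Setoid)
open import Relation.Binary.PropositionalEquality using (_≡_)
open import Relation.Binary.PropositionalEquality
  using (_≢_; refl; sym; trans; cong; cong₂; subst; subst₂; module ≡-Reasoning)
open import Relation.Nullary.Decidable
  using (Dec; yes; no; True; toWitness; decidable-stable; ¬?; _×-dec_; _→-dec_)
open import Relation.Nullary.Negation using (¬_)
open +-*-Solver using (solve; _:=_; _:+_; _:*_; _:-_; :-_; con; Polynomial)

-- Null sequences

-- Both uses of ω₄ rest on the equation |1 - ω₄|² = 2 - ω₄ - ω₄⁻¹ = 1/4: it moves points at distance
-- 2 by 1, and it makes a path of four steps of length 4 end at distance 1 from its start. Turning a
-- single segment of length 4 about one end through 2 arcsin(1/8) would be more direct but would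
-- adjoin √7; the path stays in the field already present. The number η² = (5 + √-11)/6 that brings
-- in √-11 is the rotation of the Moser spindle: |1 - η²| = 1/√3, so points at distance √3 move by
-- 1. The obstacle is that `ℝ` offers only termwise operations on Cauchy sequences and no decidable
-- equality. All geometry therefore takes place on integer coefficient vectors, where equality and
-- unit length are decidable. The one fact needed about real numbers is `unit-distance`, and it
-- comes from a polynomial identity in the rational approximations to √3, √5 and √33.

Null : (ℕ → ℚ) → Set
Null u = ∀ ε → 0ℚ ℚ.< ε → ∃[ N ] ∀ n → N ℕ.≤ n → ∣ u n ∣ ℚ.< ε

null-cong : ∀ {u v} → (∀ n → u n ≡ v n) → Null u → Null v
null-cong eq null ε ε>0 with null ε ε>0
... | N , h = N , λ n p → subst (λ q → ∣ q ∣ ℚ.< ε) (eq n) (h n p)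

null-+ : ∀ {u v} → Null u → Null v → Null (λ n → u n ℚ.+ v n)
null-+ {u} {v} nu nv ε ε>0 with nu (½ ℚ.* ε) ½ε>0 | nv (½ ℚ.* ε) ½ε>0
  where
  ½ε>0 : 0ℚ ℚ.< ½ ℚ.* ε
  ½ε>0 = subst (ℚ._< ½ ℚ.* ε) (ℚ.*-zeroʳ ½) (ℚ.*-monoʳ-<-pos ½ ε>0)
... | M , hM | N , hN = M ℕ.⊔ N , λ n p → ℚ.≤-<-trans (ℚ.∣p+q∣≤∣p∣+∣q∣ (u n) (v n))
  (subst (∣ u n ∣ ℚ.+ ∣ v n ∣ ℚ.<_) (solve 1 (λ e → con ½ :* e :+ con ½ :* e := e) refl ε)
    (ℚ.+-mono-< (hM n (ℕ.m⊔n≤o⇒m≤o M N p)) (hN n (ℕ.m⊔n≤o⇒n≤o M N p))))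

divide : ∀ B ε → 0ℚ ℚ.< B → 0ℚ ℚ.< ε → ∃[ δ ] (0ℚ ℚ.< δ × B ℚ.* δ ≡ ε)
divide B ε B>0 ε>0 = 1/B ℚ.* ε ,
  subst (ℚ._< 1/B ℚ.* ε) (ℚ.*-zeroʳ 1/B) (ℚ.*-monoʳ-<-pos 1/B {{ℚ.1/pos⇒pos B}} ε>0) ,
  trans (sym (ℚ.*-assoc B 1/B ε)) (trans (cong (ℚ._* ε) (ℚ.*-inverseʳ B)) (ℚ.*-identityˡ ε))
  where
  instance
    B⁺ : ℚ.Positive B
    B⁺ = ℚ.positive B>0
    B≠0 : ℚ.NonZero B
    B≠0 = ℚ.pos⇒nonZero B
  1/B : ℚ
  1/B = ℚ.1/ B

-- A Cauchy sequence is eventually bounded. Taking the factor from `ℝ` provides the bound for every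
-- coefficient that is built with the termwise operations.
null-* : ∀ (x : ℝ) {u} → Null u → Null (λ n → seq x n ℚ.* u n)
null-* x {u} nu ε ε>0 =
  let B , B>0 , M , hM = eventually-bounded (cauchy x)
      δ , δ>0 , Bδ≡ε   = divide B ε B>0 ε>0
      N , hN           = nu δ δ>0
  in M ℕ.⊔ N , λ n p → bound {seq x n} {u n} B>0 Bδ≡ε
       (hM n (ℕ.m⊔n≤o⇒m≤o M N p)) (hN n (ℕ.m⊔n≤o⇒n≤o M N p))
  where
  bound : ∀ {a t B δ} → 0ℚ ℚ.< B → B ℚ.* δ ≡ ε → ∣ a ∣ ℚ.≤ B → ∣ t ∣ ℚ.< δ → ∣ a ℚ.* t ∣ ℚ.< ε
  bound {a} {t} {B} B>0 Bδ≡ε a≤B t<δ = subst₂ ℚ._<_ (sym (ℚ.∣p*q∣≡∣p∣*∣q∣ a t)) Bδ≡ε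
    (ℚ.≤-<-trans (ℚ.*-monoʳ-≤-nonNeg ∣ t ∣ {{ℚ.∣-∣-nonNeg t}} a≤B)
                 (ℚ.*-monoʳ-<-pos B {{ℚ.positive B>0}} t<δ))

-- Integers as rationals

ι : ℤ → ℚ
ι i = i ℚ./ 1

toℚᵘ-ι : ∀ i → toℚᵘ (ι i) ℚᵘ.≃ mkℚᵘ i 0
toℚᵘ-ι i = ℚ.toℚᵘ-fromℚᵘ (mkℚᵘ i 0)

ι-+ : ∀ i j → ι (i ℤ.+ j) ≡ ι i ℚ.+ ι j
ι-+ i j = ℚ.toℚᵘ-injective (ℚᵘ.≃-trans (toℚᵘ-ι (i ℤ.+ j)) (ℚᵘ.≃-sym
  (ℚᵘ.≃-trans (ℚ.toℚᵘ-homo-+ (ι i) (ι j)) (ℚᵘ.≃-trans (ℚᵘ.+-cong (toℚᵘ-ι i) (toℚᵘ-ι j))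
    (*≡* (cong (ℤ._* + 1) (cong₂ ℤ._+_ (ℤ.*-identityʳ i) (ℤ.*-identityʳ j))))))))

ι-* : ∀ i j → ι (i ℤ.* j) ≡ ι i ℚ.* ι j
ι-* i j = ℚ.toℚᵘ-injective (ℚᵘ.≃-trans (toℚᵘ-ι (i ℤ.* j)) (ℚᵘ.≃-sym
  (ℚᵘ.≃-trans (ℚ.toℚᵘ-homo-* (ι i) (ι j)) (ℚᵘ.*-cong (toℚᵘ-ι i) (toℚᵘ-ι j)))))

ι-neg : ∀ i → ι (ℤ.- i) ≡ ℚ.- ι i
ι-neg i = ℚ.toℚᵘ-injective (ℚᵘ.≃-trans (toℚᵘ-ι (ℤ.- i)) (ℚᵘ.≃-sym
  (ℚᵘ.≃-trans (ℚ.toℚᵘ-homo‿- (ι i)) (ℚᵘ.-‿cong (toℚᵘ-ι i)))))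

-- Square roots

halving : ℕ → ℚ
halving zero    = ½
halving (suc k) = ½ ℚ.* halving k

halving≥0 : ∀ k → 0ℚ ℚ.≤ halving k
halving≥0 zero    = ℚ.nonNegative⁻¹ ½
halving≥0 (suc k) = subst (ℚ._≤ halving (suc k)) (ℚ.*-zeroʳ ½) (ℚ.*-monoˡ-≤-nonNeg ½ (halving≥0 k))

halving≤1 : ∀ k → halving k ℚ.≤ 1ℚ
halving≤1 zero    = ℚ.toℚᵘ-cancel-≤ (ℚᵘ.*≤* (ℤ.+≤+ (ℕ.s≤s ℕ.z≤n)))
halving≤1 (suc k) = ℚ.≤-trans (ℚ.*-monoˡ-≤-nonNeg ½ (halving≤1 k)) (halving≤1 zero)

-- The value at k + 1 is the mean of the value at k and of `halving k`, both at most 1. A linear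
-- bound suffices for convergence to 0 by the Archimedean property.
linear-halving≤1 : ∀ k → ι (+ k) ℚ.* halving k ℚ.≤ 1ℚ
linear-halving≤1 zero    = ℚ.toℚᵘ-cancel-≤ (ℚᵘ.*≤* (ℤ.+≤+ ℕ.z≤n))
linear-halving≤1 (suc k) = subst (ℚ._≤ 1ℚ) (sym eq)
  (ℚ.*-monoˡ-≤-nonNeg ½ (ℚ.+-mono-≤ (linear-halving≤1 k) (halving≤1 k)))
  where
  eq : ι (+ suc k) ℚ.* (½ ℚ.* halving k) ≡ ½ ℚ.* (ι (+ k) ℚ.* halving k ℚ.+ halving k)
  eq = trans (cong (ℚ._* (½ ℚ.* halving k)) (ι-+ (+ 1) (+ k)))
    (solve 2 (λ i h → (con 1ℚ :+ i) :* (con ½ :* h) := con ½ :* (i :* h :+ h)) refl (ι (+ k)) (halving k))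

ι-mono-≤ : ∀ {m n} → m ℕ.≤ n → ι (+ m) ℚ.≤ ι (+ n)
ι-mono-≤ {m} {n} m≤n = ℚ.toℚᵘ-cancel-≤ (ℚᵘ.≤-respˡ-≃ (ℚᵘ.≃-sym (toℚᵘ-ι (+ m)))
  (ℚᵘ.≤-respʳ-≃ (ℚᵘ.≃-sym (toℚᵘ-ι (+ n))) (ℚᵘ.*≤* (ℤ.*-monoʳ-≤-nonNeg (+ 1) (ℤ.+≤+ m≤n)))))

archimedean : ∀ ε → 0ℚ ℚ.< ε → ∃[ d ] 1ℚ ℚ.< ι (+ d) ℚ.* ε
-- `mkℚ` stores the denominator minus one, so ε = (1 + a)/(1 + d), and the witness is one more than
-- the denominator.
archimedean ε@(mkℚ (+ suc a) d _) _ = 2 ℕ.+ d , ℚ.toℚᵘ-cancel-< (ℚᵘ.<-respʳ-≃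
  (ℚᵘ.≃-sym (ℚᵘ.≃-trans (ℚ.toℚᵘ-homo-* (ι (+ (2 ℕ.+ d))) ε) (ℚᵘ.*-congʳ (toℚᵘ-ι (+ (2 ℕ.+ d))))))
  (*<* (subst₂ ℤ._<_ (sym (ℤ.*-identityˡ _)) (sym (ℤ.*-identityʳ _)) (ℤ.+<+
    (subst (ℕ._< (2 ℕ.+ d) ℕ.* suc a) (sym (ℕ.*-identityˡ (suc d))) (ℕ.m≤m*n (2 ℕ.+ d) (suc a)))))))
archimedean (mkℚ (+ 0) _ _) (ℚ.*<* (ℤ.+<+ ()))
archimedean (mkℚ -[1+ _ ] _ _) (ℚ.*<* ())

halving-null : ∀ ε → 0ℚ ℚ.< ε → ∃[ N ] ∀ n → N ℕ.≤ n → halving n ℚ.< ε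
halving-null ε ε>0 with archimedean ε ε>0
... | d , 1<dε = d , λ n d≤n → ℚ.*-cancelˡ-<-nonNeg (ι (+ d)) {{ℚ.nonNegative (ι-mono-≤ {0} {d} ℕ.z≤n)}}
  (ℚ.≤-<-trans
    (ℚ.≤-trans (ℚ.*-monoʳ-≤-nonNeg (halving n) {{ℚ.nonNegative (halving≥0 n)}} (ι-mono-≤ d≤n))
               (linear-halving≤1 n))
    1<dε)

-- The iteration s ↦ s (3 - s²/r) / 2 for √r: the relative error 1 - s²/r becomes
-- at most half as large in each step.
module SquareRoot (r c s₀ : ℚ) (rc≡1 : r ℚ.* c ≡ 1ℚ) (r≥0 : 0ℚ ℚ.≤ r)
  (1≤s₀ : 1ℚ ℚ.≤ s₀) (error₀≥0 : 0ℚ ℚ.≤ 1ℚ ℚ.- c ℚ.* (s₀ ℚ.* s₀))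
  (error₀≤½ : 1ℚ ℚ.- c ℚ.* (s₀ ℚ.* s₀) ℚ.≤ ½) (c>0 : 0ℚ ℚ.< c) where

  error : ℚ → ℚ
  error s = 1ℚ ℚ.- c ℚ.* (s ℚ.* s)

  root : ℕ → ℚ
  root zero    = s₀
  root (suc k) = root k ℚ.* (1ℚ ℚ.+ ½ ℚ.* error (root k))

  private
    e : ℕ → ℚ
    e k = error (root k)

  ¼ : ℚ
  ¼ = ½ ℚ.* ½

  -- The constant and linear terms cancel. For 0 ≤ e ≤ ½ the right side is nonnegative and at most ¼
  -- · e · ½ · 4 = e/2: the iterates stay below √r, and the error halves. Unlike Newton's iteration
  -- this one never divides by an iterate; it needs only c = 1/r.
  error-step : ∀ k → e (suc k) ≡ ¼ ℚ.* (e k ℚ.* (e k ℚ.* (ι (+ 3) ℚ.+ e k)))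
  error-step k = trans
    (cong (λ t → 1ℚ ℚ.- t) (solve 3 (λ c s g → c :* ((s :* g) :* (s :* g)) := (c :* (s :* s)) :* (g :* g))
      refl c (root k) (1ℚ ℚ.+ ½ ℚ.* e k)))
    (solve 1 (λ u → let f = con 1ℚ :- u; g = con 1ℚ :+ con ½ :* f in
        con 1ℚ :- u :* (g :* g) := con ¼ :* (f :* (f :* (con (ι (+ 3)) :+ f))))
      refl (c ℚ.* (root k ℚ.* root k)))

  *-nonNeg : ∀ {p q} → 0ℚ ℚ.≤ p → 0ℚ ℚ.≤ q → 0ℚ ℚ.≤ p ℚ.* q
  *-nonNeg {p} {q} p≥0 q≥0 = subst (ℚ._≤ p ℚ.* q) (ℚ.*-zeroʳ p)
    (ℚ.*-monoˡ-≤-nonNeg p {{ℚ.nonNegative p≥0}} q≥0)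

  *-mono : ∀ {p q r s} → 0ℚ ℚ.≤ p → 0ℚ ℚ.≤ s → p ℚ.≤ q → r ℚ.≤ s → p ℚ.* r ℚ.≤ q ℚ.* s
  *-mono {p} {q} {r} {s} p≥0 s≥0 p≤q r≤s = ℚ.≤-trans
    (ℚ.*-monoˡ-≤-nonNeg p {{ℚ.nonNegative p≥0}} r≤s)
    (ℚ.*-monoʳ-≤-nonNeg s {{ℚ.nonNegative s≥0}} p≤q)

  error≥0 : ∀ k → 0ℚ ℚ.≤ e k
  error≤  : ∀ k → e k ℚ.≤ halving k
  error≥0 zero    = error₀≥0
  error≥0 (suc k) = subst (0ℚ ℚ.≤_) (sym (error-step k))
    (*-nonNeg (ℚ.nonNegative⁻¹ ¼) (*-nonNeg (error≥0 k) (*-nonNeg (error≥0 k)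
      (ℚ.+-mono-≤ (ℚ.nonNegative⁻¹ (ι (+ 3))) (error≥0 k)))))
  error≤ zero     = error₀≤½
  error≤ (suc k)  = subst (ℚ._≤ halving (suc k)) (sym (error-step k)) (ℚ.≤-trans
    (*-mono (ℚ.nonNegative⁻¹ ¼) (*-nonNeg (halving≥0 k) (ℚ.nonNegative⁻¹ (½ ℚ.* ι (+ 4)))) ℚ.≤-refl
      (*-mono (error≥0 k) (ℚ.nonNegative⁻¹ (½ ℚ.* ι (+ 4))) (error≤ k)
        (*-mono (error≥0 k) (ℚ.nonNegative⁻¹ (ι (+ 4))) e≤½
          (ℚ.+-mono-≤ (ℚ.≤-refl {ι (+ 3)}) (ℚ.≤-trans (error≤ k) (halving≤1 k))))))
    (ℚ.≤-reflexive (solve 1 (λ h → con ¼ :* (h :* (con ½ :* con (ι (+ 4)))) := con ½ :* h) refl (halving k))))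
    where
    halving≤½ : ∀ k → halving k ℚ.≤ ½
    halving≤½ zero    = ℚ.≤-refl
    halving≤½ (suc k) = ℚ.*-monoˡ-≤-nonNeg ½ (halving≤1 k)
    e≤½ : e k ℚ.≤ ½
    e≤½ = ℚ.≤-trans (error≤ k) (halving≤½ k)

  1≤root : ∀ k → 1ℚ ℚ.≤ root k
  1≤root zero    = 1≤s₀
  1≤root (suc k) = *-mono {1ℚ} {root k} {1ℚ} (ℚ.nonNegative⁻¹ 1ℚ) (ℚ.≤-trans (ℚ.nonNegative⁻¹ 1ℚ) 1≤) (1≤root k) 1≤
    where
    1≤ : 1ℚ ℚ.≤ 1ℚ ℚ.+ ½ ℚ.* e k
    1≤ = ℚ.+-mono-≤ (ℚ.≤-refl {1ℚ}) (*-nonNeg (ℚ.nonNegative⁻¹ ½) (error≥0 k))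

  halving-antitone : ∀ {m n} → m ℕ.≤ n → halving n ℚ.≤ halving m
  halving-antitone m≤n = go (ℕ.≤⇒≤′ m≤n)
    where
    step : ∀ n → halving (suc n) ℚ.≤ halving n
    step n = ℚ.≤-trans (ℚ.*-monoʳ-≤-nonNeg (halving n) {{ℚ.nonNegative (halving≥0 n)}} (halving≤1 zero))
      (ℚ.≤-reflexive (ℚ.*-identityˡ (halving n)))
    go : ∀ {m n} → m ℕ.≤′ n → halving n ℚ.≤ halving m
    go (ℕ.≤′-reflexive refl) = ℚ.≤-refl
    go (ℕ.≤′-step {n} p)     = ℚ.≤-trans (step n) (go p)

  small : ∀ ε → 0ℚ ℚ.< ε → ∃[ N ] ∀ n → N ℕ.≤ n → r ℚ.* halving n ℚ.< ε
  small ε ε>0 = let N , h = halving-null (c ℚ.* ε) cε>0 in N , λ n p → cancel (halving n) (h n p)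
    where
    cε>0 : 0ℚ ℚ.< c ℚ.* ε
    cε>0 = subst (ℚ._< c ℚ.* ε) (ℚ.*-zeroʳ c) (ℚ.*-monoʳ-<-pos c {{ℚ.positive c>0}} ε>0)
    cancel : ∀ h → h ℚ.< c ℚ.* ε → r ℚ.* h ℚ.< ε
    cancel h h<cε = ℚ.*-cancelˡ-<-nonNeg c {{ℚ.nonNegative (ℚ.<⇒≤ c>0)}}
      (subst (ℚ._< c ℚ.* ε) (sym (trans (sym (ℚ.*-assoc c r h))
        (trans (cong (ℚ._* h) (trans (ℚ.*-comm c r) rc≡1)) (ℚ.*-identityˡ h)))) h<cε)

  square : ∀ k → root k ℚ.* root k ℚ.- r ≡ ℚ.- (r ℚ.* e k)
  square k = trans
    (cong (ℚ._- r) {root k ℚ.* root k} {r ℚ.* c ℚ.* (root k ℚ.* root k)}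
      (trans (sym (ℚ.*-identityˡ (root k ℚ.* root k))) (cong (ℚ._* (root k ℚ.* root k)) (sym rc≡1))))
    (solve 3 (λ r c s → r :* c :* (s :* s) :- r := :- (r :* (con 1ℚ :- c :* (s :* s)))) refl r c (root k))

  square-null : Null (λ k → root k ℚ.* root k ℚ.- r)
  square-null ε ε>0 = let N , h = small ε ε>0 in N , λ n p → ℚ.≤-<-trans (bound n) (h n p)
    where
    bound : ∀ n → ∣ root n ℚ.* root n ℚ.- r ∣ ℚ.≤ r ℚ.* halving n
    bound n = ℚ.≤-trans
      (ℚ.≤-reflexive (trans (cong ∣_∣ (square n))
        (trans (ℚ.∣-p∣≡∣p∣ (r ℚ.* e n)) (ℚ.0≤p⇒∣p∣≡p (*-nonNeg r≥0 (error≥0 n))))))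
      (ℚ.*-monoˡ-≤-nonNeg r {{ℚ.nonNegative r≥0}} (error≤ n))

  -- All iterates are at least 1, so |x - y| ≤ |x - y| (x + y) = |x² - y²|, and by `square` the
  -- squares differ by r times the difference of the errors.
  root-cauchy : IsCauchy root
  root-cauchy ε ε>0 = let N , h = small ε ε>0 in N , λ m n p q → ℚ.≤-<-trans (difference m n)
    (ℚ.≤-<-trans (ℚ.*-monoˡ-≤-nonNeg r {{ℚ.nonNegative r≥0}}
      (close (error≥0 m) (error≥0 n) (ℚ.≤-trans (error≤ m) (halving-antitone p))
                                     (ℚ.≤-trans (error≤ n) (halving-antitone q))))
      (h N ℕ.≤-refl))
    where
    close : ∀ {x y h} → 0ℚ ℚ.≤ x → 0ℚ ℚ.≤ y → x ℚ.≤ h → y ℚ.≤ h → ∣ x ℚ.- y ∣ ℚ.≤ h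
    close {x} {y} {h} x≥0 y≥0 x≤h y≤h with ℚ.∣p∣≡p∨∣p∣≡-p (x ℚ.- y)
    ... | inj₁ eq = subst (ℚ._≤ h) (sym eq) (ℚ.≤-trans (ℚ.+-mono-≤ x≤h (ℚ.neg-antimono-≤ y≥0))
                      (ℚ.≤-reflexive (ℚ.+-identityʳ h)))
    ... | inj₂ eq = subst (ℚ._≤ h) (sym (trans eq (solve 2 (λ x y → :- (x :- y) := y :- x) refl x y)))
                      (ℚ.≤-trans (ℚ.+-mono-≤ y≤h (ℚ.neg-antimono-≤ x≥0)) (ℚ.≤-reflexive (ℚ.+-identityʳ h)))
    difference : ∀ m n → ∣ root m ℚ.- root n ∣ ℚ.≤ r ℚ.* ∣ e m ℚ.- e n ∣
    difference m n = ℚ.≤-trans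
      (ℚ.≤-reflexive (sym (ℚ.*-identityʳ ∣ root m ℚ.- root n ∣)))
      (ℚ.≤-trans
        (ℚ.*-monoˡ-≤-nonNeg ∣ root m ℚ.- root n ∣ {{ℚ.∣-∣-nonNeg (root m ℚ.- root n)}} 1≤∣sum∣)
        (ℚ.≤-reflexive eq))
      where
      sum : ℚ
      sum = root m ℚ.+ root n
      1≤sum : 1ℚ ℚ.≤ sum
      1≤sum = ℚ.+-mono-≤ (1≤root m) (ℚ.≤-trans (ℚ.nonNegative⁻¹ 1ℚ) (1≤root n))
      1≤∣sum∣ : 1ℚ ℚ.≤ ∣ sum ∣
      1≤∣sum∣ = ℚ.≤-trans 1≤sum
        (ℚ.≤-reflexive (sym (ℚ.0≤p⇒∣p∣≡p (ℚ.≤-trans (ℚ.nonNegative⁻¹ 1ℚ) 1≤sum))))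
      eq : ∣ root m ℚ.- root n ∣ ℚ.* ∣ sum ∣ ≡ r ℚ.* ∣ e m ℚ.- e n ∣
      eq = trans (sym (ℚ.∣p*q∣≡∣p∣*∣q∣ (root m ℚ.- root n) sum))
        (trans (cong ∣_∣ (trans
          (solve 3 (λ x y r → (x :- y) :* (x :+ y) := (x :* x :- r) :- (y :* y :- r)) refl (root m) (root n) r)
          (trans (cong₂ ℚ._-_ (square m) (square n))
            (solve 3 (λ r x y → :- (r :* x) :- :- (r :* y) := :- (r :* (x :- y))) refl r (e m) (e n)))))
        (trans (ℚ.∣-p∣≡∣p∣ _) (trans (ℚ.∣p*q∣≡∣p∣*∣q∣ r (e m ℚ.- e n))
          (cong (ℚ._* ∣ e m ℚ.- e n ∣) (ℚ.0≤p⇒∣p∣≡p r≥0)))))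

  √ : ℝ
  √ = mkℝ root root-cauchy

≤! : ∀ {p q} {p≤q : True (p ℚ.≤? q)} → p ℚ.≤ q
≤! {p≤q = p≤q} = toWitness p≤q

<! : ∀ {p q} {p<q : True (p ℚ.<? q)} → p ℚ.< q
<! {p<q = p<q} = toWitness p<q

module √3  = SquareRoot (ι (+ 3))  (+ 1 ℚ./ 3)  (+ 3 ℚ./ 2) refl ≤! ≤! ≤! ≤! <!
module √5  = SquareRoot (ι (+ 5))  (+ 1 ℚ./ 5)  (ι (+ 2))   refl ≤! ≤! ≤! ≤! <!
module √33 = SquareRoot (ι (+ 33)) (+ 1 ℚ./ 33) (ι (+ 5))   refl ≤! ≤! ≤! ≤! <!

-- The plane over ℚ(√3, √5, √33)

Vector : Set
Vector = Vec ℤ 8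

_⊖_ : ∀ {n} → Vec ℤ n → Vec ℤ n → Vec ℤ n
_⊖_ = zipWith ℤ._-_

-- The common denominator 36 · 8 of the matrices below: 36 comes from the term √33 √-3 / 36 of ωη²,
-- and 8 from ω₄.
scale : ℕ
scale = 288

1/scale : ℚ
1/scale = + 1 ℚ./ scale

fromℤ : ℤ → ℝ
fromℤ = fromℚ ∘ ι

surd : ℤ → ℤ → ℤ → ℤ → ℝ
surd a b c d = (fromℤ a + fromℤ b * √33.√) + (fromℤ c + fromℤ d * √33.√) * √5.√

-- The complex number (x + y √-3) / scale, where x and y have the given coordinates with
-- respect to 1, √33, √5, √165.
⟦_⟧ᵖ : Vector → Point
⟦ x₀ ∷ x₁ ∷ x₂ ∷ x₃ ∷ y₀ ∷ y₁ ∷ y₂ ∷ y₃ ∷ [] ⟧ᵖ =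
  fromℚ 1/scale * surd x₀ x₁ x₂ x₃ , fromℚ 1/scale * (√3.√ * surd y₀ y₁ y₂ y₃)

-- For s² = m and t² = n, the square of a + b s + (c + d s) t has the coordinates
-- q₀, 2 q₁, 2 q₂, 2 q₃ with respect to 1, s, t, s t.
module Square {A : Set} (_+_ _*_ : A → A → A) (m n a b c d : A) where
  q₀ q₁ q₂ q₃ : A
  q₀ = ((a * a) + (m * (b * b))) + (n * ((c * c) + (m * (d * d))))
  q₁ = (a * b) + (n * (c * d))
  q₂ = (a * c) + (m * (b * d))
  q₃ = (a * d) + (b * c)

module Squareᶻ = Square ℤ._+_ ℤ._*_ (+ 33) (+ 5)
module Squareᑫ = Square ℚ._+_ ℚ._*_

_+3*_ : ℤ → ℤ → ℤ
m +3* n = m ℤ.+ + 3 ℤ.* n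

-- The squared length is x² + 3 y². Comparing its coefficients, with the factor 2 of the mixed ones
-- dropped, turns unit length into a decidable statement about integers.
IsUnit : Vector → Set
IsUnit (x₀ ∷ x₁ ∷ x₂ ∷ x₃ ∷ y₀ ∷ y₁ ∷ y₂ ∷ y₃ ∷ []) =
  X.q₀ +3* Y.q₀ ≡ + (scale ℕ.* scale) ×
  X.q₁ +3* Y.q₁ ≡ + 0 × X.q₂ +3* Y.q₂ ≡ + 0 × X.q₃ +3* Y.q₃ ≡ + 0
  where
  module X = Squareᶻ x₀ x₁ x₂ x₃
  module Y = Squareᶻ y₀ y₁ y₂ y₃

isUnit? : ∀ v → Dec (IsUnit v)
isUnit? (_ ∷ _ ∷ _ ∷ _ ∷ _ ∷ _ ∷ _ ∷ _ ∷ []) =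
  (_ ℤ.≟ _) ×-dec (_ ℤ.≟ _) ×-dec (_ ℤ.≟ _) ×-dec (_ ℤ.≟ _)

-- f is a variable because ι unfolds, which would prevent Agda from inferring i and j from
-- f (i + j).
module RingMap (f : ℤ → ℚ) (f-+ : ∀ i j → f (i ℤ.+ j) ≡ f i ℚ.+ f j)
               (f-* : ∀ i j → f (i ℤ.* j) ≡ f i ℚ.* f j) where

  _⊕_ : ∀ {i j p q} → f i ≡ p → f j ≡ q → f (i ℤ.+ j) ≡ p ℚ.+ q
  _⊕_ {i} {j} refl refl = f-+ i j

  _⊗_ : ∀ {i j p q} → f i ≡ p → f j ≡ q → f (i ℤ.* j) ≡ p ℚ.* q
  _⊗_ {i} {j} refl refl = f-* i j

  module _ (a b c d : ℤ) where
    module Z = Squareᶻ a b c d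
    module Q = Squareᑫ (f (+ 33)) (f (+ 5)) (f a) (f b) (f c) (f d)
    q₀-map : f Z.q₀ ≡ Q.q₀
    q₀-map = ((refl ⊗ refl) ⊕ (refl ⊗ (refl ⊗ refl))) ⊕ (refl ⊗ ((refl ⊗ refl) ⊕ (refl ⊗ (refl ⊗ refl))))
    q₁-map : f Z.q₁ ≡ Q.q₁
    q₁-map = (refl ⊗ refl) ⊕ (refl ⊗ (refl ⊗ refl))
    q₂-map : f Z.q₂ ≡ Q.q₂
    q₂-map = (refl ⊗ refl) ⊕ (refl ⊗ (refl ⊗ refl))
    q₃-map : f Z.q₃ ≡ Q.q₃
    q₃-map = (refl ⊗ refl) ⊕ (refl ⊗ refl)

  +3*-map : ∀ {i j k p q} → f i ≡ p → f j ≡ q → i +3* j ≡ k → p ℚ.+ f (+ 3) ℚ.* q ≡ f k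
  +3*-map α β refl = sym (α ⊕ (refl ⊗ β))

  module _ (x₀ x₁ x₂ x₃ y₀ y₁ y₂ y₃ : ℤ) where
    module X = Squareᑫ (f (+ 33)) (f (+ 5)) (f x₀) (f x₁) (f x₂) (f x₃)
    module Y = Squareᑫ (f (+ 33)) (f (+ 5)) (f y₀) (f y₁) (f y₂) (f y₃)
    unit-map : IsUnit (x₀ ∷ x₁ ∷ x₂ ∷ x₃ ∷ y₀ ∷ y₁ ∷ y₂ ∷ y₃ ∷ []) →
      X.q₀ ℚ.+ f (+ 3) ℚ.* Y.q₀ ≡ f (+ (scale ℕ.* scale)) ×
      X.q₁ ℚ.+ f (+ 3) ℚ.* Y.q₁ ≡ f (+ 0) ×
      X.q₂ ℚ.+ f (+ 3) ℚ.* Y.q₂ ≡ f (+ 0) ×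
      X.q₃ ℚ.+ f (+ 3) ℚ.* Y.q₃ ≡ f (+ 0)
    unit-map (h₀ , h₁ , h₂ , h₃) =
      +3*-map (q₀-map x₀ x₁ x₂ x₃) (q₀-map y₀ y₁ y₂ y₃) h₀ ,
      +3*-map (q₁-map x₀ x₁ x₂ x₃) (q₁-map y₀ y₁ y₂ y₃) h₁ ,
      +3*-map (q₂-map x₀ x₁ x₂ x₃) (q₂-map y₀ y₁ y₂ y₃) h₂ ,
      +3*-map (q₃-map x₀ x₁ x₂ x₃) (q₃-map y₀ y₁ y₂ y₃) h₃

module Norm (m n k s t c r : ℚ) where

  value : ℚ → ℚ → ℚ → ℚ → ℚ
  value a b c d = (a ℚ.+ b ℚ.* s) ℚ.+ (c ℚ.+ d ℚ.* s) ℚ.* t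

  excess-s : ℚ → ℚ → ℚ
  excess-s b d = (b ℚ.* b ℚ.+ n ℚ.* (d ℚ.* d)) ℚ.+ (b ℚ.* d ℚ.+ b ℚ.* d) ℚ.* t

  excess-t : ℚ → ℚ → ℚ
  excess-t c d = (c ℚ.+ d ℚ.* s) ℚ.* (c ℚ.+ d ℚ.* s)

  s-part t-part : ℚ
  s-part = s ℚ.* s ℚ.- m
  t-part = t ℚ.* t ℚ.- n
  c-part : ℚ
  c-part = c ℚ.* c ℚ.- k

  -- Here s and t are rational approximations, so s² - m and t² - n do not vanish. The reduction of
  -- the square modulo these two keeps its multipliers explicit.
  square-value : ∀ a b c d →
    let open Squareᑫ m n a b c d
        x = q₁ ℚ.* s ℚ.+ (q₂ ℚ.* t ℚ.+ q₃ ℚ.* (s ℚ.* t))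
    in
    value a b c d ℚ.* value a b c d ≡
    (q₀ ℚ.+ (x ℚ.+ x)) ℚ.+ (excess-s b d ℚ.* s-part ℚ.+ excess-t c d ℚ.* t-part)
  square-value a b c d = solve 8 (λ m n a b c d s t →
    let v = (a :+ b :* s) :+ (c :+ d :* s) :* t
        q₀ = ((a :* a) :+ (m :* (b :* b))) :+ (n :* ((c :* c) :+ (m :* (d :* d))))
        q₁ = (a :* b) :+ (n :* (c :* d))
        q₂ = (a :* c) :+ (m :* (b :* d))
        q₃ = (a :* d) :+ (b :* c)
        x = q₁ :* s :+ (q₂ :* t :+ q₃ :* (s :* t))
    in v :* v := (q₀ :+ (x :+ x)) :+
      (((b :* b :+ n :* (d :* d)) :+ (b :* d :+ b :* d) :* t) :* (s :* s :- m) :+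
       ((c :+ d :* s) :* (c :+ d :* s)) :* (t :* t :- n))) refl m n a b c d s t

  -- The squared length minus 1 lies in the ideal generated by s² - m, t² - n and c² - k, with c
  -- standing for the approximation to √k. The cofactors are written out because they must be seen
  -- to be bounded when s, t and c run through their sequences.
  norm-value : ∀ x₀ x₁ x₂ x₃ y₀ y₁ y₂ y₃ N →
    let module X = Squareᑫ m n x₀ x₁ x₂ x₃
        module Y = Squareᑫ m n y₀ y₁ y₂ y₃
    in X.q₀ ℚ.+ k ℚ.* Y.q₀ ≡ N × X.q₁ ℚ.+ k ℚ.* Y.q₁ ≡ 0ℚ ×
       X.q₂ ℚ.+ k ℚ.* Y.q₂ ≡ 0ℚ × X.q₃ ℚ.+ k ℚ.* Y.q₃ ≡ 0ℚ → r ℚ.* r ℚ.* N ≡ 1ℚ →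
    let x = r ℚ.* value x₀ x₁ x₂ x₃
        y = r ℚ.* (c ℚ.* value y₀ y₁ y₂ y₃)
    in (r ℚ.* r ℚ.* (excess-s x₁ x₃ ℚ.+ k ℚ.* excess-s y₁ y₃)) ℚ.* s-part ℚ.+
       ((r ℚ.* r ℚ.* (excess-t x₂ x₃ ℚ.+ k ℚ.* excess-t y₂ y₃)) ℚ.* t-part ℚ.+
        (r ℚ.* r ℚ.* (value y₀ y₁ y₂ y₃ ℚ.* value y₀ y₁ y₂ y₃)) ℚ.* c-part) ≡
       (x ℚ.* x ℚ.+ y ℚ.* y) ℚ.- 1ℚ ℚ.* 1ℚ
  norm-value x₀ x₁ x₂ x₃ y₀ y₁ y₂ y₃ N (h₀ , h₁ , h₂ , h₃) hr = sym (begin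
    ((r ℚ.* V) ℚ.* (r ℚ.* V) ℚ.+ (r ℚ.* (c ℚ.* W)) ℚ.* (r ℚ.* (c ℚ.* W))) ℚ.- 1ℚ
      ≡⟨ cong (ℚ._- 1ℚ) (solve 5 (λ r c k V W →
           (r :* V) :* (r :* V) :+ (r :* (c :* W)) :* (r :* (c :* W)) :=
           r :* r :* (V :* V :+ k :* (W :* W)) :+ (r :* r :* (W :* W)) :* (c :* c :- k)) refl r c k V W) ⟩
    (r ℚ.* r ℚ.* (V ℚ.* V ℚ.+ k ℚ.* (W ℚ.* W)) ℚ.+ C) ℚ.- 1ℚ
      ≡⟨ cong (λ q → (r ℚ.* r ℚ.* q ℚ.+ C) ℚ.- 1ℚ)
           (cong₂ (λ p q → p ℚ.+ k ℚ.* q) (square-value x₀ x₁ x₂ x₃) (square-value y₀ y₁ y₂ y₃)) ⟩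
    (r ℚ.* r ℚ.* (((X.q₀ ℚ.+ (μ ℚ.+ μ)) ℚ.+ (Sx ℚ.* s-part ℚ.+ Tx ℚ.* t-part)) ℚ.+
      k ℚ.* ((Y.q₀ ℚ.+ (ν ℚ.+ ν)) ℚ.+ (Sy ℚ.* s-part ℚ.+ Ty ℚ.* t-part))) ℚ.+ C) ℚ.- 1ℚ
      ≡⟨ solve 14 (λ R k u v C p q x y Sx Tx Sy Ty one →
           (R :* (((p :+ (x :+ x)) :+ (Sx :* u :+ Tx :* v)) :+
             k :* ((q :+ (y :+ y)) :+ (Sy :* u :+ Ty :* v))) :+ C) :- one :=
           (R :* ((p :+ k :* q) :+ ((x :+ k :* y) :+ (x :+ k :* y))) :- one) :+
           ((R :* (Sx :+ k :* Sy)) :* u :+ ((R :* (Tx :+ k :* Ty)) :* v :+ C)))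
           refl (r ℚ.* r) k s-part t-part C X.q₀ Y.q₀ μ ν Sx Tx Sy Ty 1ℚ ⟩
    ((r ℚ.* r) ℚ.* ((X.q₀ ℚ.+ k ℚ.* Y.q₀) ℚ.+ ((μ ℚ.+ k ℚ.* ν) ℚ.+ (μ ℚ.+ k ℚ.* ν))) ℚ.- 1ℚ) ℚ.+ E
      ≡⟨ cong (ℚ._+ E) (cong₂ (λ p q → (r ℚ.* r) ℚ.* (p ℚ.+ (q ℚ.+ q)) ℚ.- 1ℚ) h₀ cross) ⟩
    ((r ℚ.* r) ℚ.* (N ℚ.+ (0ℚ ℚ.+ 0ℚ)) ℚ.- 1ℚ) ℚ.+ E
      ≡⟨ cong (λ q → (q ℚ.- 1ℚ) ℚ.+ E) (trans (cong ((r ℚ.* r) ℚ.*_) (ℚ.+-identityʳ N)) hr) ⟩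
    0ℚ ℚ.+ E
      ≡⟨ ℚ.+-identityˡ E ⟩
    E ∎)
    where
    open ≡-Reasoning
    module X = Squareᑫ m n x₀ x₁ x₂ x₃
    module Y = Squareᑫ m n y₀ y₁ y₂ y₃
    V W C μ ν Sx Tx Sy Ty E : ℚ
    V = value x₀ x₁ x₂ x₃
    W = value y₀ y₁ y₂ y₃
    C = (r ℚ.* r ℚ.* (W ℚ.* W)) ℚ.* c-part
    μ = X.q₁ ℚ.* s ℚ.+ (X.q₂ ℚ.* t ℚ.+ X.q₃ ℚ.* (s ℚ.* t))
    ν = Y.q₁ ℚ.* s ℚ.+ (Y.q₂ ℚ.* t ℚ.+ Y.q₃ ℚ.* (s ℚ.* t))
    Sx = excess-s x₁ x₃
    Tx = excess-t x₂ x₃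
    Sy = excess-s y₁ y₃
    Ty = excess-t y₂ y₃
    E = (r ℚ.* r ℚ.* (Sx ℚ.+ k ℚ.* Sy)) ℚ.* s-part ℚ.+ ((r ℚ.* r ℚ.* (Tx ℚ.+ k ℚ.* Ty)) ℚ.* t-part ℚ.+ C)
    cross : μ ℚ.+ k ℚ.* ν ≡ 0ℚ
    cross = trans
      (solve 9 (λ k a b c a′ b′ c′ s t →
        (a :* s :+ (b :* t :+ c :* (s :* t))) :+ k :* (a′ :* s :+ (b′ :* t :+ c′ :* (s :* t))) :=
        (a :+ k :* a′) :* s :+ ((b :+ k :* b′) :* t :+ (c :+ k :* c′) :* (s :* t)))
        refl k X.q₁ X.q₂ X.q₃ Y.q₁ Y.q₂ Y.q₃ s t)
      (trans (cong₂ ℚ._+_ (cong (ℚ._* s) h₁) (cong₂ ℚ._+_ (cong (ℚ._* t) h₂) (cong (ℚ._* (s ℚ.* t)) h₃)))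
        (cong₂ ℚ._+_ (ℚ.*-zeroˡ s) (cong₂ ℚ._+_ (ℚ.*-zeroˡ t) (ℚ.*-zeroˡ (s ℚ.* t)))))

module ι = RingMap ι ι-+ ι-*

ι-difference : ∀ i j → ι (i ℤ.- j) ≡ ι i ℚ.- ι j
ι-difference i j = trans (ι-+ i (ℤ.- j)) (cong (ι i ℚ.+_) (ι-neg j))

value-difference : ∀ s t p₀ p₁ p₂ p₃ q₀ q₁ q₂ q₃ →
  let value = λ a b c d → (a ℚ.+ b ℚ.* s) ℚ.+ (c ℚ.+ d ℚ.* s) ℚ.* t in
  value (ι (p₀ ℤ.- q₀)) (ι (p₁ ℤ.- q₁)) (ι (p₂ ℤ.- q₂)) (ι (p₃ ℤ.- q₃)) ≡
  value (ι p₀) (ι p₁) (ι p₂) (ι p₃) ℚ.- value (ι q₀) (ι q₁) (ι q₂) (ι q₃)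
value-difference s t p₀ p₁ p₂ p₃ q₀ q₁ q₂ q₃
  rewrite ι-difference p₀ q₀ | ι-difference p₁ q₁ | ι-difference p₂ q₂ | ι-difference p₃ q₃ =
  solve 10 (λ s t a b c d a′ b′ c′ d′ →
    let value = λ (a b c d : Polynomial 10) → (a :+ b :* s) :+ (c :+ d :* s) :* t in
    value (a :- a′) (b :- b′) (c :- c′) (d :- d′) := value a b c d :- value a′ b′ c′ d′)
    refl s t (ι p₀) (ι p₁) (ι p₂) (ι p₃) (ι q₀) (ι q₁) (ι q₂) (ι q₃)

*-distribˡ-- : ∀ r x y → r ℚ.* (x ℚ.- y) ≡ r ℚ.* x ℚ.- r ℚ.* y
*-distribˡ-- = solve 3 (λ r x y → r :* (x :- y) := r :* x :- r :* y) refl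

0≤1 : 0ℝ ≤ 1ℝ
0≤1 ε ε>0 = 0 , λ _ _ → ℚ.+-mono-≤-< {0ℚ} {1ℚ} (ℚ.nonNegative⁻¹ 1ℚ) ε>0

-- Termwise, the squared distance minus 1 is a combination of the null sequences s² - 33, t² - 5 and
-- c² - 3. The cofactors `A`, `B` and `C` are assembled as real numbers so that they are bounded. No
-- ring laws up to `_≈_` are involved, only identities in ℚ.
unit-distance : ∀ p q → IsUnit (p ⊖ q) → UnitDistance ⟦ p ⟧ᵖ ⟦ q ⟧ᵖ
unit-distance (p₀ ∷ p₁ ∷ p₂ ∷ p₃ ∷ p₄ ∷ p₅ ∷ p₆ ∷ p₇ ∷ [])
  (q₀ ∷ q₁ ∷ q₂ ∷ q₃ ∷ q₄ ∷ q₅ ∷ q₆ ∷ q₇ ∷ [])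
  unit = 0≤1 , ≈-sym {distance²} {1ℝ * 1ℝ} (null-cong termwise
    (null-+ (null-* A √33.square-null) (null-+ (null-* B √5.square-null) (null-* C √3.square-null))))
  where
  r : ℚ
  r = 1/scale
  x₀ x₁ x₂ x₃ y₀ y₁ y₂ y₃ : ℚ
  x₀ = ι (p₀ ℤ.- q₀)
  x₁ = ι (p₁ ℤ.- q₁)
  x₂ = ι (p₂ ℤ.- q₂)
  x₃ = ι (p₃ ℤ.- q₃)
  y₀ = ι (p₄ ℤ.- q₄)
  y₁ = ι (p₅ ℤ.- q₅)
  y₂ = ι (p₆ ℤ.- q₆)
  y₃ = ι (p₇ ℤ.- q₇)
  X Y distance² A B C : ℝ
  X = fromℚ r * surd p₀ p₁ p₂ p₃ - fromℚ r * surd q₀ q₁ q₂ q₃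
  Y = fromℚ r * (√3.√ * surd p₄ p₅ p₆ p₇) - fromℚ r * (√3.√ * surd q₄ q₅ q₆ q₇)
  distance² = X * X + Y * Y
  excess : ℚ → ℚ → ℝ
  excess b d = fromℚ (b ℚ.* b ℚ.+ ι (+ 5) ℚ.* (d ℚ.* d)) + fromℚ (b ℚ.* d ℚ.+ b ℚ.* d) * √5.√
  linear : ℚ → ℚ → ℝ
  linear c d = fromℚ c + fromℚ d * √33.√
  A = fromℚ (r ℚ.* r) * (excess x₁ x₃ + fromℚ (ι (+ 3)) * excess y₁ y₃)
  B = fromℚ (r ℚ.* r) * (linear x₂ x₃ * linear x₂ x₃ + fromℚ (ι (+ 3)) * (linear y₂ y₃ * linear y₂ y₃))
  C = fromℚ (r ℚ.* r) * (v * v)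
    where
    v : ℝ
    v = linear y₀ y₁ + linear y₂ y₃ * √5.√
  termwise : ∀ n → seq A n ℚ.* (√33.root n ℚ.* √33.root n ℚ.- ι (+ 33)) ℚ.+
    (seq B n ℚ.* (√5.root n ℚ.* √5.root n ℚ.- ι (+ 5)) ℚ.+
     seq C n ℚ.* (√3.root n ℚ.* √3.root n ℚ.- ι (+ 3))) ≡
    seq distance² n ℚ.- 1ℚ ℚ.* 1ℚ
  termwise n = trans
    (Norm.norm-value (ι (+ 33)) (ι (+ 5)) (ι (+ 3)) s t c r x₀ x₁ x₂ x₃ y₀ y₁ y₂ y₃ _
      (ι.unit-map (p₀ ℤ.- q₀) (p₁ ℤ.- q₁) (p₂ ℤ.- q₂) (p₃ ℤ.- q₃)
                  (p₄ ℤ.- q₄) (p₅ ℤ.- q₅) (p₆ ℤ.- q₆) (p₇ ℤ.- q₇) unit) refl)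
    (cong (ℚ._- 1ℚ ℚ.* 1ℚ) (cong₂ ℚ._+_ (cong₂ ℚ._*_ x-eq x-eq) (cong₂ ℚ._*_ y-eq y-eq)))
    where
    s t c : ℚ
    s = √33.root n
    t = √5.root n
    c = √3.root n
    open Norm (ι (+ 33)) (ι (+ 5)) (ι (+ 3)) s t c r using (value)
    P Q P′ Q′ : ℚ
    P  = value (ι p₀) (ι p₁) (ι p₂) (ι p₃)
    Q  = value (ι q₀) (ι q₁) (ι q₂) (ι q₃)
    P′ = value (ι p₄) (ι p₅) (ι p₆) (ι p₇)
    Q′ = value (ι q₄) (ι q₅) (ι q₆) (ι q₇)
    x-eq : r ℚ.* value x₀ x₁ x₂ x₃ ≡ seq X n
    x-eq = trans (cong (r ℚ.*_) (value-difference s t p₀ p₁ p₂ p₃ q₀ q₁ q₂ q₃)) (*-distribˡ-- r P Q)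
    y-eq : r ℚ.* (c ℚ.* value y₀ y₁ y₂ y₃) ≡ seq Y n
    y-eq = trans
      (cong (λ v → r ℚ.* (c ℚ.* v)) (value-difference s t p₄ p₅ p₆ p₇ q₄ q₅ q₆ q₇))
      (trans (cong (r ℚ.*_) (*-distribˡ-- c P′ Q′)) (*-distribˡ-- r (c ℚ.* P′) (c ℚ.* Q′)))

-- Colour domains

data Domain : Set where
  dom : (a b c d : Bool) → Domain

_∋_ : Domain → Fin 4 → Set
dom a b c d ∋ 0F = T a
dom a b c d ∋ 1F = T b
dom a b c d ∋ 2F = T c
dom a b c d ∋ 3F = T d

full : Domain
full = dom true true true true

full-∋ : ∀ x → full ∋ x
full-∋ 0F = tt
full-∋ 1F = tt
full-∋ 2F = tt
full-∋ 3F = tt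

isEmpty : Domain → Bool
isEmpty (dom a b c d) = not (a ∨ b ∨ c ∨ d)

isEmpty-∌ : ∀ D {x} → T (isEmpty D) → ¬ D ∋ x
isEmpty-∌ (dom false false false false) {0F} _ ()
isEmpty-∌ (dom false false false false) {1F} _ ()
isEmpty-∌ (dom false false false false) {2F} _ ()
isEmpty-∌ (dom false false false false) {3F} _ ()

_⊆_ : Domain → Domain → Bool
dom a b c d ⊆ dom a′ b′ c′ d′ =
  (not a ∨ a′) ∧ (not b ∨ b′) ∧ (not c ∨ c′) ∧ (not d ∨ d′)

implies : ∀ {x y} → T (not x ∨ y) → T x → T y
implies {true} y _ = y

⊆-∋ : ∀ D E {x} → T (D ⊆ E) → D ∋ x → E ∋ x
⊆-∋ (dom a b c d) (dom a′ b′ c′ d′) {x} s = go x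
  where
  ab : T (not a ∨ a′) × T ((not b ∨ b′) ∧ (not c ∨ c′) ∧ (not d ∨ d′))
  ab = Equivalence.to T-∧ s
  bc : T (not b ∨ b′) × T ((not c ∨ c′) ∧ (not d ∨ d′))
  bc = Equivalence.to T-∧ (proj₂ ab)
  cd : T (not c ∨ c′) × T (not d ∨ d′)
  cd = Equivalence.to T-∧ (proj₂ bc)
  go : ∀ x → dom a b c d ∋ x → dom a′ b′ c′ d′ ∋ x
  go 0F = implies (proj₁ ab)
  go 1F = implies (proj₁ bc)
  go 2F = implies (proj₁ cd)
  go 3F = implies (proj₂ cd)

_∖_ : Domain → Domain → Domain
dom a b c d ∖ dom a′ b′ c′ d′ =
  dom (a ∧ not a′) (b ∧ not b′) (c ∧ not c′) (d ∧ not d′)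

∖-∋ : ∀ D E {x} → D ∋ x → ¬ E ∋ x → (D ∖ E) ∋ x
∖-∋ (dom _ _ _ _) (dom _ _ _ _) {x} = go x
  where
  differ : ∀ {p q} → T p → ¬ T q → T (p ∧ not q)
  differ {true} {false} _ _  = tt
  differ {true} {true}  _ ¬q = ⊥-elim (¬q tt)
  go : ∀ {a b c d a′ b′ c′ d′} x → dom a b c d ∋ x → ¬ dom a′ b′ c′ d′ ∋ x →
       (dom a b c d ∖ dom a′ b′ c′ d′) ∋ x
  go 0F = differ
  go 1F = differ
  go 2F = differ
  go 3F = differ

only : Domain → Maybe (Fin 4)
only (dom true  false false false) = just 0F
only (dom false true  false false) = just 1F
only (dom false false true  false) = just 2F
only (dom false false false true ) = just 3F
only _                             = nothing

singleton : Fin 4 → Domain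
singleton 0F = dom true false false false
singleton 1F = dom false true false false
singleton 2F = dom false false true false
singleton 3F = dom false false false true

only-singleton : ∀ D {c} → only D ≡ just c → D ≡ singleton c
only-singleton (dom true  false false false) refl = refl
only-singleton (dom false true  false false) refl = refl
only-singleton (dom false false true  false) refl = refl
only-singleton (dom false false false true ) refl = refl
only-singleton (dom false false false false) ()
only-singleton (dom false false true  true ) ()
only-singleton (dom false true  false true ) ()
only-singleton (dom false true  true  _    ) ()
only-singleton (dom true  false false true ) ()
only-singleton (dom true  false true  _    ) ()
only-singleton (dom true  true  _     _    ) ()

singleton-∋ : ∀ c x → singleton c ∋ x → x ≡ c
singleton-∋ 0F 0F _ = refl
singleton-∋ 0F 1F ()
singleton-∋ 0F 2F ()
singleton-∋ 0F 3F ()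
singleton-∋ 1F 0F ()
singleton-∋ 1F 1F _ = refl
singleton-∋ 1F 2F ()
singleton-∋ 1F 3F ()
singleton-∋ 2F 0F ()
singleton-∋ 2F 1F ()
singleton-∋ 2F 2F _ = refl
singleton-∋ 2F 3F ()
singleton-∋ 3F 0F ()
singleton-∋ 3F 1F ()
singleton-∋ 3F 2F ()
singleton-∋ 3F 3F _ = refl

only-∋ : ∀ D {c x} → only D ≡ just c → D ∋ x → x ≡ c
only-∋ D {c} {x} eq with refl ← only-singleton D eq = singleton-∋ c x

∋-singleton : ∀ c → singleton c ∋ c
∋-singleton 0F = tt
∋-singleton 1F = tt
∋-singleton 2F = tt
∋-singleton 3F = tt

exclude : Domain → Domain → Domain
exclude N D = maybe (λ c → D ∖ singleton c) D (only N)

exclude-∋ : ∀ N D {x y} → N ∋ x → D ∋ y → x ≢ y → exclude N D ∋ y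
exclude-∋ N D x∈N y∈D x≢y with only N | only-∋ N
... | nothing | _  = y∈D
... | just c  | eq = ∖-∋ D (singleton c) y∈D
  λ y∈c → x≢y (trans (eq refl x∈N) (sym (singleton-∋ c _ y∈c)))

swap₂₃ : Fin 4 → Fin 4
swap₂₃ 0F = 0F
swap₂₃ 1F = 1F
swap₂₃ 2F = 3F
swap₂₃ 3F = 2F

swap₂₃-involutive : ∀ x → swap₂₃ (swap₂₃ x) ≡ x
swap₂₃-involutive 0F = refl
swap₂₃-involutive 1F = refl
swap₂₃-involutive 2F = refl
swap₂₃-involutive 3F = refl

swapDomain : Domain → Domain
swapDomain (dom a b c d) = dom a b d c

swapDomain-∋ : ∀ D x → swapDomain D ∋ x → D ∋ swap₂₃ x
swapDomain-∋ (dom _ _ _ _) 0F h = h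
swapDomain-∋ (dom _ _ _ _) 1F h = h
swapDomain-∋ (dom _ _ _ _) 2F h = h
swapDomain-∋ (dom _ _ _ _) 3F h = h

-- Tables indexed by bit vectors

data Trie (A : Set) : ℕ → Set where
  empty : ∀ {n} → Trie A n
  leaf  : A → Trie A zero
  node  : ∀ {n} → Trie A n → Trie A n → Trie A (suc n)

module _ {A : Set} (default : A) where

  get : ∀ {n} → Trie A n → Vec Bool n → A
  get empty      _           = default
  get (leaf a)   []          = a
  get (node l r) (false ∷ v) = get l v
  get (node l r) (true  ∷ v) = get r v

set : ∀ {A : Set} {n} → Vec Bool n → A → Trie A n → Trie A n
set []          a _          = leaf a
set (false ∷ v) a empty      = node (set v a empty) empty
set (false ∷ v) a (node l r) = node (set v a l) r
set (true  ∷ v) a empty      = node empty (set v a empty)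
set (true  ∷ v) a (node l r) = node l (set v a r)

-- Stated for a pointwise predicate, so that keys never have to be compared. The soundness of a
-- state and the validity of a database are both of this form.
get-set : ∀ {A : Set} (default : A) {n} (P : Vec Bool n → A → Set) t v {a} → P v a →
          (∀ w → P w (get default t w)) → ∀ w → P w (get default (set v a t) w)
get-set d P t          []                 p h []          = p
get-set d P empty      (false ∷ v) p h (false ∷ w) = get-set d (P ∘ (false ∷_)) empty v p (h ∘ (false ∷_)) w
get-set d P empty      (false ∷ v) p h (true  ∷ w) = h (true ∷ w)
get-set d P (node l r) (false ∷ v) p h (false ∷ w) = get-set d (P ∘ (false ∷_)) l v p (h ∘ (false ∷_)) w
get-set d P (node l r) (false ∷ v) p h (true  ∷ w) = h (true ∷ w)
get-set d P empty      (true ∷ v)  p h (false ∷ w) = h (false ∷ w)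
get-set d P empty      (true ∷ v)  p h (true  ∷ w) = get-set d (P ∘ (true ∷_)) empty v p (h ∘ (true ∷_)) w
get-set d P (node l r) (true ∷ v)  p h (false ∷ w) = h (false ∷ w)
get-set d P (node l r) (true ∷ v)  p h (true  ∷ w) = get-set d (P ∘ (true ∷_)) r v p (h ∘ (true ∷_)) w

-- Decoding of certificates

bits : ∀ n → ℕ → Vec Bool n
bits zero    k = []
bits (suc n) k = (k ℕ.% 2 ≡ᵇ 1) ∷ bits n (k ℕ./ 2)

-- Least significant digit first; the most significant digit is the sentinel 1.
digits : (b : ℕ) .{{_ : NonZero b}} → ℕ → List ℕ
digits b = go 2000
  where
  go : ℕ → ℕ → List ℕ
  go zero    _ = []
  go (suc f) 1 = []
  go (suc f) k = k ℕ.% b ∷ go f (k ℕ./ b)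

Vertex : ℕ → Set
Vertex n = Vec Bool (2 ℕ.+ n)

-- The first two bits of a vertex, read as a number below 3, count the rotations
-- by 120° that carry a representative of its orbit to it. Vertices with both bits set are
-- fixed and have no neighbours listed; they stand for the origin.
rot : ∀ {n} → Vertex n → Vertex n
rot (false ∷ false ∷ v) = true  ∷ false ∷ v
rot (true  ∷ false ∷ v) = false ∷ true  ∷ v
rot (false ∷ true  ∷ v) = false ∷ false ∷ v
rot (true  ∷ true  ∷ v) = true  ∷ true  ∷ v

rot³ : ∀ {n} (v : Vertex n) → rot (rot (rot v)) ≡ v
rot³ (false ∷ false ∷ v) = refl
rot³ (true  ∷ false ∷ v) = refl
rot³ (false ∷ true  ∷ v) = refl
rot³ (true  ∷ true  ∷ v) = refl

Colouring : ℕ → Set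
Colouring n = Vertex n → Fin 4

-- The negation of a clause: a nogood claims that no admissible colouring takes, at all of the
-- listed vertices at once, colours in the listed domains.
Entry Nogood : ℕ → Set
Entry n = Vertex n × Domain
Nogood n = List (Entry n)

Matches : ∀ {n} → Colouring n → Nogood n → Set
Matches col = All λ (v , D) → D ∋ col v

toDomain : ℕ → Domain
toDomain k with bits 4 k
... | a ∷ b ∷ c ∷ d ∷ [] = dom a b c d

toNogood : ∀ n → ℕ → Nogood n
toNogood n k = List.map (λ e → bits (2 ℕ.+ n) (e ℕ.% 4096) , toDomain (e ℕ./ 4096)) (digits 65536 k)

data Step (n : ℕ) : Set where
  visit : Vertex n → Step n
  apply : Vec Bool 9 → (swapped : Bool) → (rotations : ℕ) → Step n

-- The code of `visit v` is 2 v; that of `apply i s r` is 1 + 2 (6 i + 2 r + s), with s = 1 for an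
-- exchange of colours 2 and 3.
toStep : ∀ n → ℕ → Step n
toStep n s = if s ℕ.% 2 ≡ᵇ 0 then visit (bits (2 ℕ.+ n) k)
             else apply (bits 9 (k ℕ./ 6)) (k ℕ.% 2 ≡ᵇ 1) ((k ℕ.% 6) ℕ./ 2)
  where
  k : ℕ
  k = s ℕ./ 2

-- Refutation by unit propagation

module Refutation {n : ℕ}
  (nbrs : Vertex n → List (Vertex n))
  (Admissible : Colouring n → Set)
  (proper : ∀ {col} → Admissible col → ∀ v → All (λ u → col u ≢ col v) (nbrs v))
  (rot-admissible : ∀ {col} → Admissible col → Admissible (col ∘ rot))
  (swap-admissible : ∀ {col} → Admissible col → Admissible (swap₂₃ ∘ col))
  where

  Valid : Nogood n → Set
  Valid ℓ = ∀ col → Admissible col → ¬ Matches col ℓ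

  rotate : ℕ → Nogood n → Nogood n
  rotate zero    ℓ = ℓ
  rotate (suc k) ℓ = rotate k (List.map (λ (v , D) → rot v , D) ℓ)

  -- If `col` matched the rotated nogood, then `col ∘ rot`, which is again admissible, would match
  -- the original. In this way a single certificate serves for all images of a lemma.
  rotate-valid : ∀ k {ℓ} → Valid ℓ → Valid (rotate k ℓ)
  rotate-valid zero    h = h
  rotate-valid (suc k) h = rotate-valid k λ col ok m → h (col ∘ rot) (rot-admissible ok) (map⁻ m)

  recolour : Bool → Nogood n → Nogood n
  recolour false ℓ = ℓ
  recolour true  ℓ = List.map (λ (v , D) → v , swapDomain D) ℓ

  recolour-valid : ∀ s {ℓ} → Valid ℓ → Valid (recolour s ℓ)
  recolour-valid false h = h
  recolour-valid true  h col ok m = h (swap₂₃ ∘ col) (swap-admissible ok)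
    (All.map (λ { {v , D} → swapDomain-∋ D (col v) }) (map⁻ m))

  State : Set
  State = Trie Domain (2 ℕ.+ n)

  _at_ : State → Vertex n → Domain
  σ at v = get full σ v

  Sound : Colouring n → State → Set
  Sound col σ = ∀ v → (σ at v) ∋ col v

  narrow : State → List (Vertex n) → Domain → Domain
  narrow σ []       D = D
  narrow σ (u ∷ us) D = narrow σ us (exclude (σ at u) D)

  narrow-∋ : ∀ {col σ} → Sound col σ → ∀ {us D c} →
             All (λ u → col u ≢ c) us → D ∋ c → narrow σ us D ∋ c
  narrow-∋ sound []       c∈D = c∈D
  narrow-∋ {σ = σ} sound {u ∷ us} {D} (≢c ∷ r) c∈D =
    narrow-∋ sound r (exclude-∋ (σ at u) D (sound u) c∈D ≢c)

  data Outcome : Set where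
    conflict stuck : Outcome
    exclusion      : Vertex n → Domain → Outcome

  Correct : Colouring n → Outcome → Set
  Correct col conflict        = ⊥
  Correct col stuck           = ⊤
  Correct col (exclusion v D) = ¬ D ∋ col v

  satisfied : State → Entry n → Bool
  satisfied σ (v , D) = (σ at v) ⊆ D

  -- The unit rule. An entry is certain once the domain of the state at its vertex lies within its
  -- own. If all entries are certain, the nogood is contradicted; if all but one are, the remaining
  -- one must fail.
  resolve : State → Nogood n → Outcome
  resolve σ []      = conflict
  resolve σ (e ∷ ℓ) =
    if satisfied σ e then resolve σ ℓ
    else if all (satisfied σ) ℓ then exclusion (proj₁ e) (proj₂ e)
    else stuck

  satisfied-∋ : ∀ col σ → Sound col σ → ∀ e → T (satisfied σ e) → proj₂ e ∋ col (proj₁ e)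
  satisfied-∋ col σ sound (v , D) s = ⊆-∋ (σ at v) D s (sound v)

  resolve-correct : ∀ col σ → Sound col σ → ∀ ℓ → ¬ Matches col ℓ → Correct col (resolve σ ℓ)
  resolve-correct col σ sound [] ¬m = ¬m []
  resolve-correct col σ sound (e ∷ ℓ) ¬m with satisfied σ e in eq
  ... | true  = resolve-correct col σ sound ℓ λ m → ¬m (satisfied-∋ col σ sound e (subst T (sym eq) tt) ∷ m)
  ... | false with all (satisfied σ) ℓ in eq′
  ...   | true  = λ e∋ → ¬m (e∋ ∷ All.map (λ {x} → satisfied-∋ col σ sound x)
                    (all⁺ (satisfied σ) ℓ (subst T (sym eq′) tt)))
  ...   | false = tt

  Database : Set
  Database = Trie (Maybe (Nogood n)) 9

  ValidEntry : Maybe (Nogood n) → Set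
  ValidEntry nothing  = ⊤
  ValidEntry (just ℓ) = Valid ℓ

  Justified : Database → Set
  Justified db = ∀ i → ValidEntry (get nothing db i)

  recall : Database → Vec Bool 9 → Bool → ℕ → State → Outcome
  recall db i s k σ = maybe (λ ℓ → resolve σ (rotate k (recolour s ℓ))) stuck (get nothing db i)

  recall-correct : ∀ {db} → Justified db → ∀ i s k {col σ} → Admissible col → Sound col σ →
                   Correct col (recall db i s k σ)
  recall-correct {db} valid i s k ok sound with get nothing db i | valid i
  ... | nothing | _ = tt
  ... | just ℓ  | v = resolve-correct _ _ sound (rotate k (recolour s ℓ))
                        (rotate-valid k (recolour-valid s v) _ ok)

  update : State → Vertex n → Domain → (State → Bool) → Bool
  update σ v D continue = if isEmpty D then true else continue (set v D σ)

  update-sound : ∀ {col σ} → Sound col σ → ∀ v D continue → D ∋ col v →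
                 (∀ {σ} → Sound col σ → ¬ T (continue σ)) → ¬ T (update σ v D continue)
  update-sound {col} {σ} sound v D continue D∋ k t with isEmpty D in eq
  ... | true  = isEmpty-∌ D (subst T (sym eq) tt) D∋
  ... | false = k {set v D σ} (get-set full (λ v D → D ∋ col v) σ v D∋ sound) t

  -- Success means an emptied domain or a nogood all of whose entries are certain; `stuck` and an
  -- exhausted list count as failure, so a faulty certificate can only be rejected.
  propagate : Database → List (Step n) → State → Bool
  finish : Database → List (Step n) → State → Outcome → Bool
  propagate db []                  σ = false
  propagate db (visit v ∷ ss)      σ = update σ v (narrow σ (nbrs v) (σ at v)) (propagate db ss)
  propagate db (apply i s k ∷ ss)  σ = finish db ss σ (recall db i s k σ)
  finish db ss σ conflict        = true
  finish db ss σ stuck           = false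
  finish db ss σ (exclusion v D) = update σ v ((σ at v) ∖ D) (propagate db ss)

  propagate-sound : ∀ {db} → Justified db → ∀ ss {col σ} → Admissible col → Sound col σ →
                    ¬ T (propagate db ss σ)
  finish-sound : ∀ {db} → Justified db → ∀ ss {col σ} → Admissible col → Sound col σ →
                 ∀ o → Correct col o → ¬ T (finish db ss σ o)
  propagate-sound {db} valid (visit v ∷ ss) {col} {σ} ok sound =
    update-sound sound v _ (propagate db ss)
      (narrow-∋ sound (proper ok v) (sound v)) (propagate-sound valid ss ok)
  propagate-sound {db} valid (apply i s k ∷ ss) {col} {σ} ok sound =
    finish-sound valid ss ok sound (recall db i s k σ) (recall-correct {db} valid i s k ok sound)
  finish-sound {db} valid ss {col} {σ} ok sound (exclusion v D) v∉D =
    update-sound sound v _ (propagate db ss)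
      (∖-∋ (σ at v) D (sound v) v∉D) (propagate-sound valid ss ok)

  initial : Nogood n → State → State
  initial []            σ = σ
  initial ((v , D) ∷ ℓ) σ = initial ℓ (set v D σ)

  initial-sound : ∀ {col} ℓ σ → Matches col ℓ → Sound col σ → Sound col (initial ℓ σ)
  initial-sound []            σ []      sound = sound
  initial-sound {col} ((v , D) ∷ ℓ) σ (m ∷ ms) sound =
    initial-sound ℓ (set v D σ) ms (get-set full (λ v D → D ∋ col v) σ v m sound)

  refutes : Database → Nogood n → ℕ → Bool
  refutes db ℓ ss = propagate db (List.map (toStep n) (digits 4096 ss)) (initial ℓ empty)

  refutes-valid : ∀ {db} → Justified db → ∀ ℓ ss → T (refutes db ℓ ss) → Valid ℓ
  refutes-valid valid ℓ ss t col ok m =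
    propagate-sound valid (List.map (toStep n) (digits 4096 ss)) ok
      (initial-sound ℓ empty m (λ v → full-∋ (col v))) t

  verify : Database → ℕ → List (ℕ × ℕ) → Nogood n → ℕ → Bool
  verify db i []             goal gs = refutes db goal gs
  verify db i ((l , s) ∷ ls) goal gs =
    refutes db (toNogood n l) s ∧ verify (set (bits 9 i) (just (toNogood n l)) db) (suc i) ls goal gs

  record-valid : ∀ {db} → Justified db → ∀ i {ℓ} → Valid ℓ → Justified (set (bits 9 i) (just ℓ) db)
  record-valid {db} valid i v = get-set nothing (λ _ → ValidEntry) db (bits 9 i) v valid

  verify-valid : ∀ {db} → Justified db → ∀ i ls goal gs → T (verify db i ls goal gs) → Valid goal
  verify-valid valid i []             goal gs t = refutes-valid valid goal gs t
  verify-valid valid i ((l , s) ∷ ls) goal gs t with Equivalence.to T-∧ t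
  ... | p , q = verify-valid (record-valid valid i (refutes-valid valid (toNogood n l) s p))
                  (suc i) ls goal gs q

  load : ℕ → Database → List (Nogood n) → ℕ × Database
  load i db []       = i , db
  load i db (ℓ ∷ ls) = load (suc i) (set (bits 9 i) (just ℓ) db) ls

  load-valid : ∀ i {db ls} → Justified db → All Valid ls → Justified (proj₂ (load i db ls))
  load-valid i valid []       = valid
  load-valid i valid (v ∷ vs) = load-valid (suc i) (record-valid valid i v) vs

  check : List (Nogood n) → List (ℕ × ℕ) → Nogood n → ℕ → Bool
  check axioms ls goal gs = let i , db = load 0 empty axioms in verify db i ls goal gs

  -- With `refl` for the last argument, type checking replays the certificate. Soundness does not
  -- depend on the decoding: each lemma is refuted in decoded form before it is stored, and only
  -- axioms and stored lemmas can be recalled.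
  check-valid : ∀ {axioms} → All Valid axioms → ∀ ls goal gs → check axioms ls goal gs ≡ true → Valid goal
  check-valid {axioms} vs ls goal gs eq =
    verify-valid (load-valid 0 {empty} (λ _ → tt) vs) (proj₁ (load 0 empty axioms)) ls goal gs
      (Equivalence.from T-≡ eq)

-- Graphs with a threefold symmetry

Point₄ : Set
Point₄ = Vec ℤ 4

-- Multiplication by ω² on pairs of Eisenstein integers a + b ω, where ω² = ω - 1.
turn : Point₄ → Point₄
turn (a ∷ b ∷ c ∷ d ∷ []) = ℤ.- (a ℤ.+ b) ∷ a ∷ ℤ.- (c ℤ.+ d) ∷ c ∷ []

coordinates : ∀ n → ℕ → Vec ℤ n
coordinates zero    k = []
coordinates (suc n) k = (k ℕ.% 256 ℤ.⊖ 128) ∷ coordinates n (k ℕ./ 256)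

Orbit : ℕ → Set
Orbit n = Point₄ × List (Vertex n)

-- Indices beyond the end of a table get no edges and lie at the centre of the graph, so they can
-- safely be included when all bit vectors are enumerated.
noOrbit : ∀ {n} → Orbit n
noOrbit = replicate 4 (+ 0) , []

toOrbit : ∀ n → ℕ × ℕ → Orbit n
toOrbit n (p , us) = coordinates 4 p , List.map (bits (2 ℕ.+ n)) (digits 4096 us)

orbits : ∀ n → ℕ → List (ℕ × ℕ) → Trie (Orbit n) n
orbits n i []       = empty
orbits n i (o ∷ os) = set (bits n i) (toOrbit n o) (orbits n (suc i) os)

module Graph₃ {n : ℕ} (table : Trie (Orbit n) n) where

  orbit : Vec Bool n → Orbit n
  orbit = get noOrbit table

  position : Vertex n → Point₄
  position (false ∷ false ∷ v) = proj₁ (orbit v)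
  position (true  ∷ false ∷ v) = turn (proj₁ (orbit v))
  position (false ∷ true  ∷ v) = turn (turn (proj₁ (orbit v)))
  position (true  ∷ true  ∷ v) = replicate 4 (+ 0)

  nbrs : Vertex n → List (Vertex n)
  nbrs (false ∷ false ∷ v) = proj₂ (orbit v)
  nbrs (true  ∷ false ∷ v) = List.map rot (proj₂ (orbit v))
  nbrs (false ∷ true  ∷ v) = List.map (rot ∘ rot) (proj₂ (orbit v))
  nbrs (true  ∷ true  ∷ v) = []

  Proper : Colouring n → Set
  Proper col = ∀ v → All (λ u → col u ≢ col v) (nbrs v)

  -- Neighbour lists rotate with the vertex by construction, so the claim at `v` is the hypothesis
  -- at `rot v`. Only where three rotations accumulate is `rot³` needed.
  rot-proper : ∀ {col} → Proper col → Proper (col ∘ rot)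
  rot-proper h (false ∷ false ∷ v) = map⁻ (h (true ∷ false ∷ v))
  rot-proper {col} h (true ∷ false ∷ v) = map⁺ (map⁻ (h (false ∷ true ∷ v)))
  rot-proper {col} h (false ∷ true ∷ v) = map⁺
    (All.map (λ {u} → subst (λ u → col u ≢ col (false ∷ false ∷ v)) (sym (rot³ u)))
      (h (false ∷ false ∷ v)))
  rot-proper h (true ∷ true ∷ v) = []

  recolour-proper : ∀ {π : Fin 4 → Fin 4} → Injective _≡_ _≡_ π → ∀ {col} → Proper col → Proper (π ∘ col)
  recolour-proper inj h v = All.map (λ ≢ eq → ≢ (inj eq)) (h v)

-- Certificates

-- In the tables, a vertex is the number j + 4 k if it is the j-th rotation of the k-th
-- representative. An orbit is listed as the coordinates of its representative, each increased
-- by 128 and written in base 256, and the neighbours of the representative. A lemma is a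
-- nogood, whose entries are vertex + 4096 · domain, and a list of propagation steps. The
-- lemmas were found by a clause-learning solver. In the spindle, the origin is the position
-- of three vertices, which form an ordinary orbit.

triangleOrbits : List (ℕ × ℕ)
triangleOrbits =
  (0x80808083 , 0x1) ∷
  (0x7f81827c , 0x12282202162101e61e41b91a818518416c15c14d144128125) ∷
  (0x7f80837e , 0x123422421c21920c1e91c61ac18a18816015214212c) ∷
  (0x7f81817d , 0x122c22120d1be1b417e17c16415415214813e) ∷
  (0x7f80847e , 0x124223221e2162121e21e01c11b218118016814413211c) ∷
  (0x7f80837f , 0x123e21113e13c0e0) ∷
  (0x807f8182 , 0x126424121420d1420ee) ∷
  (0x7e81847b , 0x12b529828827526c21c1c11a41541301080f80d8) ∷
  (0x7e81867a , 0x12b22482322201be1a41040f40e8) ∷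
  (0x7e80867d , 0x12b827824c22a1be1a81240ee0e0) ∷
  (0x7f82807a , 0x129425d22821c1c41690f40e9002) ∷
  (0x7f7f857f , 0x12a028c2742201b81281100ce001) ∷
  (0x7e82837a , 0x12a92802792512321c41b019d1040ec0e00cc) ∷
  (0x7e80877d , 0x12ae29028522c1b81080f00d0) ∷
  (0x807e8384 , 0x11c01381140d6) ∷
  (0x7e80877b , 0x12d82040f80c0) ∷
  (0x7e7f887f , 0x114c0ee0a4) ∷
  (0x7f80827f , 0x12e52c92a82a12802152141851801301240ce0cc0a4090086) ∷
  (0x7f81837c , 0x12e22ac29e27021a21818a0d10d008c089) ∷
  (0x80817f7d , 0x12f62a427d20e18917e12c1210d5094085) ∷
  (0x807f8181 , 0x12ec2e82d22ba29827821121018618112811e0da09a08a) ∷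
  (0x7f81827b , 0x13302681dc0f8094002) ∷
  (0x7f80837d , 0x132c2d82a82941b00f40ee09a092001) ∷
  (0x7f81807d , 0x13393142d92d42b01a91a40e90e009a090) ∷
  (0x7f80857d , 0x12621e81ae1a40e609408c) ∷
  (0x7e81857c , 0x134131d3052f12a129e1c41b815c0e80a4088084) ∷
  (0x7f82817b , 0x133e2dc2991e01c11bc1590f90f4089084) ∷
  (0x7f80827e , 0x13390b0072) ∷
  (0x80817e7d , 0x12392020b509a) ∷
  (0x807f8280 , 0x132c1fc1d80b60ae) ∷
  (0x7e818579 , 0x134832627026c2380ac064) ∷
  (0x81827a7d , 0x1281170059) ∷
  (0x827f7b87 , 0x131527615a0b2069) ∷
  (0x80807f7f , 0x137c3703443402e42982212201bc1b81861200f408608504e045) ∷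
  (0x8080817e , 0x138c38034233c2a021e21c1c41c018918211c0f80e808a08906a064051) ∷
  (0x807f8082 , 0x13853753311a417c0f00e608e08d056048) ∷
  (0x8081807d , 0x137837233832e2f22b92942322301b11a40ec0e909209105c059) ∷
  (0x7f808280 , 0x137d2651ae12c0f809609507404c002) ∷
  (0x81807d80 , 0x139238033832c2aa1aa1841290f50e109a09905d059002) ∷
  (0x7f81817b , 0x139936c2e824c1e01440d8068051) ∷
  (0x7f81807c , 0x11480d1064) ∷
  (0x7f80857c , 0x138c3783502e42502421e614c0ce064044) ∷
  (0x7e80857e , 0x13813652582011dc0d0078072054) ∷
  (0x7e828579 , 0x139137e2f12552381e01c814d0cc0c0058044) ∷
  (0x7e80877e , 0x13763602ed1e61440d805e050) ∷
  (0x8080807e , 0x139c2381d8099095) ∷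
  (0x80807e80 , 0x13a836832924509208e06d) ∷
  (0x7e80857c , 0x12c40e0064) ∷
  (0x7d81877b , 0x130011c0f80ac058) ∷
  (0x7e82817b , 0x138d30c2c92051300ec09c068) ∷
  (0x7f7e8680 , 0x13c43b42d8278168) ∷
  (0x80817f7c , 0x13c835434232c21621412911c0ac0a5045044030) ∷
  (0x807f8180 , 0x134834033021912e1200a803402a) ∷
  (0x7f80817f , 0x13ad35133d33420d20c04e04c020) ∷
  (0x7f81847b , 0x13ce33e3382122101301240b005105002401c) ∷
  (0x7f80827d , 0x13e43e23ad1b81ac108094034) ∷
  (0x7f81837a , 0x13e837836c2b21c41a810409a05c030024) ∷
  (0x7f828279 , 0x11b91a408406402d01c) ∷
  (0x7f7f8380 , 0x13ec3813703262b82501c61a409208805e02a020) ∷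
  (0x80817d7d , 0x13e43a437936c2941bc1b0090059030025) ∷
  (0x807f837f , 0x13e83d02c21c01b611408c056014) ∷
  (0x7e81837d , 0x13f13c538137131429809a084068058002) ∷
  (0x7e81877b , 0x14062d02a41c10c008806a02c01c001) ∷
  (0x7f7f8382 , 0x13d93d5200058056) ∷
  (0x81817d7e , 0x13de18c05d) ∷
  (0x7e81837a , 0x13ec3e43143100f40e0030020) ∷
  (0x7e818778 , 0x13e83482421580f803401c) ∷
  (0x7f7f867d , 0x13f03e83180ee0e8) ∷
  (0x7d80897d , 0x14000f80e8020) ∷
  (0x7f7f887f , 0x13e635015e0e604002c) ∷
  (0x83807783 , 0x128e0f5029) ∷
  (0x7f80817e , 0x13c038d32c3002c42750cc088051030010) ∷
  (0x7f81847a , 0x133027c17e08403400c) ∷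
  (0x807f827f , 0x13c43993382c826c1840d8086044024006) ∷
  (0x7e80857f , 0x14214113dd3412d027823e1840ce0bc09a05002c004) ∷
  (0x7e82857a , 0x13412fc0d1094028) ∷
  (0x7e82847b , 0x142633e30c28024218109004401c011) ∷
  (0x7e80867f , 0x1020) ∷
  (0x7f80867e , 0x10d604a008) ∷
  (0x817f7d82 , 0x13a136c17807106e006) ∷
  (0x81807e7f , 0x13a4378076019018012009) ∷
  (0x7e80847e , 0x13b02e81c11a816c09c010004) ∷
  (0x80827e7a , 0x11c41641610a9009) ∷
  (0x807e8282 , 0x14204183b22f02e41b81b216815e0ae010006) ∷
  (0x82807882 , 0x12fa2f41bc1ad15500d009) ∷
  (0x7f828178 , 0x14283a02a421c19d10408206801c) ∷
  (0x7f7f847e , 0x13f03482982201d506a020010) ∷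
  (0x7e81827c , 0x13ec2a121c064028004) ∷
  (0x7e818879 , 0x14303a634c29e22019810c07806402c) ∷
  (0x7e838477 , 0x14062ac22514805402d) ∷
  (0x7e7f8680 , 0x12a822a05802a010) ∷
  (0x7d82867a , 0x123205c020) ∷
  (0x82807783 , 0x14313a8295059031) ∷
  (0x80807f7e , 0x1379010) ∷
  (0x8080827d , 0x136c18e13c0dc0b6006) ∷
  (0x81807d7f , 0x14282ac2a51de1dc08c08604d04800c) ∷
  (0x817f7e81 , 0x143c41c2e82a829a1e013211e090089052044012010) ∷
  (0x807f7f82 , 0x14394343c92ec2e52b82a01e51e4128124098085051046006004) ∷
  (0x8081817c , 0x14302fa2e229c1ea12c09608a04e049009008) ∷
  (0x81817a7e , 0x123c0e1015) ∷
  (0x807e8680 , 0x12500c802a) ∷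
  (0x7f80847b , 0x145030e0d801c) ∷
  (0x7d828879 , 0x13051280d8024004) ∷
  (0x7e7f8781 , 0x14413a23561320ce032010) ∷
  (0x7f7f8483 , 0x13a5141010) ∷
  (0x8080807d , 0x146045c4503703380e809008c05c003002001) ∷
  (0x807f8080 , 0x14544103f03ec3391b21b00e009905e003) ∷
  (0x8081807b , 0x140d40938a3361f51b61b41520dc095061008003) ∷
  (0x7f808080 , 0x144c3f13ec37932d1a91a80ec092058003) ∷
  (0x81807b80 , 0x140e4093853302191f91ac14805500c003) ∷
  (0x7f7f8282 , 0x14003f837d34026c2151c11c014c0e608406402c006003) ∷
  (0x81817d7d , 0x147046c43642837236c2811c51c40f50ec084068021003) ∷
  (0x817e7e84 , 0x14684144023f837533c2111ba1b80fa08806a012003) ∷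
  (0x7f82837a , 0x145e43e3823783422791be1bc0e90e0088030028003) ∷
  (0x7d81887c , 0x12321680ac044010) ∷
  (0x7f7e8484 , 0x12d222a050006) ∷
  (0x817f8282 , 0x12960a6046) ∷
  (0x81807e84 , 0x148241e2b121d0ca09d052012) ∷
  (0x7f7f8280 , 0x145439009403c) ∷
  (0x807f7f81 , 0x146d3d43442f817d17c06a05400e) ∷
  (0x8081817b , 0x14703d83ce2ee2e41821800ac068058011010) ∷
  (0x81807c7f , 0x14643512f22e81861840a506505c005004) ∷
  (0x817f7f80 , 0x145c34c188066060008) ∷
  (0x7e7f867d , 0x147c31010c) ∷
  (0x7d82837a , 0x13c5319104030) ∷
  (0x7e808580 , 0x11b0142018) ∷
  (0x7e82857b , 0x11a913e014) ∷
  (0x7f80877b , 0x144e3f438c1940f80c6074010) ∷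
  (0x817e7d85 , 0x133132c0ae074) ∷
  (0x7f7e8481 , 0x13c43001240c606a024) ∷
  (0x827d7f85 , 0x130411e032) ∷
  (0x817f7d81 , 0x12fa2f42242201bd1ac1790d60d404d04c01a00e008) ∷
  (0x81807e7e , 0x14102ec2ea22821c1c21a80d90d8052050011004) ∷
  (0x817f7c82 , 0x14103a42f02e42302211ba1b00cd0cc046044011005) ∷
  (0x81807f7e , 0x122e21e1c504904800a) ∷
  (0x80807e7e , 0x145c3ec34829821008908802801c011) ∷
  (0x8080827c , 0x146c4603f03502a42a021620c1d115808608402c02000e004) ∷
  (0x807e8084 , 0x14684052be09609402c008) ∷
  (0x8082807a , 0x146c2b929409a098028004) ∷
  (0x7e808480 , 0x14612ae21908c01c00c) ∷
  (0x82807a80 , 0x14703fa2b02aa214091090031021011) ∷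
  (0x7f80807e , 0x13810a8078075) ∷
  (0x7f818579 , 0x13c837e2d81e61240ac004) ∷
  (0x80827f79 , 0x13de36c2dc1e409c004) ∷
  (0x82807881 , 0x13d83791e113107c01a011) ∷
  (0x7f80877e , 0x13762d61fc11e0ba010) ∷
  (0x7f80867a , 0x14503102500ee058) ∷
  (0x7e80837d , 0x14543993262b80f4058) ∷
  (0x807e8380 , 0x147c45038c3162a80e805e032) ∷
  (0x807d8285 , 0x12a00f606a) ∷
  (0x7d808a7e , 0x129e0f806a02a) ∷
  (0x807f8680 , 0x145631829624e0e205e) ∷
  (0x81807d7e , 0x13aa2661000ba091) ∷
  (0x807f7e82 , 0x13d90fc0b5075058) ∷
  (0x8081827b , 0x139e3280b6098) ∷
  (0x7f7f827f , 0x143942c3092881b81a412404402c) ∷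
  (0x7f828377 , 0x13583481c41a4028020) ∷
  (0x817e8181 , 0x142c30e28c1c011e08105002c01e001) ∷
  (0x7f7e8383 , 0x143d4343b43041c61a8128050032024) ∷
  (0x7e81897a , 0x14303b835004e02a020001) ∷
  (0x7d81867d , 0x14353bd1be1b0130044030024) ∷
  (0x817d7e89 , 0x11c01b504a) ∷
  (0x7d80867d , 0x13ec2801ec104024) ∷
  (0x807d8383 , 0x13f02781f203202c) ∷
  (0x7d808c7d , 0x127c11402a) ∷
  (0x8081807a , 0x137832c2280ec090058) ∷
  (0x7f7f8181 , 0x137033d21c1810f408405001c) ∷
  (0x81817c7c , 0x145c37c34221c1c91610e4084065028) ∷
  (0x817e7f82 , 0x138034022018415e0e808806604602c) ∷
  (0x7f828478 , 0x146c44233e2201cd0f8088068020) ∷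
  (0x807e8083 , 0x138132c2311800f6099058) ∷
  (0x80828079 , 0x137e3300f9095054) ∷
  (0x81807a80 , 0x145c36c3392492300e109805c) ∷
  (0x817f817f , 0x14854600de09606001e) ∷
  (0x7e808380 , 0x148146537133922a1840e809205c) ∷
  (0x7e828779 , 0x13760e404e) ∷
  (0x7f817f81 , 0x146922502d) ∷
  (0x807f817e , 0x13b438c2e811c0e0088050) ∷
  (0x817f827f , 0x13bc3982e42081240ee086046) ∷
  (0x7e7f8582 , 0x11c8092044) ∷
  (0x7d82877b , 0x12ed1280f80c009a051) ∷
  (0x7f80807d , 0x14483141b01a405c058) ∷
  (0x807f837d , 0x144e4483261a805e058001) ∷
  (0x80837f79 , 0x11bc068065) ∷
  (0x81807c7e , 0x14754312181890a0088054049) ∷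
  (0x817f7f7f , 0x147042039930e2141e018614c0a4084058046) ∷
  (0x807f7e81 , 0x146438d3092c421118009c08905c050) ∷
  (0x827e7b84 , 0x146843441c3a13923022101e1184146098069050) ∷
  (0x807e7f85 , 0x146143d3042141e518114c0ae091066044) ∷
  (0x817f7a84 , 0x142920c17d084) ∷
  (0x807e7f86 , 0x146d1dc09406a) ∷
  (0x7e828877 , 0x129e270060) ∷
  (0x7e7f8481 , 0x12ed2a828019c11c06a044) ∷
  (0x817d7f85 , 0x14452f02ba278066050) ∷
  (0x827e7f82 , 0x12ea2a026e05e046) ∷
  (0x7e82817e , 0x14152e5299275130059051) ∷
  (0x7f80837a , 0x147c3e82d40e0058) ∷
  (0x7e81807d , 0x13f12d42511040f405c) ∷
  (0x807f867d , 0x14803e62d825c0ee05e) ∷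
  (0x827c7d89 , 0x14023620f6) ∷
  (0x847e7587 , 0x136425a118069) ∷
  (0x7f827d80 , 0x13ed2d924d059) ∷
  (0x8080827b , 0x132c1fc074054) ∷
  (0x817f7d80 , 0x14544504183803792a82941b211c098091058002) ∷
  (0x81807e7d , 0x137c0d0096054001) ∷
  (0x817f7b82 , 0x138a3752b51ad1a40d4096) ∷
  (0x8180807d , 0x145037236c2ba1aa1a409809005e) ∷
  (0x827f7b81 , 0x14243702a529a1c01bc1310d9088084069) ∷
  (0x817e7c85 , 0x142038137c2a01c512a0cd089084066) ∷
  (0x80807f7c , 0x14283c826c2201dc1541040cc084078) ∷
  (0x8080817b , 0x142c3261e015810809c088) ∷
  (0x8080847b , 0x13ce21e10c0d8088) ∷
  (0x8080857c , 0x13d03162201e615e0a4086) ∷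
  (0x81827d7a , 0x14283582812300cc090) ∷
  (0x7f838377 , 0x13542702321e0090) ∷
  (0x837f7783 , 0x1431170098) ∷
  (0x7d82897a , 0x143527c22a16c09a) ∷
  (0x837f7a82 , 0x126e22e1de1650aa) ∷
  (0x827f7883 , 0x12600fe091) ∷
  (0x81807d7d , 0x14704643e43382b023c1bc1a80ec0e0098) ∷
  (0x817e7d83 , 0x146d45c3f03392ba2981bd1a40f60e8091084) ∷
  (0x81817e7b , 0x146a3fc33c2a41c21a40f90e4088) ∷
  (0x8081837a , 0x14703e832e2941c41b20ee0e0090) ∷
  (0x827f7982 , 0x146846040439234029c1ba0ad084002) ∷
  (0x827f7d80 , 0x146c3ee32c2aa1c50f60ea098088001) ∷
  (0x8180817d , 0x13e61ba1b60f00de) ∷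
  (0x7f807f83 , 0x13e92b51c11ad0f10dd094) ∷
  (0x817f817e , 0x13782ea25018011e0a4088) ∷
  (0x7f7e8285 , 0x137d2ed184128099) ∷
  (0x7d81877e , 0x12cc181092) ∷
  (0x8180827f , 0x136e24e186086) ∷
  (0x81807b7e , 0x14543d82e82101fd0f90d9) ∷
  (0x80828178 , 0x13c82ee2101540e00d8) ∷
  (0x8280797f , 0x14583cc2f22141991400ec0cc0ad) ∷
  (0x817f7985 , 0x12e52140cd0b80a5) ∷
  (0x82807e7f , 0x145815a140) ∷
  (0x7d81847e , 0x139438d1b00c40c0) ∷
  (0x7f7e8380 , 0x14483c02500e8) ∷
  (0x7f80897a , 0x144e1900ee) ∷
  (0x827d8083 , 0x144e3c424e0f6) ∷
  (0x7e7f8380 , 0x14182d42b80e8) ∷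
  (0x817d8083 , 0x14342d82a81240f6) ∷
  (0x81807f7c , 0x14103422c42381e40e00cc) ∷
  (0x817f7b81 , 0x14143a433c2c92451e118011c0ec0d9) ∷
  (0x8180807c , 0x135033c1de17c0d6) ∷
  (0x827e7b83 , 0x13302690f60d0) ∷
  (0x82807b7e , 0x144041635432c1e01801310f90cc) ∷
  (0x827e7985 , 0x141035c3391e41840d9) ∷
  (0x7f808084 , 0x134918a0d1) ∷
  (0x80807d7d , 0x13ec36c1a41040ec0dc002) ∷
  (0x8080837a , 0x14783f03781a40e0001) ∷
  (0x7f7f8080 , 0x147c3e43811b01a81040e8) ∷
  (0x817e8080 , 0x147c3e83703161b21a80f6) ∷
  (0x7e828977 , 0x14063782320ee) ∷
  (0x807d8086 , 0x13702310e8) ∷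
  (0x80838077 , 0x14011c41bc) ∷
  (0x7d808680 , 0x138122a0f4) ∷
  (0x83807780 , 0x13f537c1c51bc1180f9) ∷
  (0x7e818a7b , 0x13e621e1560f8) ∷
  (0x7f7f8585 , 0x13ea37d222162) ∷
  (0x827e7c82 , 0x13083042142101ba1a812a124) ∷
  (0x807e7e84 , 0x13002141b013211c) ∷
  (0x807e7f82 , 0x143932c2f02a018411c) ∷
  (0x827e7e81 , 0x13c4338180124) ∷
  (0x827d7c85 , 0x143c2e42a818014c) ∷
  (0x837f7b81 , 0x14362ba186) ∷
  (0x81817d7a , 0x146c45c3543442701bc1a417c) ∷
  (0x817e7e81 , 0x146041c3482e826c1c01a4180) ∷
  (0x7f828677 , 0x146c45e34c2e227c2701c4188001) ∷
  (0x817d7d86 , 0x14714643c41bd1a816e) ∷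
  (0x827f7f7f , 0x146041a2741ba18615e001) ∷
  (0x837e7a83 , 0x14704643c22f228227a1c51b2180) ∷
  (0x837e7884 , 0x13d830223021419e180) ∷
  (0x82817c7c , 0x13de392228210186) ∷
  (0x807f807d , 0x14544502d82d41a81a4) ∷
  (0x7f807d80 , 0x14542d92d41b0002) ∷
  (0x817f807d , 0x144e44833832c1b21a4) ∷
  (0x807f7d80 , 0x144c44833932c1a8002) ∷
  (0x8380797f , 0x134233c1bc1ba199) ∷
  (0x827f7a80 , 0x13803702b02301c51a4) ∷
  (0x827f7c7f , 0x142c37c3742f22a02201e41ba1a4) ∷
  (0x827e7a83 , 0x143c43437936c2ba2291c51a8) ∷
  (0x817e7b84 , 0x143937c2ec29821c1e11c0002) ∷
  (0x8181807a , 0x13803722942282201bc001) ∷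
  (0x82807d7d , 0x143c3782e42aa2301e01bc1b2) ∷
  (0x80828379 , 0x13893842ac1c21b61a1) ∷
  (0x8080807a , 0x13e42941a4) ∷
  (0x807e8080 , 0x13f03ec3102a82501a8) ∷
  (0x827e8080 , 0x13f03ee3182ba1b2) ∷
  (0x80808086 , 0x13ea2b1000) ∷
  []

triangleLemmas : List (ℕ × ℕ)
triangleLemmas =
  (0x1e380d1aab1b240983091 ,
   0x1122364354001658700019025) ∷
  (0x1b0ed7092609040593091 ,
   0x165a52a00d6f41241da362001122120) ∷
  (0x1d0a6b340b1deb14eb118b0aeb085b084b069b029a281a131a0cd9182916a9046726e722271c571bd70aa7066628e60ea6022335a3272321531e230ad301221bc ,
   0x16406c82ca55a12c6f837402515a29c01980823051c1540f40cc14c1d43bc68c19c15c3c44dc08c3044b41f405c53a68019a1080522d400d0d210a44404442a02426250237a38a001) ∷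
  (0x1e381e37ae2a9e181e0cde099e059d0edb1b2b098729570f570927045309121aa2090 ,
   0x13c402430426250237804938a50237a1d426204402442a3c43023042d444419a6b446255008c29c05210a4e405415c14c15a10808a5520b21340d21544dc0cc38c6f468070223051c7e43bc8d86e434c1ea0623621da0011245547006580251ec0191301320b436412200d) ∷
  (0x1e05dd1aab09870f560ea4372 ,
   0x13540ba1300251ea00d1d4001) ∷
  (0x1e381e37ae2a9e181e0cde099e059d0edb1b2b098729570f57092704530912090 ,
   0x11e258044a5788d28744ec51c0625da83a78a5b23c402405a2520a230882442411a34a0ba1c86ec3823726821141d40a86606f87245d886828c12c1f405c0d209c4f877089c5b03201902d00547684a062c8908a054c3981081e80b01dc1f00d438037000c2dc7f01d053030205825019c42a46255008c10a44454408a55230c0a05740bc5ac4f038c7020485700b834845413452c6f470404437a6e07e06723503641ec1320b41da7e455465c8ac6703543621300b21ea6e40611d434c12400d0010ba122055019025) ∷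
  (0x1e381e37ae2a9e181e0cde099e059d0edb1b2b09872957092704530912090 ,
   0x15708ca87a30208a55238c70245452c6f40b81340191300253523603501323640b41da3620b206d00d124122001) ∷
  (0x1e381e37ae2a9e181e0cde099e059d0edb09872957092704530912090 ,
   0x12624803c23028e24626f25500f82e052a0b250208a5521e81340b01240623620011da5547001ec1320b400d019130658079025122) ∷
  (0x1e09ae099b382b32e805a ,
   0x113470465c13200d019) ∷
  (0x1e381e37ae2a9e181e0cde099e059b09872957092704530912090 ,
   0x108c55430414c48229c5cc0244625507021ec3c430208a8e45521341320b409165c3626f41240017041ea13400d0191300b252a085122025) ∷
  (0x1e18172957092704530912090132d ,
   0x11ec0b413200d70065802512209d19a6f40b2132702552019) ∷
  (0x1e181732d729571b1709270456090309120ed ,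
   0x11ec0b413270065802509d19a1203620016f40b213270255265a52a12200d019) ∷
  (0x1e181732d72957092704530912090 ,
   0x11ec0b413270065802509d19a6f40b213270255265a12412200d019) ∷
  (0x1d3f2d37ad1aad1a9d0edb32e732d70f570e8705e705a4381409830923091 ,
   0x13500bc7d83600b01e80251341320191d012465a00d001) ∷
  (0x171a85339309121b2 ,
   0x1672350001122) ∷
  (0x1e37ae181e099e09080597092704540983091 ,
   0x11083786d81d87c87d810a37a6da1da6f48e26f252a5506e21e80b067434c1d464a5b47dc8fc5540ba35236065a7020cd1d00bc7e465c6f40b53520253501241ea6e01ec1220b43643543620d93506720b83481200c152a65a13413201900100d) ∷
  (0x1e0f4e0d6e0a4e02ce028d33cd29dd1b9d1b8d12ed0d0d079c1cec084c066b352b1c6b1bdb1b2b1aab0a9b086b02aa37aa341a216a184a128a0eea08591e69126900680ed73757342720271c0715d714c7096702d63ca61e1618560e560ad60886069606550765005341230a6 ,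
   0x10702280801dc2983641483806ea1ca2700941a011068401031425c12a6fc12c2585f853c2c00580c80544e00404640c03488c04c44ca7b43c415c4745da13272002042435438219c1727525cc42a00c3ca6a414c65465c1341300193fc1f41147ec80a6fa53a0ec1200b21ea00d3625e43c815a3c20ca1cc3700cc0501e81ac67854a39c00a0d244205a0256a03cc44042c82424c10800825037230810c10a37a30a79468238c6f4001) ∷
  (0x1e37ae181e099e09080597092709170454098 ,
   0x10ca38a10a37a1da0f137a6f40d210a38c14c3c26a468237230824c1080cc05415a79458c25005a0ca82400a2520a23701e853a0ec3fc30a0581ca35442c39c5a25dc1826025020a42ba00c44405040412c10c3cc5e23640f24da6145d215225c6846ea6782621a068025430c5440a005c2242981481103801f418415c3941ac0441d44a471c30423a06211430223c0241dc06419c08c19a42a4625501ec0b470202508a55265a5541241d234a70465c3620011341320191ea00d1200e5) ∷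
  (0x1732d709262a9618160904091 ,
   0x165a55230200d124120) ∷
  (0x1e372b099732d70f570987092705a30912090 ,
   0x16587001ec13265a0b40191301ea6e434c12400100d025122) ∷
  (0x1e37ae181e099e0908059709270914098 ,
   0x15301e80b036065a7020cd1d00bc6f41da3521243500250a05741d464a5b47dc8fc7e45540ba30255270465c6e01ec1220b43643543620d93506720b83481150b46e41ea1091203020fd55213413201965a00100d) ∷
  (0x1b32ca098732d7058 ,
   0x165a7021e813200d1340b0658130019025) ∷
  (0x1e099b098a09081b1732d70926091 ,
   0x11301320250b265a00d124122120) ∷
  (0x1e099b0987059432d ,
   0x113013200d0b2025) ∷
  (0x1b1a8b05e73ec71b030e82092 ,
   0x13500bc7d83601d0001) ∷
  (0x1b339b1b1b1a8b09ab05e8098809073ec70f470e870916092 ,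
   0x11223643503600ba35436267434c00d1511d03480013600b01e8025134019) ∷
  (0x1e099b3f2b338b2dab1b2b1b1b098b05db05aa090732d70926091 ,
   0x10b43641221241d03480bc34c5b40ba1c204a1d83786e46707e41ea0b235213401913015d1341e81d00bc7d870212465a67235013165c1450b212036213900102500d) ∷
  (0x1e099d1aab44ab3f2b36eb338b2dab1b2b1b1b146b098b05db05aa090732d70927091 ,
   0x128c5d413c49c6dc58c76c7848348704e88c04404a45541100a231209824206a1a22580502d22126923c264849a7346da56230a86a00824a78a2b27d27e202448203041a09c2fa11a55a12c3100183686606f85381c837210830c15a08a4ac5440a84320104387d88f802230453230255244880a4588c234a55c0385304c81f87b22644006620e816c47424c15c5e03ca0ba6741841f43b07201286fa53a8ba0781f00585182500a04087885b018c0d467a5904106085744f00cc10c08c19c68270430823c1141d40440d210a1ea0b25b26e25700b837a65c8a489a8aa35236089434c5b406446255038c37c1dc1e80b01341300337001241517d80bc1d070202565a3486e07e01ec6723603501320193640b400d169001) ∷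
  (0x1b098b05aa090732d7092709141aa ,
   0x11243600b01e870213465a1221d47dc0ba5b47001300251ec0193640b41753626707e43640ba8946dc28c5b400d001) ∷
  (0x1e381e380e32cd281d181d0edd045d031c37ab1e1b1b0b05ab025a0e172b9723071bc71b270e27092702662aa622853f253724099333a30ec3091205d ,
   0x12487888688e210c1086e037a04430c08a50206286c3788cc37c1dc1240484f038c06420c6244625625507020251ec1c05646dc1341c47d46703547e46e43481203626f41da0b400d1220191303503601d804a1c2450572674001) ∷
  (0x1e381b1b07339409930912092 ,
   0x1350360672122001) ∷
  (0x1e381e380e32cd472d452d2bad281d181d0edd05ed045d031c37ab370b1e1b1b0b0e8b05ab025b020a0e193ed744d743673c673be7382736e732e72da72b97299725e723071bc71b2718670e27085706970587029702662aa62286092605d53f2537252b252324099333a324d30ec3091 ,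
   0x101a45a8c436a6621281f06fa4343880604a28a28928fa5528bc09411030483c2ca05c54408a50204a1088083781f20d067c03a5324ec0a41002b45342922c44447e48644fc0446a43ca30857013013400a3528aa65a30a10c6e462a4a45aa3621540f44e469413c0d437c0401e80b06dc56464a49c3c48e46f446479a1b467a59424c78c55404c5741c477c70038a4b453a43a7da70465c8ba0524bc49a5720d210a6e26748a489a37a6e01ec0b45b401938c1d07020250bc34c19967234a18d00d001) ∷
  (0x1e380e32ce2aae228e0f5e0e1e09ae099e059b098b05aa090743673f2736e732d72da71b270e27092709170266338605d21b1 ,
   0x13503601243641a53c21c24500621d830246089a7023601240b04646f40bc8a45648e41d06746e00405725547045746e467034849a78c7da10a3787e404a4bc8aa35277c1da0d25325020521ea30c08a55213413165c01965a0b212000d001) ∷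
  (0x1d1aab098b05aa090732d70927091 ,
   0x10b06581341241220b465c8ac67001900d1200b23621b10b21321ea6701341c24506587005b41c46dc55404c7e486c3640ba130354181001025) ∷
  (0x1e382e32eb0f5b0598090 ,
   0x17041ea0b202565c01900d) ∷
  (0x1e45de382e32ee2a9e186e128e0f4e0ede050b1bdb184b0f5b0e1a2aa732d70926090409132291059 ,
   0x129c3740cc53a42808c00a4222ba2da76218260218a13a5d26145440a41b224a1084da51226204a1d871c23a19a6aa6b24604e211430208a5023780425521e81da52a4520244625501ec0197021320b402543a8ba6e27e236065a8fa7da1d262235212405238a1c220a0621d44a462a5540ba5aa34a36265c7041ea12000100d) ∷
  (0x171c6645d50e2503242b1 ,
   0x18ba38c0641c4) ∷
  (0x1e3cdb415b11d903180ed321530cd ,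
   0x179a74a82a23a42a19a062) ∷
  (0x1e299e1e2e065e050d422d044d005c3cdc2b9c182c046b45eb341b2ceb1c4b14eb086b06aa43ea401a228a08a733d72d271c6712a70e57084645d637162f16186608552ca433a3215313130cd3012 ,
   0x141a44a1286fa6821f03828d211002509c12c35a0120c43d40ca37269c79a1b443a8bc34c3881ca03a2620191f45a40a025454c1140d43c467a10810c08842819a00a30c24c08c59437429c02442a84487c5e23043848024505720d237a38c8ba1ea53210a6e200d001) ∷
  (0x1e1e2c3cdc182c046a33a9184733d72e57126637152ca408532153012 ,
   0x10243c479a1b467424c59467a6e230442a5ca30808c) ∷
  (0x1e2dae1e2d464c3cdc3c6c182c046b1b2b184a33a933892ba81aa7434733d72e572b171c671a870e2645d63716085605e52ca503232153012 ,
   0x11c438c5621e11c40bc8ba6e22053088688c857467035036400124c78c5b400d) ∷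
  (0x1e099e090709240984091 ,
   0x15624944a462a5aa67434c6e47e40ba3542116705b436457478c3508c80bc8680646741f957245080267a59453208c1143040ca1d268230c5e287c8e46f48443882542623c429c8bc7045a459c0d400a45252a1ca08810c1085ca79a02410a1ea6e28ba34a1c438c37a1ed06255465c19a08a42a46255023a82a36279a1216f45520b21d55541c24521e81da8ba70202537a1ec55230c0a030825065a1241201c965c0b21ea7041340190b456213200d001) ∷
  (0x1e090709a709240984091 ,
   0x121d132134019) ∷
  (0x1e099d1b2b1b0b091b090b05880986092333a ,
   0x11c73526746583643503600b013413200d0190010b2134) ∷
  (0x1d1aac33853ee52ba10ea ,
   0x16703547dc001574) ∷
  (0x1309130901092 ,
   0x1122120) ∷
  (0x1e32ce099e05a4098 ,
   0x11ec0b413200d700658025019) ∷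
  (0x1d1b0b1b1b098b092b091b059809960903338 ,
   0x1239134130025) ∷
  (0x1e099709240901091 ,
   0x10b21ea70413013465c0b41322656703480013620b236012400d0192590b4658025) ∷
  (0x1e099832d4090 ,
   0x165c7041ea1341300b202513200d019) ∷
  (0x1e370e099709240903091 ,
   0x13647e03500bc1d00b41ec13265a27d12400d6e0348019271001) ∷
  (0x1e370b32eb1b2a09a7090705830922091 ,
   0x165c1346f01201dc3640010b0019124) ∷
  (0x1b059a29530ec2379 ,
   0x10b252a0251d8) ∷
  (0x1e370b1b27092409840903091 ,
   0x17b88206084287487985e42800ec3b48ac16a73a8aa5e06b82e08623120124340905c44e045a11a66412a6fc68401a2fa55a8c43d03108608d809c54c4448823387448dc69843c7501706d04c020031802a4785b81744880206ec5ac0d80e41601fc7b03000244627a81a066012c1f46f86908583808286005508c05401386520aa4d21f205a4ea3822520ea1684707903c80ca7385d01b24225da43a7da8a81583c08e037819a23a58a6800cc14a4a21982380600621c25604f460c8887bc1b067c0d01086e08b80a21104245d272425400c3cc30a30c08a30287a4f00641c41dc5521e80b05b00bc34c54411438c37c6e234a6720b83481c03500a411270238a1d47dc7006f22a11d80b252a65a3601d25720ba6743521243886f070465c3623543646580252950b013401912465c13428900d001) ∷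
  (0x1e381d1c6b382b099b058a09171b070927090708a6341432d ,
   0x11e436a8182920142c474a42a19c4443a046c1544b41f40d237a0f46942b47e462a3a883c78c9040441ec49447424c00c45452c1dc35430815c3c45cc30a2524f20a257002470022c7ca05c2540a457212019a08c14c5442ba05243a7da8fa3840222d205055223a71c3045323720ca38a0624a45541da0b45b40ba1125420c811038837c1d010a1ea7d46f436234c8a489a5aa34a6e27e21e88925b20b21308aa67435265c70411468238c1340b012436013270202501900100d) ∷
  (0x1e370b1b2709240903091 ,
   0x102c27a2f20d80e41606c04f88605c40908e871235c81844442a7d47e470836c2941500a84027cc20c2d80b81d227c0e016a47215a29c2f46dc8e45cc61a1bc2144826f42b43a804406c50836a55a12c0aa66200a4200a05d01121b404c1da7ca1ba7c031453c39046455201038c2c03301b067004824800c28c4984680f04d83700c870265a2b936070238c7046821140ea1683b007840818c1dc2646001585e260a4f22521802384ea3fa32a1882606180883005501a205043443a02438809453a1ca37438055c12a1286fa7205da4221f01100d42121f20d067c6e45346926485b23c25ca13a73449a03a26230408c5040644621c45623543623086780d20b436467a1b20a430a57210c37c0401e80b00a253210a6e25701d06743521c26da0ba34a6721ea0b237a1ec6e03481222251341302ad02501913028900d001) ∷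
  (0x1b456b099b058a0917092709063f051a8344a331632d6 ,
   0x11b835812a25a1a469464a7dc6846fc80c7e846466c71256c8c45e285c83c5d49085626da1c203a5681bc37429c2d484421403c26408c30487c1b404c4f486c3542b43a819476c4a478c5549040447d47e47cc8c05404407c86d82102b00400383481b026067c10c0882487886706e40481c00601286fa53a1ca0ca2ba43a5327da3628fa7e25521e80521f01101d04a05507006588a80d467a10a6e21ea0b237a1ec38a1d43781d837c6dc6743523608cc5724501305280ba5b434a6723887041340b05b01dc6f012065c8ac8940b413201912434c0bc5ac62c00d1223647e0350001025) ∷
  (0x1e3f1e3d5e390e33ce30ce2f1e2ede2e5e2d9e185e182e068e052e046e028d435d406d33ed2a0d280d211d20dd1c4d131d088d064d00cc3c5b3e6b3ceb3c6b3a6b325b2e6b2dab2c8b2b9b2a1b299b25eb1e2b1b1b1a9b134b130b0e0b0d4b0aeb099b085b058b029b018a24da104a091936e9180916a910c90449024742873ee73e87380732c731672f8726c7254722171e071dc71c871b071aa71a87184714a70ac70927090706070517022701c700863f0637a610660e2547254025086506a505d503033f43378335832d632aa32943270324e233a ,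
   0x11084406a02bc7a03bc7ac1ea0b24d016c47465001c2a25f03b86887908204700143d00c035c3e81bc37401028474c03048246c0e83f818c1dc37c4086005500b015c0f44dc24c61036c6643f027c7405dc72213402847c00c2942c06982181b01500f00c84b053c3901585e22404f80403481201d012409c2fa0921a41a205055a12c0aa5ea41a2fc09841c1ac7582807487988b033225200a29c5cc6781b268404401a2aa33c2628804287b03003c079c1004ec85c5d48cc2b469413c3a843a42216428c3808040242d40524bc49a0a444442a5ca6182422f855812a1f26fc66255c1286fa7203085401100d47006585281f080c7e86f07d07e010a08c5902484d873049c64a7dc7cc6dc0190182a80d053267c10c0a230487c3883c45da4f244205a5420884ea51a3e07e20385102080481c02605000603602d162c20c8ac8945b484c30a57286a8e41e878a5b270238c6f41c41321300ba35436235200100d025) ∷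
  (0x1e400e3f1e3d5e3c5e390e381e37ae371e356e30ce2f1e2ede2e5e2d9e2b8e295e232e185e182e104e0f6e0e8e0e2e068e05ee05ae052e046e028e020b3c6b36eb2b2b299b1a9b128b0e0b099b085b058b050b029b021a33aa2a9a24da22a832d7380732c729471e071b071aa718470ac7092705d705162a8622960ee409032aa2091 ,
   0x10084200a43005d43045543502b84380508b85601301340b01240b26721320224600421d234a2602d82500583704d85102080482208004545706e21785882381106007180c81484a00bc34c00d6f065c3620885000603603881c05646dc0b83522dd36278a6f41c40ba8e420c0645b45726dc86a7cc4bc7dc5cc64a3c42d449c35062c5ac7e07d00606f02185007e852804820838808826080c10c3005505420384d867c0d40c880411054059042245226267815c4a879c44239003001841a6b04645522944e00101a88502685f03b88da52a2c50c00441ec0b436474c1dc37c38c0401d0348019001702025) ∷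
  (0x1e314e2b8e068d421d251d215d1a9d031c371c339c2d5b46eb451b44eb43cb3bcb380b36cb341b32cb2d8b2b0b2a5b29ab221b211b1e0b1bdb1a8b0a9b09ab086b051b011a3f1a36da2f1a0e1947d947093ed93c49230918091319044901273f972c8721470f470e970897085700633ee33723338332532e432d43282324e318430cd305c21b0 ,
   0x11520aa1a26621286fa6828428c26ea67a06a6cc45a03a2124807b03c255812a6fc6840ca1981f254a1128c454430c3ba68a20a06233c8804280d02b28dc44400c24878859010c4da37229a5ca08830810a44224a1b226202400830a0a45726745dc1341e886c3543623522da0424924a26286228a20ba5aa8d43c05c802243c5348bc7047da8fa6e46706d813242c4647f236412234a00d1245705e41201d26e27e23008788e04605601c26da37a50477889c5b049c64a7dc7006588a86723500250190010b85a8) ∷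
  (0x1e33cd215d180d044d031b29ab1bdb06aa36da2f1a0eea0e1a088936c913190127372714d714254725471537950ed4090321631e2318430cd3085301130101086 ,
   0x11dc37c8e43c40d41106785343786d86703480196e474c5e229a2840344806f28e21da0621c26da37a00133c19a42a2620223c20245ca30810a42c020300088) ∷
  (0x1a086904472e6618532f232161180 ,
   0x15cc30a10c08842c5e4) ∷
  (0x1e33cd215d180d044d031b416b380b29ab1e0b1bdb088b086b06aa36da2f1a0eea0e1936c91319012832c737272f272e6714d7142618554725471537950ed4090321631e2318430cd308530113010 ,
   0x17b01980883c082c26242c0203c402430030d5e4088301110700019) ∷
  (0x1e362e2bae09ae098d464d434c05eb402b31cb211b1bdb1aab08ab088b086b05da22991809044901273ee737972e6721671b27089618560e854714058332c32f22091 ,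
   0x10a023c65c1206708a03488b81140cc6386c48688e28046807028da6e037a1ec1321e85401101d00bc34c00d42202430087836438a0018c86f24525741d4700130134025019658159) ∷
  (0x1e36de362e33ce2bae185e098e05ed471d470d3c6d180d044d031c339b451b41eb402b3bcb380b37ab36cb32cb31cb2f1b2b0b2a5b29ab221b1bdb1aab131b0e1b088b086b06ab05db051b012b011a229a09a93c4732572f272e672e472da72c872827216721471b2712670ed7092708970854090324e31e2318430cd21b12091 ,
   0x183c78c24c3196d88e402228429a1da1dc3256f28e20bc8c88683503602f57e25a83508fa6e20b85b01d27da62857089c7f25aa4a27dc64a5b45046da1c24608e06708785c86e40d000c8dc8425e215268242a1d03483005e408830a5720ba35442211470465c02482c26202046455265a6f400d1e80253c00b042c364674352134019001124) ∷
  (0x1e46de381e36de362e33ce2bae2a8e185e0e2e098e05ee052d470d3c6d031c339b41eb402b3c4b3bcb380b36cb32cb31cb316b2f1b2b0b29ab1bdb1aab131b106b0f5b0e1b088b086b06ab05db059b051b022b012b011a229a09a732572f272e672e472da72d672c872827216721471b27132712670ed70ce70cd70927085432d4090324e31e231842091 ,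
   0x11b01603cc00830a0a411238a37a4401086e00401486ec1cc1140d22b467c3846e86783788d43c043c53403c82c23c19c02442c0202480883005905c88e08787845741d45ac62c4a010c68c2ac3382645046ac8544e404434c0bc1d08bc4645521e80b070465c13420c0641c438c6f41246e41ea0b26703483543623316f47888a244254a8da1128e219a3000885501ec0b436401913270202500d001) ∷
  (0x1b32cb058709240901091 ,
   0x16f01dc1245280b065802565c0b42c56e000d019) ∷
  (0x1b1b2b09881aa809170924090 ,
   0x18fc4a462a5aa1d438a3786e46700ba34a5547006580197e41ea0b200d130025362001) ∷
  (0x1b33ab1b2b1a9b0988099809171b03092 ,
   0x16743520ba34a00d130025124360350364001) ∷
  (0x1e0eae08ac25cc05eb212b1b2b1a9a22a908590698091721e71b071a870da702a6126333a32963092 ,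
   0x11140d243c42400c45452c35430813013435202557067213210a6e234a6741243600544b80191d434c0bc35036400d001) ∷
  (0x1e338e250e248e194e185b380b2a8b1b2b11cb098b05880917092409a4090 ,
   0x141803448026284886c30c4cc1687381b204a8a84700087b06583c079c5907780982fc11c34c6e86780aa66255c31211054053a43a7da3942d402401038c68211443802238467c37c6dc1c47cc6e47e48fc8b83581b82102b044004049012a1f21123000d01d20424601286fa10a1083781d80b21f005837042a4620644a04e80a04201b04505285746e08588380384d85102087c86d85600b81e83d82186304b89008f87e06207d00882487880481dc0b05b00bc1c036d0bc6703484b824c78c5b464a55452c0541d41b404c49c8ac1da45410a4240d21ea37a6da67234a11470443c7dc3543557001306f05501ec0b40193616741243603523621c135036413200d025001) ∷
  (0x1e18580917092432c4090 ,
   0x113022b12413565c0b43791307005506703284a00b02384908a0348364001019) ∷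
  (0x1e058b09a432c4090 ,
   0x11ea70465c00d0b21301340b0019025) ∷
  (0x1e185e0917092432c4090 ,
   0x13581b87c82102b00381f05300681e07a03703805204f822836c81043c2ac20c1c40d47081bc37480468421403c4dc24c5144822640242d40524224521b404c1da67a7d46f47cc6dc56466c1ac6a02bc54008c5045547dc35436205438c62c04434c0bc6706d86e85481106780d21d04a08f87d87020640403484401083781d810c37c04110a6e27e267435237a8da52a7e03503602e955252a7024644525501d00401dc1ec5b278a3546f41c40ba49a5da0527e25282080507003045540b40a25e278c08c61853215830810a0d07205ca3c07aa6743603526dc6e20bc5645701c04540421ea0b21308001e80b00190256ac0a413225f65a0a02503910b000d1242c5364122385001) ∷
  (0x1b1b2b098709240901091 ,
   0x12c56e0) ∷
  (0x17092432c4090 ,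
   0x10bc35067012423913413002567034801936212212413365c27d1320b200d39d3a9130364001) ∷
  (0x1e32de05ee05870927091409a4090 ,
   0x11d438a1226e48d87004503781d85281ea00d0b21306580b00193b5025001) ∷
  (0x1e099d339709240902091 ,
   0x130423a7825aa1d234a6726e01ec0624a41d41da87c38870437c1e80b070238c6f41d08cc6dc45057267434c0bc3523603500b83480ba5540b436435413002536265c13413265a27d00d3c10b00bc65a019001124) ∷
  (0x1709260914090 ,
   0x124c04c5740bc3501d07021da10a6e27e267435236037a8da52a0b233d7025508da5b467278864a49c7785604280a23b53640ba4528046c463870010a3086d86da1c219a0221100d40625e21da5cc83c2623c424c78c0b23541ea1c450420c57426437a04462c5ac19c8e05e45340243045c842c4645527041e810c0a430a5900ad30452c55413065c6780256e03481ec0b40411dc0b01343c10b00bc65a1240193cd67212200d001) ∷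
  (0x1e43ce42ce3d8e390e37ee342e2f2e2ede2e8e0fae0f6e089e084e012e010d471d306d302d218d1c0d1a0d00ac446c420c2d2c21ec11ec006b416b375b2e1b2d1b281b1e8b1bdb1aab18ab131b129b11db0f9b0ccb0a5b096b06ab05db048a3a5a2a5a2a2a29aa12aa0cda088a052a05192ec92dc917491419065747673ce739473587348733a72cc721571a9712470ed70ac7092644061e66185527a51c85144509c503140903391338d333d323c308621b11091 ,
   0x10981aa67c10a4427e241a1a866809c54c88230208a0203c05dc5c884030046241837a2f21687385d06da31837c6e234a11a0923108604e069085813828876072859839015834971a14a6b06a81982525a25c409055843055a6f81147048542fc3ba5f268c19c08855023c3bc8d87008dc35a2a001a2aa33c0243807101e23820d002a42445452c7d210c09a31401443c5345c20aa1f254a8807b06582628ec34028274a55c1280ac66412a6fc68412c1f441c4445442f02786d81304785b80ca60c8c88786f274279219a68011270265a36002513242282237010837850238a1c24f40626e03481ec42a0a05a42540a45720ba67412430c13435201965c0b41da00d3cc00c354001) ∷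
  (0x1709270914090 ,
   0x10c43d401443c28274a69c79a1da0628bc6e48d867011c34c1d46e87f83888021ea4505287081e03800d437c1dc3c402847c00c3cc8cc86c4221b204a1d80a47d01c00b85601c20ba7cc7dc37400a24c1b46746dc8e46f435412c1f45a425419a15a0b23623e51da3523540626740ba00c4f45023cc5e226260c7b023a2540ca88c88043c19a5a45b854454a67874a8b242a1f44783c81f228238037080012c5a23402e801402485825243023c7221980908ec15814a5c26b071a31472810c8e25e453442a0a430a5d08c82486fc8d43900205980886842887205d80a24243825dc45452c1380d05da60479c82c0d467a3d06ea6903c01101121143020a053030c08a55270465c1e81343495c86f81083786d835068070265a3606f21248403008788e046055455038a37a8b86e03481ec0b42ad6e07001306583b50252713d900d001019) ∷
  (0x1e382e370e33ae32ee2eee2a9e294e186e125e11ce0f4e0cce0b5e070e058d1e4d1a9d0e9c2b8c0e0b461b45db42db429b3e5b2ecb2d5b2d1b2aab26db184b129b0f5b051b01da22881aa73817355734272f072ed72b172a07231723071c5713170ed70e270987088705a70526379636d62a8618540f6409030e1305d3021 ,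
   0x11b479a48c17265403c34c11c0943125c01401a21520e047216a73a7b26620aa3ba68a2902c844a0122807485e42a005a4ea2385881c07d07181486f061882a55c1180ac11a34a6ec8d25da67c37c1e80b052845000824a4da85a8748325680c035c36a35a81436c0a866001c4405481f03820d08846025524185e82fa54c04485210844812c80a8d05d87422aa7921286fa4ca0ec3fc89a5aa71c15a0b26f86807b48c05401f405c4ec61a82c23c19c15c5e04286820c858c26260408c33c6aa19a23a51c7e41ea5323045d48cc6dc1c413413203a43a8ba5624628e23e220a0626347ca7da5b44245dc30c3c814a6f21982525a21f254a4428c23ca30a3080a25705428da02504268454411438c37a1101d03880ca0a411238a8b86e03484605547021831221245505721d224b5727da70465c0196740ba1c26da1da3620010b400d) ∷
  (0x1e46de300e2a4e214e1c8e189e140e11ce0f8e0f4e0ace06ae04ae02ad3a4d314d279d221d216d1bed009c2b8c215c0eec0d9b43ab3d9b37eb232b1c1b1bab129b0f9b075b068a45da38da372a33ca2a9a21ea21da15da0e5a08aa086a051a005943e934192d1744c71c6718171047045637062f062a8622060e86066547252d450304058331030843020 ,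
   0x101231209411c34c6e41ca11a34a8ba6ec67c55c66412a6fc2807483321b26780302846f465a83230a5420c838811270274c19c65c7042505a00a05301340ea1581983fa1f25a22524f289871a41a5f00d410c37400a8da44242808c30487c0a21105c82988306582380607805705502bc05443c42c4645528e45e00cc1286fa8d23820d01086e01d08742ba43a00d68211438c37c1dc0011f05484400402086281e86205a8019025) ∷
  (0x1e454e380e379e2a8e294e185e11ce0cce098e058b09a80914090 ,
   0x10b21d80605003601ea6e410c37c1e80b04095a81dc6207d08988a837c55262820838c8e46f40405646dc0608ba1d01140cc46487c8cc4407e04f243a05443c7dc1d46825e054842c2ba0524bc1c20a21086f86808c06785341f008a87400a3c80d01b239042a30237471a6005a238215810c1ca4280881f26fc6847b20d46e44425427485e43005d08c84520ca8da0ea0943121100122806f03881c035036430a0a41121d238a6f252a7021835729046347da7ca1da7040ba5b40b41ec3fd6e05505541da4606da3543620421c256038a7020ba6f26743521d25704628ba7ca0a41105623c86845407000a21c43085da1c06aa8528c25e003a5a25d826225265c7041ea5525aa1e830c5dc16a85a4da24a67234a0b83480014500e030a13213565865c0b401913022b12402500d) ∷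
  (0x1e380e098e058b372b371b0ecb0e9b059a294a09171b270ea7090705a409a33393092305c ,
   0x14200a05741226704381101d01245303841140d26781086e07e07d08f03487c86d856011238a67a10a6e21e837a1ec6da1d25721206743521c204a1d80ba3543640b41d46e43788d87001ea0b20b867213200d0014501300255280b0019) ∷
  (0x1e33ad1a9a2b993ed90e9205d ,
   0x17da3526740011d2572) ∷
  (0x170924090 ,
   0x16f238a7001c25606720ba42d7da70436265c6743525721d20b813413222b4151988a86f25502384213640b40b01305280b27006e21d867234a00d1241d21d46e40b83480010196583f13b5025) ∷
  (0x1b090 ,
   0x112212044324d43d43b44143f) ∷
  []

triangleSteps : ℕ
triangleSteps = 0x1443122439445

spindleOrbits : List (ℕ × ℕ)
spindleOrbits =
  (0x80808082 , 0x1042019016012) ∷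
  (0x8080807e , 0x103c02401801400c) ∷
  (0x80808080 , 0x103203102d02c01201101000e00d00c) ∷
  (0x8080807f , 0x101801401101000a009008004) ∷
  (0x8080817f , 0x101a01400e00c00a009008001) ∷
  (0x8080817e , 0x101000c004001) ∷
  (0x80807f7f , 0x101100c004002) ∷
  (0x8080817d , 0x1020014004) ∷
  (0x8080827d , 0x101c014001) ∷
  (0x80807f7e , 0x1029018004) ∷
  (0x8080837e , 0x102601a001) ∷
  (0x807f8080 , 0x103803403103000a009008) ∷
  (0x817f8080 , 0x104003a03402e02c00a009008) ∷
  (0x817e8080 , 0x104804003002c) ∷
  (0x7f7f8080 , 0x104103102c) ∷
  (0x807e8080 , 0x104403803402c004) ∷
  (0x827e8080 , 0x103a034030001) ∷
  (0x817d8080 , 0x104803c034) ∷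
  (0x827d8080 , 0x1044040034) ∷
  (0x7f7e8080 , 0x105103c038) ∷
  (0x837e8080 , 0x104e04003a) ∷
  []

spindleLemmas : List (ℕ × ℕ)
spindleLemmas =
  (0x1c015a005602540194008 ,
   0x10ad02a00a04a) ∷
  (0x1c02ac015a012a005602560194008 ,
   0x122f05404a00a0243f1) ∷
  (0x1602560194005 ,
   0x104a032) ∷
  (0x1c02aa012a00560252019 ,
   0x122f05404a00a024) ∷
  (0x1e005d02ac015b0127019602520041000 ,
   0x110900203413b02801802000d02202a01c0103fd0f901a22f05400a04a415409032054024) ∷
  (0x1d018d011d00cd0028009100d ,
   0x10f5004030018022) ∷
  (0x1e005d02a6025401920041000 ,
   0x10f500403001802201242d02201803000402a42101a02422f05400a04a) ∷
  (0x1e04ae03ee02d80324042402e100a ,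
   0x135307c09406c30907201205a291) ∷
  (0x1e03db036803220421009 ,
   0x13d109a0a43af07a05a07230906c) ∷
  (0x1e042e03ee03d8032402e100a1009 ,
   0x107c08c38106c44505a08445106c) ∷
  (0x1c010c00c800e800d ,
   0x104b018020) ∷
  (0x1e042e03ee03d70322036100a1009 ,
   0x145f05c064) ∷
  (0x1704a70466042603e6032202e ,
   0x135109408c07c375084064) ∷
  (0x1e042e03ee03da0367032100a1009 ,
   0x138108c09408434507c06405c48107c06408409408c475) ∷
  (0x1e016e010e006d014c00c4012200e100a ,
   0x11510340120280180200e100c02c) ∷
  (0x1c014c001800e800c ,
   0x110b002028) ∷
  (0x1e016e00640122004100a ,
   0x11f90380400020284a50021510120341bd0200e100c02c01c499020028018) ∷
  (0x1e03de039e02d80324042 ,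
   0x13af0a409a3dd07a05a072) ∷
  (0x1e042e03ee03d8032100a1009 ,
   0x14bd2a906c05a08445148f) ∷
  (0x1e005a019a00d901880111008 ,
   0x115503001402402a00a03201a) ∷
  (0x1e005b00da019400c2004100a1008 ,
   0x125904805200415502a00a03201a21d0224d501a030) ∷
  (0x1e005b00eb00da019801030082004100a ,
   0x14e101001c018) ∷
  (0x1e042e019e016d010803240122004100a1009 ,
   0x115503000410f02a00a03201a0220180190204ed01c00a4c907c4b101a032010) ∷
  (0x1a015a002800d800c ,
   0x110f00402a) ∷
  (0x1d014d009c010c00ec00c800d ,
   0x1151034002109012028018020469) ∷
  (0x1e03ee03d8042100a1009 ,
   0x13df09a0a43a107a05a0722a906c48f0644cb) ∷
  (0x1d040d03cd034402c1030 ,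
   0x1331090088379080078068) ∷
  (0x19040902e902c8030 ,
   0x127105808005c) ∷
  (0x1c040c03a802e802c ,
   0x128b080074) ∷
  (0x1d040d03ed03cd02e802c20091030 ,
   0x13990a009c3e108007c07405c5410800742dd52b) ∷
  (0x1e019e012a01160084009300d1005 ,
   0x10ad03202402a02201001a) ∷
  (0x1e019e005a0118012200d ,
   0x10df02200a032) ∷
  (0x1e019e016e005b011b00e80124009300d100c ,
   0x108103400c0e302002c01401c031565022) ∷
  (0x1b012700d6008400a4009100c1000 ,
   0x10d500c03408102c02001c03101a57155902403202201a01c02c) ∷
  (0x1e019e012e00ae008e0057011700d400c20102004 ,
   0x100a03202401402a01a50702a19f0100040300220cd) ∷
  (0x1e016701a700e700140121010 ,
   0x125504c05000221900c02c03401c) ∷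
  (0x1e016e012e00ad00cb011901890148008700e1010 ,
   0x110901800203401c02459513b002028) ∷
  (0x1e019e016e012e00a8008700e700d400c2004 ,
   0x11b504203a1f158900402a01a50702a19f0040300cd0205a1030022028) ∷
  (0x1e019e016e012e00c8008700e700d2004 ,
   0x104901c02001a0225ad018) ∷
  (0x1e019e016e012e00cc008700e400d2004 ,
   0x15ad01401c049018024010) ∷
  (0x1e019e016e012e010e00de00ce008600e20112004 ,
   0x101c02401001a5c5010) ∷
  (0x1e019e016e012e010e008a011700e2004100a ,
   0x101b02002401a0100185d101a01c018) ∷
  (0x1e010d00d8011700e6008400c1000 ,
   0x10f901c01a02401b020010) ∷
  (0x1e012e0108011700e60084018100d100c ,
   0x101b02002401c03101213d02a0040f5) ∷
  (0x1e010e00ad018d00dd00c8011700e60081000 ,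
   0x10a102a00a0df03202401001a5f50240300185e9) ∷
  (0x1e0108011700e600820041000 ,
   0x157d0120240140180106010180305dd02c032024) ∷
  (0x1e010701140082004100c1000 ,
   0x158f00a02a0ad03203400c01c02457d0120240140200cd022) ∷
  (0x1e010701160082004100c1000 ,
   0x10e300c03400202860501a13501402c01202002460f022619) ∷
  (0x1e010c011700e200820041000 ,
   0x102001862560f60d) ∷
  (0x1d03e80306034502e4040200a ,
   0x13e109c0a03b307c05c07430d068) ∷
  (0x1d03ed03cd0305040502e200a2009102c ,
   0x134b0900880782dd07427136163d068060537) ∷
  (0x1d040d03ed030403a102e ,
   0x13b30a009c3c908007c060) ∷
  (0x1d040d03ed03ad030102e ,
   0x13b10a009c3c908007c060074655) ∷
  (0x1d03cd02c803440301040 ,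
   0x1361088090349078058) ∷
  (0x1d03ed03cd02ed02cb03a504040302009 ,
   0x166105c0742dd06866d080) ∷
  (0x1d040d03ed03c8030200a2009 ,
   0x137908809034b07864906863d67b07405805c) ∷
  (0x1c012c00d400a ,
   0x102401a) ∷
  (0x1d00dc012500a1011 ,
   0x102401a014) ∷
  (0x1d040d03ed03c200a2009 ,
   0x154f05854d05c060685687) ∷
  (0x1e019e016e012e00ce00a40082004 ,
   0x15bb01c01a) ∷
  (0x1e011e010200820041000 ,
   0x162701860f020631022) ∷
  (0x1c012c00a800e ,
   0x1014024) ∷
  (0x1e011d00a200820041000 ,
   0x102401401c6cd0140246c1) ∷
  (0x1e011d00a600820041000 ,
   0x157d01202002807903001401a6250205bb01c02c02403201a6d9) ∷
  (0x1e011e008d00a20041000 ,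
   0x16e76e5) ∷
  (0x1e008d00a20041000 ,
   0x102401a69102401a6b76b501803202c0240146f1) ∷
  (0x1a022a01e80128006 ,
   0x11d304403c) ∷
  (0x1d014d001c01ac00c4010 ,
   0x1028018002034) ∷
  (0x1e010e00de009d03cd014c00c8012200a1000 ,
   0x10020340280180207150340026a907c00c70904403c1e901c02c13503201201a) ∷
  (0x1e010e00de009d03cd014c00c200a1000 ,
   0x1723024721) ∷
  (0x1e019e016e00ee009c00d4012 ,
   0x102001804b01413503202c01c01201a) ∷
  (0x1d03cd014d00c200a10111000 ,
   0x113503201a02c01c02473903202c01c72d01a012018) ∷
  (0x1e0056025401920041000 ,
   0x143905404a) ∷
  (0x1d018d002c015c011800c ,
   0x102a004030022) ∷
  (0x1e00ee00c8012200a2009200820041000 ,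
   0x102a00403002275d02274502801803002a0046ad07807a00a75100a24501a03213502c01c) ∷
  (0x1e00c200a200410101000 ,
   0x102a00403002275d03002a0046ad07a00a75300a24501a03213502c01c76969b6a502274502807801801c0106b76b503202c024) ∷
  (0x1c011c010b008900e2004100d1000 ,
   0x160103001001c02001862760f010014) ∷
  (0x1e00c4012200a20041000 ,
   0x10dd00a03202a00410f03001802201a78101c020775022010745028078018) ∷
  (0x1e00c200a20041000 ,
   0x178f02478d) ∷
  (0x1e010e008d00dc011801220041000 ,
   0x162560103001001c7996fd) ∷
  (0x1200a20041000 ,
   0x162760f01c0100247a501a010020022745028078799) ∷
  (0x1e019e010e00ec011c00c800d4012 ,
   0x101902001c04b018022) ∷
  (0x1e042e032e019e016d00a40124011200d20041009 ,
   0x148307c05c09408c4510644cb51d51f07c4b107a00a0320dd014018) ∷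
  (0x1e042e032e019e016e010e00ee00de00cd00ac01140122004 ,
   0x148307c05c09408c4510644cb51d51f07c4b107a4e10320100180147c901269b01a7bd018) ∷
  (0x1e042e03ee03d6032100a1009 ,
   0x151f08451d4cb) ∷
  (0x1e042e019e016d00a401220041008 ,
   0x110f00403015502a4e100a7e107c4b14f90120cd03201401a0227d501c02001a018064) ∷
  (0x1d014d009c010c00ec00dc00c ,
   0x1513511) ∷
  (0x1e042e019e016e00cd009c011a012400d2004100a ,
   0x110d00402a155030018022) ∷
  (0x1e042e019e016e010e00ee00cd009c011c00da0122004100a ,
   0x110f00402a155030018022805) ∷
  (0x1c011c00a800d ,
   0x1014022) ∷
  (0x120041000 ,
   0x102201481d81102200d0207f902801c01201801a0247ef7ed02c0840326fd7b1) ∷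
  []

spindleSteps : ℕ
spindleSteps = 0x1829

-- Affine images of the graphs

Frame : Set
Frame = Vector × Vec Point₄ 8

dot : Point₄ → Point₄ → ℤ
dot (a ∷ b ∷ c ∷ d ∷ []) (x ∷ y ∷ z ∷ w ∷ []) =
  (a ℤ.* x ℤ.+ b ℤ.* y) ℤ.+ (c ℤ.* z ℤ.+ d ℤ.* w)

linear : ∀ {n} → Vec Point₄ n → Point₄ → Vec ℤ n
linear rows x = Vec.map (λ row → dot row x) rows

place : Frame → Point₄ → Vector
place (t , rows) x = zipWith ℤ._+_ t (linear rows x)

place-⊖ : ∀ f x y → place f x ⊖ place f y ≡ linear (proj₂ f) (x ⊖ y)
place-⊖ (t , rows) x y = go t rows
  where
  dot-⊖ : ∀ t r x y → (t ℤ.+ dot r x) ℤ.- (t ℤ.+ dot r y) ≡ dot r (x ⊖ y)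
  dot-⊖ t (a ∷ b ∷ c ∷ d ∷ []) (x ∷ y ∷ z ∷ w ∷ []) (x′ ∷ y′ ∷ z′ ∷ w′ ∷ []) =
    ℤ-solve 13 (λ t a b c d x y z w x′ y′ z′ w′ →
      (t ⟨+⟩ ((a ⟨*⟩ x ⟨+⟩ b ⟨*⟩ y) ⟨+⟩ (c ⟨*⟩ z ⟨+⟩ d ⟨*⟩ w))) ⟨-⟩
      (t ⟨+⟩ ((a ⟨*⟩ x′ ⟨+⟩ b ⟨*⟩ y′) ⟨+⟩ (c ⟨*⟩ z′ ⟨+⟩ d ⟨*⟩ w′))) ⟨=⟩
      (a ⟨*⟩ (x ⟨-⟩ x′) ⟨+⟩ b ⟨*⟩ (y ⟨-⟩ y′)) ⟨+⟩ (c ⟨*⟩ (z ⟨-⟩ z′) ⟨+⟩ d ⟨*⟩ (w ⟨-⟩ w′)))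
      refl t a b c d x y z w x′ y′ z′ w′
    where
    open ℤ-Solver using () renaming
      (solve to ℤ-solve; _:=_ to _⟨=⟩_; _:+_ to _⟨+⟩_; _:*_ to _⟨*⟩_; _:-_ to _⟨-⟩_)
  go : ∀ {n} (t : Vec ℤ n) rows →
       zipWith ℤ._+_ t (linear rows x) ⊖ zipWith ℤ._+_ t (linear rows y) ≡ linear rows (x ⊖ y)
  go []      []         = refl
  go (t ∷ ts) (r ∷ rows) = cong₂ _∷_ (dot-⊖ t r x y) (go ts rows)

-- Properness is required of colourings of coefficient vectors, not of points of the plane: this
-- makes it accessible to search and to evaluation.
ProperOn : List Vector → (Vector → Fin 4) → Set
ProperOn L F = ∀ {p q} → p ∈ L → q ∈ L → IsUnit (p ⊖ q) → F p ≢ F q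

bitVectors : ∀ n → List (Vec Bool n)
bitVectors zero    = [] ∷ []
bitVectors (suc n) = List.map (false ∷_) (bitVectors n) ++ List.map (true ∷_) (bitVectors n)

∈-bitVectors : ∀ {n} (v : Vec Bool n) → v ∈ bitVectors n
∈-bitVectors []          = here refl
∈-bitVectors (false ∷ v) = ∈-++⁺ˡ (∈-map⁺ (false ∷_) (∈-bitVectors v))
∈-bitVectors {suc n} (true  ∷ v) =
  ∈-++⁺ʳ (List.map (false ∷_) (bitVectors n)) (∈-map⁺ (true ∷_) (∈-bitVectors v))

sameℤ : ℤ → ℤ → Bool
sameℤ (+ m)    (+ n)    = m ≡ᵇ n
sameℤ -[1+ m ] -[1+ n ] = m ≡ᵇ n
sameℤ _        _        = false

sameℤ-≡ : ∀ i j → T (sameℤ i j) → i ≡ j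
sameℤ-≡ (+ m)    (+ n)    t = cong +_ (ℕ.≡ᵇ⇒≡ m n t)
sameℤ-≡ -[1+ m ] -[1+ n ] t = cong -[1+_] (ℕ.≡ᵇ⇒≡ m n t)

same : ∀ {n} → Vec ℤ n → Vec ℤ n → Bool
same []       []       = true
same (i ∷ is) (j ∷ js) = sameℤ i j ∧ same is js

same-≡ : ∀ {n} (u v : Vec ℤ n) → T (same u v) → u ≡ v
same-≡ []       []       _ = refl
same-≡ (i ∷ is) (j ∷ js) t with Equivalence.to T-∧ t
... | p , q = cong₂ _∷_ (sameℤ-≡ i j p) (same-≡ is js q)

module Placed {n : ℕ} (table : Trie (Orbit n) n) where
  open Graph₃ table

  -- Under a `Frame` the length of an edge depends only on the difference of its ends. It is enough
  -- to find each difference once in a short list, and then to check for each matrix that this list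
  -- goes to unit vectors; the edges are not examined again for every copy.
  edgesAmong : List Point₄ → Bool
  edgesAmong δs = all (λ v → all (λ u → any (same (position u ⊖ position v)) δs) (nbrs v))
                      (bitVectors (2 ℕ.+ n))

  points : Frame → List Vector
  points f = List.map (place f ∘ position) (bitVectors (2 ℕ.+ n))

  ∈-points : ∀ f v → place f (position v) ∈ points f
  ∈-points f v = ∈-map⁺ (place f ∘ position) (∈-bitVectors v)

  place-proper : ∀ δs → edgesAmong δs ≡ true → ∀ f → All (IsUnit ∘ linear (proj₂ f)) δs →
    ∀ {L} → (∀ v → place f (position v) ∈ L) → ∀ {F} → ProperOn L F →
    Proper (F ∘ place f ∘ position)
  place-proper δs eq f units {L} ∈L {F} proper v = All.map (λ {u} → distinct u)
    (all⁺ (λ u → any (same (position u ⊖ position v)) δs) (nbrs v)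
      (All.lookup (all⁺ _ (bitVectors (2 ℕ.+ n)) (Equivalence.from T-≡ eq)) (∈-bitVectors v)))
    where
    distinct : ∀ u → T (any (same (position u ⊖ position v)) δs) →
               F (place f (position u)) ≢ F (place f (position v))
    distinct u t = proper (∈L u) (∈L v) (subst IsUnit (sym (place-⊖ f (position u) (position v)))
      (All.lookupWith (λ {δ} unit eq → subst (IsUnit ∘ linear (proj₂ f)) (sym (same-≡ _ δ eq)) unit)
        units (any⁻ (same (position u ⊖ position v)) δs t)))

-- Renaming colours

-- The first transposition may move `b` (when `b` is 0), hence the second one acts on the image of
-- `b`.
sendTo01 : Fin 4 → Fin 4 → Fin 4 → Fin 4
sendTo01 a b = transpose (transpose a 0F b) 1F ∘ transpose a 0F

sendTo01-injective : ∀ a b → Injective _≡_ _≡_ (sendTo01 a b)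
sendTo01-injective a b = transpose-injective a 0F ∘ transpose-injective (transpose a 0F b) 1F
  where
  transpose-injective : ∀ (i j : Fin 4) → Injective _≡_ _≡_ (transpose i j)
  transpose-injective i j {x} {y} eq =
    trans (sym (transpose-inverse j i)) (trans (cong (transpose j i) eq) (transpose-inverse j i))

sendTo01-values : ∀ a b → a ≢ b → sendTo01 a b a ≡ 0F × sendTo01 a b b ≡ 1F
sendTo01-values = toWitness {a? = Fin.all? λ a → Fin.all? λ b →
  ¬? (a Fin.≟ b) →-dec ((sendTo01 a b a Fin.≟ 0F) ×-dec (sendTo01 a b b Fin.≟ 1F))} tt

swap₂₃-injective : Injective _≡_ _≡_ swap₂₃
swap₂₃-injective {x} {y} eq =
  trans (sym (swap₂₃-involutive x)) (trans (cong swap₂₃ eq) (swap₂₃-involutive y))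

except : Fin 4 → Domain
except c = full ∖ singleton c

∉-except : ∀ c → ¬ except c ∋ c
∉-except 0F ()
∉-except 1F ()
∉-except 2F ()
∉-except 3F ()

-- Monochromatic triangles with side √3

abstract
  triangleTable : Trie (Orbit 9) 9
  triangleTable = orbits 9 0 triangleOrbits

-- The vertices are sums of at most three of the unit vectors ω^i η^j with |j| ≤ 2, where
-- η = (√33 + √-3)/6.
module TriangleGraph where
  open Graph₃ triangleTable public
  open Placed triangleTable public

origin corner : Vertex 9
origin = true ∷ true ∷ replicate 9 false
corner = replicate 11 false

-- The conditions are invariant under the rotation, which permutes the corners and fixes the centre,
-- and under the exchange of colours 2 and 3. Exactly these symmetries may be applied to lemmas.
record TriangleColouring (col : Colouring 9) : Set where
  field
    proper : TriangleGraph.Proper col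
    centre : col origin ≡ 0F
    first  : col corner ≡ 1F
    second : col (rot corner) ≡ 1F
    third  : col (rot (rot corner)) ≡ 1F

triangle-rot : ∀ {col} → TriangleColouring col → TriangleColouring (col ∘ rot)
triangle-rot {col} ok = record
  { proper = TriangleGraph.rot-proper {col} proper ; centre = centre
  ; first = second ; second = third ; third = first }
  where open TriangleColouring ok

triangle-swap : ∀ {col} → TriangleColouring col → TriangleColouring (swap₂₃ ∘ col)
triangle-swap {col} ok = record
  { proper = TriangleGraph.recolour-proper swap₂₃-injective {col} proper
  ; centre = cong swap₂₃ centre ; first = cong swap₂₃ first
  ; second = cong swap₂₃ second ; third = cong swap₂₃ third }
  where open TriangleColouring ok

module TriangleRefutation = Refutation TriangleGraph.nbrs TriangleColouring
  TriangleColouring.proper triangle-rot triangle-swap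

-- A nogood can only forbid, so a prescribed colour is expressed by forbidding the other three.
triangleAxioms : List (Nogood 9)
triangleAxioms =
  ((origin , except 0F) ∷ []) ∷ ((corner , except 1F) ∷ []) ∷
  ((rot corner , except 1F) ∷ []) ∷ ((rot (rot corner) , except 1F) ∷ []) ∷ []

triangleAxioms-valid : All TriangleRefutation.Valid triangleAxioms
triangleAxioms-valid = fixed centre ∷ fixed first ∷ fixed second ∷ fixed third ∷ []
  where
  open TriangleColouring
  fixed : ∀ {v c} → (∀ {col} → TriangleColouring col → col v ≡ c) →
          TriangleRefutation.Valid ((v , except c) ∷ [])
  fixed {v} {c} eq col ok (m ∷ []) = ∉-except c (subst (except c ∋_) (eq ok) m)

abstract
  -- The goal is the empty nogood, which every colouring matches. The last lemma forces colour 2 on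
  -- the vertex at η² - 1; with its two rotations it forms a unit triangle, on which the closing
  -- steps reach a conflict.
  no-triangleColouring : ∀ {col} → ¬ TriangleColouring col
  no-triangleColouring {col} ok = TriangleRefutation.check-valid triangleAxioms-valid
    triangleLemmas [] triangleSteps refl col ok []

-- Copies of both graphs in the plane

⁻_ : ℕ → ℤ
⁻ n = ℤ.- + n

rows : (x₀ y₀ z₀ w₀ x₁ y₁ z₁ w₁ x₂ y₂ z₂ w₂ x₃ y₃ z₃ w₃ : ℤ) → Vec Point₄ 4
rows x₀ y₀ z₀ w₀ x₁ y₁ z₁ w₁ x₂ y₂ z₂ w₂ x₃ y₃ z₃ w₃ =
  (x₀ ∷ y₀ ∷ z₀ ∷ w₀ ∷ []) ∷ (x₁ ∷ y₁ ∷ z₁ ∷ w₁ ∷ []) ∷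
  (x₂ ∷ y₂ ∷ z₂ ∷ w₂ ∷ []) ∷ (x₃ ∷ y₃ ∷ z₃ ∷ w₃ ∷ []) ∷ []

-- The columns are ζ/3, ζω/3, ζη², ζωη² with ω = (1 + √-3)/2, η² = (5 + √-11)/6 and,
-- respectively, ζ = 1, ζ = ω₄ = (7 + √-15)/8, ζ = ω₄⁻¹.
data Rotation : Set where
  1ʳ ω₄ ω₄⁻¹ : Rotation

matrix : Rotation → Vec Point₄ 8
matrix 1ʳ =
  rows (+ 96) (+ 48) (+ 240) (+ 120) (+ 0) (+ 0)  (+ 0)  (⁻ 24)
       (+ 0)  (+ 0)  (+ 0)   (+ 0)   (+ 0) (+ 0)  (+ 0)  (+ 0) Vec.++
  rows (+ 0)  (+ 48) (+ 0)   (+ 120) (+ 0) (+ 0)  (+ 16) (+ 8)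
       (+ 0)  (+ 0)  (+ 0)   (+ 0)   (+ 0) (+ 0)  (+ 0)  (+ 0)
matrix ω₄ =
  rows (+ 84) (+ 42) (+ 210) (+ 105) (+ 0) (+ 0)  (+ 0)  (⁻ 21)
       (+ 0)  (⁻ 18) (+ 0)   (⁻ 45)  (+ 0) (+ 0)  (⁻ 6)  (⁻ 3) Vec.++
  rows (+ 0)  (+ 42) (+ 0)   (+ 105) (+ 0) (+ 0)  (+ 14) (+ 7)
       (+ 12) (+ 6)  (+ 30)  (+ 15)  (+ 0) (+ 0)  (+ 0)  (⁻ 3)
matrix ω₄⁻¹ =
  rows (+ 84) (+ 42) (+ 210) (+ 105) (+ 0) (+ 0)  (+ 0)  (⁻ 21)
       (+ 0)  (+ 18) (+ 0)   (+ 45)  (+ 0) (+ 0)  (+ 6)  (+ 3) Vec.++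
  rows (+ 0)  (+ 42) (+ 0)   (+ 105) (+ 0) (+ 0)  (+ 14) (+ 7)
       (⁻ 12) (⁻ 6)  (⁻ 30)  (⁻ 15)  (+ 0) (+ 0)  (+ 0)  (+ 3)

reflect : Bool → Vec Point₄ 8 → Vec Point₄ 8
reflect false m = m
reflect true  m = Vec.map (Vec.map (λ i → ℤ.- i)) m

-- (i , j) ↦ ζ i + ξ j for pairs of Eisenstein integers.
spindleMatrix : Rotation → Rotation → Vec Point₄ 8
spindleMatrix ζ ξ = zipWith join (matrix ζ) (matrix ξ)
  where
  join : Point₄ → Point₄ → Point₄
  join (a ∷ b ∷ _) (c ∷ d ∷ _) =
    + 3 ℤ.* a ∷ + 3 ℤ.* b ∷ + 3 ℤ.* c ∷ + 3 ℤ.* d ∷ []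

record Spindle : Set where
  constructor spindle
  field
    middle : Vector
    ζ ξ    : Rotation
  frame : Frame
  frame = middle , spindleMatrix ζ ξ

abstract
  spindleTable : Trie (Orbit 5) 5
  spindleTable = orbits 5 0 spindleOrbits

module SpindleGraph where
  open Graph₃ spindleTable public
  open Placed spindleTable public

-- A triangle lies in the lattice of ζ (false) or ξ (true) and is translated from
-- {1, ω², ω⁴} (false) or {-1, -ω², -ω⁴} (true).
record Triangle : Set where
  constructor triple
  field
    second reflected : Bool
    a b c            : Vertex 5

triangle : Bool → Bool → ℕ → ℕ → ℕ → Triangle
triangle s r a b c = triple s r (bits 7 a) (bits 7 b) (bits 7 c)

spindleTriangles : List Triangle
spindleTriangles =
  triangle false false 18 16 17 ∷
  triangle false true  12 13 14 ∷
  triangle false false 8 20 24 ∷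
  triangle false false 10 20 24 ∷
  triangle false true  4 17 16 ∷
  triangle false false 14 1 12 ∷
  triangle false true  20 8 26 ∷
  triangle false true  20 9 26 ∷
  triangle false true  20 10 26 ∷
  triangle false false 16 32 4 ∷
  triangle false true  28 12 1 ∷
  triangle false false 17 4 41 ∷
  triangle false true  36 2 12 ∷
  triangle true  false 46 64 44 ∷
  triangle true  true  52 8 58 ∷
  triangle true  true  52 9 58 ∷
  triangle true  true  52 10 58 ∷
  triangle true  false 48 72 60 ∷
  triangle true  true  68 44 64 ∷
  triangle true  false 49 60 81 ∷
  triangle true  true  76 65 44 ∷
  []

-- Rotation by ω² takes the corner in direction ω⁴ to direction 1. The cyclic shift keeps the
-- corners in the order 1, ω², ω⁴ (or its negative), so the same matrix fits the rotated triangle.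
rotTriangle : Triangle → Triangle
rotTriangle (triple s r a b c) = triple s r (rot c) (rot a) (rot b)

rotatedTriangles : List Triangle
rotatedTriangles = spindleTriangles ++
  (List.map rotTriangle spindleTriangles ++ List.map (rotTriangle ∘ rotTriangle) spindleTriangles)

unitTriangle : ℕ → Point₄
unitTriangle zero    = + 3 ∷ + 0 ∷ + 0 ∷ + 0 ∷ []
unitTriangle (suc j) = turn (unitTriangle j)

abstract
  position-corner : TriangleGraph.position corner ≡ unitTriangle 0
  position-corner = refl

triangleMatrix : Spindle → Triangle → Vec Point₄ 8
triangleMatrix S (triple s r _ _ _) = reflect r (matrix (if s then Spindle.ξ S else Spindle.ζ S))

module Alignment (position : Vertex 5 → Point₄) where

  vertex : Spindle → Vertex 5 → Vector
  vertex S v = place (Spindle.frame S) (position v)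

  -- The translation is chosen to put the first corner at `a`. That the other two then fall on `b`
  -- and `c` is what `aligned?` tests.
  triangleFrame : Spindle → Triangle → Frame
  triangleFrame S t =
    vertex S (Triangle.a t) ⊖ linear (triangleMatrix S t) (unitTriangle 0) , triangleMatrix S t

  corners : List (ℕ × (Triangle → Vertex 5))
  corners = (0 , Triangle.a) ∷ (1 , Triangle.b) ∷ (2 , Triangle.c) ∷ []

  aligned? : List Spindle → List Triangle → Bool
  aligned? Ss ts = all (λ S → all (λ t → all (λ (j , c) →
    same (place (triangleFrame S t) (unitTriangle j)) (vertex S (c t))) corners) ts) Ss

  aligned-≡ : ∀ {Ss ts} → aligned? Ss ts ≡ true → ∀ {S} → S ∈ Ss → ∀ {t} → t ∈ ts →
    All (λ (j , c) → place (triangleFrame S t) (unitTriangle j) ≡ vertex S (c t)) corners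
  aligned-≡ {Ss} {ts} eq S∈ t∈ = All.map (same-≡ _ _)
    (all⁺ _ corners (All.lookup (all⁺ _ ts (All.lookup (all⁺ _ Ss (Equivalence.from T-≡ eq)) S∈)) t∈))

open Alignment SpindleGraph.position

configuration : List Triangle → Spindle → List Vector
configuration ts S = SpindleGraph.points (Spindle.frame S) ++
  concatMap (λ t → TriangleGraph.points (triangleFrame S t)) ts

pointsOf : List Triangle → List Spindle → List Vector
pointsOf ts = concatMap (configuration ts)

spindle-point : ∀ ts {Ss S} → S ∈ Ss → ∀ v →
  place (Spindle.frame S) (SpindleGraph.position v) ∈ pointsOf ts Ss
spindle-point ts {S = S} S∈ v = ∈-concatMap⁺ (configuration ts) (lose S∈
  (∈-++⁺ˡ (SpindleGraph.∈-points (Spindle.frame S) v)))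

triangle-point : ∀ {ts Ss S t} → S ∈ Ss → t ∈ ts → ∀ v →
  place (triangleFrame S t) (TriangleGraph.position v) ∈ pointsOf ts Ss
triangle-point {ts} {S = S} {t} S∈ t∈ v = ∈-concatMap⁺ (configuration ts) (lose S∈
  (∈-++⁺ʳ (SpindleGraph.points (Spindle.frame S))
    (∈-concatMap⁺ (λ t → TriangleGraph.points (triangleFrame S t)) (lose t∈
      (TriangleGraph.∈-points (triangleFrame S t) v)))))

vector : (x₀ x₁ x₂ x₃ y₀ y₁ y₂ y₃ : ℤ) → Vector
vector x₀ x₁ x₂ x₃ y₀ y₁ y₂ y₃ = x₀ ∷ x₁ ∷ x₂ ∷ x₃ ∷ y₀ ∷ y₁ ∷ y₂ ∷ y₃ ∷ []

-- The points 2, 6, 8 - 2 ω₄ and 8 - 4 ω₄ - 2 ω₄⁻¹, halfway along the four steps of the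
-- path 0, 4, 8, 8 - 4 ω₄, 8 - 4 ω₄ - 4 ω₄⁻¹ = 1.
spindle₁ spindle₂ spindle₃ spindle₄ : Spindle
spindle₁ = spindle (vector (+ 576)  (+ 0) (+ 0) (+ 0) (+ 0) (+ 0) (+ 0)  (+ 0)) 1ʳ   ω₄
spindle₂ = spindle (vector (+ 1728) (+ 0) (+ 0) (+ 0) (+ 0) (+ 0) (+ 0)  (+ 0)) 1ʳ   ω₄
spindle₃ = spindle (vector (+ 1800) (+ 0) (+ 0) (+ 0) (+ 0) (+ 0) (⁻ 72) (+ 0)) ω₄   1ʳ
spindle₄ = spindle (vector (+ 792)  (+ 0) (+ 0) (+ 0) (+ 0) (+ 0) (⁻ 72) (+ 0)) ω₄⁻¹ 1ʳ

spindles : List Spindle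
spindles = spindle₁ ∷ spindle₂ ∷ spindle₃ ∷ spindle₄ ∷ []

-- The thirty vectors ω^i η^j with |j| ≤ 2, in the basis 1/3, ω/3, η², ωη².
triangleUnits : List Point₄
triangleUnits = List.map (coordinates 4) (
  0x7f82837a ∷ 0x8081807b ∷ 0x7f81857b ∷ 0x7f82827c ∷ 0x81817d7d ∷ 0x8080807d ∷
  0x8080837d ∷ 0x7e81867d ∷ 0x81817e7e ∷ 0x7e81847e ∷ 0x81807b80 ∷ 0x80807d80 ∷
  0x807f8080 ∷ 0x817f8080 ∷ 0x7f808080 ∷ 0x81808080 ∷ 0x7f818080 ∷ 0x80818080 ∷
  0x80808380 ∷ 0x7f808580 ∷ 0x827f7c82 ∷ 0x7f7f8282 ∷ 0x827f7a83 ∷ 0x80807d83 ∷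
  0x80808083 ∷ 0x7f7f8383 ∷ 0x817e7e84 ∷ 0x817f7b85 ∷ 0x807f8085 ∷ 0x817e7d86 ∷
  [])

-- The six units u of ℤ[ω] in each of the two lattices, and the six vectors 2 u (ζ - ξ). The latter
-- have length 1 as soon as |ζ - ξ| = 1/2, so the same graph serves for ξ/ζ = ω₄ and for ξ/ζ = ω₄⁻¹.
spindleUnits : List Point₄
spindleUnits = List.map (coordinates 4) (
  0x8082807e ∷ 0x7e82827e ∷ 0x8080807f ∷ 0x8080817f ∷ 0x82807e80 ∷ 0x80807f80 ∷
  0x807f8080 ∷ 0x817f8080 ∷ 0x7f808080 ∷ 0x81808080 ∷ 0x7f818080 ∷ 0x80818080 ∷
  0x80808180 ∷ 0x7e808280 ∷ 0x80807f81 ∷ 0x80808081 ∷ 0x827e7e82 ∷ 0x807e8082 ∷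
  [])

units? : ∀ (M : Vec Point₄ 8) δs → Dec (All (IsUnit ∘ linear M) δs)
units? M = All.all? (isUnit? ∘ linear M)

abstract
  unitTriangle-∈ : unitTriangle 0 ∈ triangleUnits
  unitTriangle-∈ = toWitness {a? = any? (unitTriangle 0 ≟ᵛ_) triangleUnits} tt
    where
    _≟ᵛ_ : (u v : Point₄) → Dec (u ≡ v)
    _≟ᵛ_ = Vec.≡-dec ℤ._≟_

  triangleUnits-unit : ∀ r ζ → All (IsUnit ∘ linear (reflect r (matrix ζ))) triangleUnits
  triangleUnits-unit false 1ʳ   = toWitness {a? = units? (matrix 1ʳ) triangleUnits} tt
  triangleUnits-unit false ω₄   = toWitness {a? = units? (matrix ω₄) triangleUnits} tt
  triangleUnits-unit false ω₄⁻¹ = toWitness {a? = units? (matrix ω₄⁻¹) triangleUnits} tt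
  triangleUnits-unit true  1ʳ   = toWitness {a? = units? (reflect true (matrix 1ʳ)) triangleUnits} tt
  triangleUnits-unit true  ω₄   = toWitness {a? = units? (reflect true (matrix ω₄)) triangleUnits} tt
  triangleUnits-unit true  ω₄⁻¹ = toWitness {a? = units? (reflect true (matrix ω₄⁻¹)) triangleUnits} tt

  spindleUnits-unit : All (λ S → All (IsUnit ∘ linear (proj₂ (Spindle.frame S))) spindleUnits) spindles
  spindleUnits-unit = toWitness
    {a? = All.all? (λ S → units? (proj₂ (Spindle.frame S)) spindleUnits) spindles} tt

  -- The tables are bound to variables so that they are evaluated only once.
  triangle-edges : TriangleGraph.edgesAmong triangleUnits ≡ true
  triangle-edges = edges refl refl
    where
    edges : ∀ {t δs} → t ≡ orbits 9 0 triangleOrbits → δs ≡ List.map (λ δ → δ) triangleUnits →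
            Placed.edgesAmong t δs ≡ true
    edges refl refl = refl

  spindle-edges : SpindleGraph.edgesAmong spindleUnits ≡ true
  spindle-edges = refl

  aligned : aligned? spindles rotatedTriangles ≡ true
  aligned = checked refl
    where
    checked : ∀ {t} → t ≡ orbits 5 0 spindleOrbits →
              Alignment.aligned? (Graph₃.position t) spindles rotatedTriangles ≡ true
    checked refl = refl

Free : Colouring 5 → Triangle → Set
Free col t = ¬ (col (Triangle.a t) ≡ col (Triangle.b t) × col (Triangle.b t) ≡ col (Triangle.c t))

module _ {F : Vector → Fin 4} (proper : ProperOn (pointsOf rotatedTriangles spindles) F)
         {S : Spindle} (S∈ : S ∈ spindles) where

  spindleColouring : Colouring 5
  spindleColouring v = F (place (Spindle.frame S) (SpindleGraph.position v))

  spindle-proper : SpindleGraph.Proper spindleColouring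
  spindle-proper = SpindleGraph.place-proper spindleUnits spindle-edges (Spindle.frame S)
    (All.lookup spindleUnits-unit S∈) (spindle-point rotatedTriangles S∈) proper

  -- A monochromatic triangle would be the corners of a copy of the triangle graph. The centre of
  -- that copy is adjacent to them, so colours can be renamed to 0 at the centre and 1 at the
  -- corners, contrary to `no-triangleColouring`.
  triangle-free : ∀ {t} → t ∈ rotatedTriangles → Free spindleColouring t
  triangle-free {t} t∈ (a≡b , b≡c) = no-triangleColouring record
    { proper = TriangleGraph.recolour-proper {π} (sendTo01-injective (col origin) (col corner)) {col}
        (TriangleGraph.place-proper triangleUnits triangle-edges f units (triangle-point S∈ t∈) proper)
    ; centre = proj₁ values
    ; first  = proj₂ values
    ; second = trans (cong π (trans at-b (trans (sym a≡b) (sym at-a)))) (proj₂ values)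
    ; third  = trans (cong π (trans at-c (trans (sym (trans a≡b b≡c)) (sym at-a)))) (proj₂ values)
    }
    where
    f : Frame
    f = triangleFrame S t
    col : Colouring 9
    col v = F (place f (TriangleGraph.position v))
    units : All (IsUnit ∘ linear (proj₂ f)) triangleUnits
    units = triangleUnits-unit (Triangle.reflected t) (if Triangle.second t then Spindle.ξ S else Spindle.ζ S)
    -- The table lists no neighbours for `corner`, and `origin` has none either, so this edge comes
    -- directly from the unit vector between them.
    adjacent : col corner ≢ col origin
    adjacent = proper (triangle-point S∈ t∈ corner) (triangle-point S∈ t∈ origin)
      (subst IsUnit (sym (place-⊖ f (TriangleGraph.position corner) (TriangleGraph.position origin)))
        (subst (λ x → IsUnit (linear (proj₂ f) (x ⊖ TriangleGraph.position origin))) (sym position-corner)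
          (All.lookup units unitTriangle-∈)))
    π : Fin 4 → Fin 4
    π = sendTo01 (col origin) (col corner)
    values : π (col origin) ≡ 0F × π (col corner) ≡ 1F
    values = sendTo01-values (col origin) (col corner) (adjacent ∘ sym)
    alignment : All (λ (j , c) → place f (unitTriangle j) ≡ vertex S (c t)) corners
    alignment = aligned-≡ aligned S∈ t∈
    colour-at : ∀ {v x} w → TriangleGraph.position v ≡ x → place f x ≡ vertex S w → col v ≡ spindleColouring w
    colour-at _ p q = trans (cong (F ∘ place f) p) (cong F q)
    at-a : col corner ≡ spindleColouring (Triangle.a t)
    at-a = colour-at {corner} (Triangle.a t) position-corner (All.lookup alignment (here refl))
    at-b : col (rot corner) ≡ spindleColouring (Triangle.b t)
    at-b = colour-at {rot corner} (Triangle.b t) (cong turn position-corner) (All.lookup alignment (there (here refl)))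
    at-c : col (rot (rot corner)) ≡ spindleColouring (Triangle.c t)
    at-c = colour-at {rot (rot corner)} (Triangle.c t) (cong (turn ∘ turn) position-corner)
      (All.lookup alignment (there (there (here refl))))

-- Spindles

-- The three rotations are kept together because composing a colouring with `rot` merely permutes
-- the three conditions, up to the cyclic order of the corners.
Free₃ : Colouring 5 → Triangle → Set
Free₃ col t = Free col t × Free col (rotTriangle t) × Free col (rotTriangle (rotTriangle t))

record SpindleColouring (col : Colouring 5) : Set where
  field
    proper : SpindleGraph.Proper col
    free   : All (Free₃ col) spindleTriangles

spindle-rot : ∀ {col} → SpindleColouring col → SpindleColouring (col ∘ rot)
spindle-rot {col} ok = record
  { proper = SpindleGraph.rot-proper {col} proper
  ; free   = All.map (λ {t} (f₀ , f₁ , f₂) → turned t f₁ , turned (rotTriangle t) f₂ , turned² t f₀) free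
  }
  where
  open SpindleColouring ok
  turned : ∀ t → Free col (rotTriangle t) → Free (col ∘ rot) t
  turned _ f (a≡b , b≡c) = f (sym (trans a≡b b≡c) , a≡b)
  turned² : ∀ t → Free col t → Free (col ∘ rot) (rotTriangle (rotTriangle t))
  turned² t f (b≡c , c≡a) rewrite rot³ (Triangle.a t) | rot³ (Triangle.b t) | rot³ (Triangle.c t) =
    f (sym (trans b≡c c≡a) , b≡c)

spindle-recolour : ∀ {π : Fin 4 → Fin 4} → Injective _≡_ _≡_ π → ∀ {col} →
  SpindleColouring col → SpindleColouring (π ∘ col)
spindle-recolour {π} inj {col} ok = record
  { proper = SpindleGraph.recolour-proper {π} inj {col} proper
  ; free   = All.map (λ {t} (f₀ , f₁ , f₂) →
      injected t f₀ , injected (rotTriangle t) f₁ , injected (rotTriangle (rotTriangle t)) f₂) free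
  }
  where
  open SpindleColouring ok
  injected : ∀ t → Free col t → Free (π ∘ col) t
  injected _ f (p , q) = f (inj p , inj q)

module SpindleRefutation = Refutation SpindleGraph.nbrs SpindleColouring
  SpindleColouring.proper spindle-rot (λ {col} → spindle-recolour {swap₂₃} swap₂₃-injective {col})

monochromatic : Triangle → Fin 4 → Nogood 5
monochromatic t k =
  (Triangle.a t , singleton k) ∷ (Triangle.b t , singleton k) ∷ (Triangle.c t , singleton k) ∷ []

-- One nogood for each triangle and colour. Only representatives are loaded; a rotated triangle is
-- reached by recalling its representative with rotations.
freeAxioms : List Triangle → List (Nogood 5)
freeAxioms ts = concatMap (λ t → List.map (monochromatic t) (List.allFin 4)) ts

freeAxioms-valid : ∀ {ts} → (∀ {t} → t ∈ ts → ∀ col → SpindleColouring col → Free col t) →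
                   All SpindleRefutation.Valid (freeAxioms ts)
freeAxioms-valid {ts} free = concat⁺ (map⁺ (All.tabulate {xs = ts} λ {t} t∈ →
  map⁺ (All.tabulate {xs = List.allFin 4} λ {k} _ col ok m → violated t k (free t∈ col ok) m)))
  where
  violated : ∀ {col} t k → Free col t → ¬ Matches col (monochromatic t k)
  violated t k f (a ∷ b ∷ c ∷ []) = f
    ( trans (singleton-∋ k _ a) (sym (singleton-∋ k _ b))
    , trans (singleton-∋ k _ b) (sym (singleton-∋ k _ c)))

spindleAxioms-valid : All SpindleRefutation.Valid (freeAxioms spindleTriangles)
spindleAxioms-valid = freeAxioms-valid λ t∈ _ ok → proj₁ (All.lookup (SpindleColouring.free ok) t∈)

forth back : Vertex 5
forth = bits 7 0
back  = bits 7 4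

+2₄ -2₄ : Point₄
+2₄ = + 2 ∷ + 0 ∷ + 0 ∷ + 0 ∷ []
-2₄ = -[1+ 1 ] ∷ + 0 ∷ + 0 ∷ + 0 ∷ []

abstract
  -- The two colours are part of the goal and not of `SpindleColouring`, which would otherwise not
  -- be invariant under rotation. The last lemma of the certificate is the goal itself, and the one
  -- closing step recalls it.
  no-spindleColouring : ∀ {col} → SpindleColouring col → col forth ≡ 0F → ¬ col back ≡ 1F
  no-spindleColouring {col} ok p q =
    SpindleRefutation.check-valid spindleAxioms-valid spindleLemmas goal spindleSteps refl col ok
      (subst (singleton 0F ∋_) (sym p) tt ∷ subst (singleton 1F ∋_) (sym q) tt ∷ [])
    where
    goal : Nogood 5
    goal = (forth , singleton 0F) ∷ (back , singleton 1F) ∷ []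

  forth-position : SpindleGraph.position forth ≡ +2₄
  forth-position = refl

  back-position : SpindleGraph.position back ≡ -2₄
  back-position = refl

-- The path from 0 to 1

module _ {F : Vector → Fin 4} (proper : ProperOn (pointsOf rotatedTriangles spindles) F) where

  -- Distinct colours at the two ends could be renamed to 0 and 1, which `no-spindleColouring` rules
  -- out; equality in `Fin 4` is decidable, so this proves equality.
  monochromatic-step : ∀ {S} → S ∈ spindles →
    F (place (Spindle.frame S) +2₄) ≡
    F (place (Spindle.frame S) -2₄)
  monochromatic-step {S} S∈ = subst₂ (λ x y → F (place f x) ≡ F (place f y)) forth-position back-position
    (decidable-stable (_ Fin.≟ _) λ ≢ → let values = sendTo01-values (col forth) (col back) ≢ in
      no-spindleColouring (spindle-recolour {sendTo01 (col forth) (col back)}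
        (sendTo01-injective (col forth) (col back)) {col} colouring) (proj₁ values) (proj₂ values))
    where
    f : Frame
    f = Spindle.frame S
    col : Colouring 5
    col = spindleColouring proper S∈
    free : ∀ {t} → t ∈ rotatedTriangles → Free col t
    free = triangle-free proper S∈
    colouring : SpindleColouring col
    colouring = record
      { proper = spindle-proper proper S∈
      ; free   = All.tabulate λ {t} t∈ →
          free (∈-++⁺ˡ t∈) ,
          free (∈-++⁺ʳ spindleTriangles (∈-++⁺ˡ (∈-map⁺ rotTriangle t∈))) ,
          free (∈-++⁺ʳ spindleTriangles (∈-++⁺ʳ (List.map rotTriangle spindleTriangles)
            (∈-map⁺ (rotTriangle ∘ rotTriangle) t∈)))
      }

  contradiction : ⊥
  -- The ends `-2₄` of `spindle₄` and `spindle₁` are 1 and 0. Consecutive steps fit together because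
  -- their common ends 8 - 4 ω₄, 8 and 4 evaluate to the same vectors.
  contradiction = proper (end spindle₄-∈) (end spindle₁-∈) (refl , refl , refl , refl)
    (trans (sym (monochromatic-step spindle₄-∈)) (trans (sym (monochromatic-step spindle₃-∈))
      (trans (monochromatic-step spindle₂-∈) (monochromatic-step spindle₁-∈))))
    where
    spindle₁-∈ : spindle₁ ∈ spindles
    spindle₁-∈ = here refl
    spindle₂-∈ : spindle₂ ∈ spindles
    spindle₂-∈ = there (here refl)
    spindle₃-∈ : spindle₃ ∈ spindles
    spindle₃-∈ = there (there (here refl))
    spindle₄-∈ : spindle₄ ∈ spindles
    spindle₄-∈ = there (there (there (here refl)))
    end : ∀ {S} → S ∈ spindles → place (Spindle.frame S) -2₄ ∈ pointsOf rotatedTriangles spindles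
    end {S} S∈ = subst (λ x → place (Spindle.frame S) x ∈ pointsOf rotatedTriangles spindles) back-position
      (spindle-point rotatedTriangles S∈ back)

-- The finite set and the plane

module _ (vs : List Vector) (uncolourable : ∀ {F} → ¬ ProperOn vs F) where

  not-4-colourable : ¬ Colourable 4 (unitDistanceGraph ⟦ List.map ⟦_⟧ᵖ vs ⟧)
  not-4-colourable (c , proper) = uncolourable λ {p} {q} p∈ q∈ unit →
    distinct p∈ q∈ unit (p ∈?v vs) (q ∈?v vs)
    where
    _∈?v_ : (v : Vector) (vs : List Vector) → Dec (v ∈ vs)
    _∈?v_ = member? (Vec.≡-dec ℤ._≟_)
    point : ∀ {v} → v ∈ vs → Member ℝ² ⟦ v ⟧ᵖ (List.map ⟦_⟧ᵖ vs)
    point v∈ = Any.map⁺ (Any.map (λ { {w} refl → Setoid.refl ℝ² {⟦ w ⟧ᵖ} }) v∈)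
    colour : ∀ {v} → Dec (v ∈ vs) → Fin 4
    colour {v} (yes v∈) = c ⟨$⟩ (⟦ v ⟧ᵖ , point v∈)
    -- An arbitrary value off the list; `distinct` only concerns vectors on it.
    colour     (no  _)  = 0F
    distinct : ∀ {p q} → p ∈ vs → q ∈ vs → IsUnit (p ⊖ q) →
      (p? : Dec (p ∈ vs)) (q? : Dec (q ∈ vs)) → colour p? ≢ colour q?
    distinct {p} {q} _ _ unit (yes _) (yes _) = proper (unit-distance p q unit)
    distinct p∈ _ _ (no p∉) _       = ⊥-elim (p∉ p∈)
    distinct _ q∈ _ (yes _) (no q∉) = ⊥-elim (q∉ q∈)

  -- The pair is found constructively: `isUnit?` and equality of colours are decidable, so the
  -- finite list can be searched, and a failed search would make the colouring proper on it.
  monochromatic-unit : (c : Colours ℝ² 4) → ∃[ p ] ∃[ q ] (UnitDistance p q × c ⟨$⟩ p ≡ c ⟨$⟩ q)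
  monochromatic-unit c with any? (λ p → any? (λ q → isUnit? (p ⊖ q) ×-dec (F p Fin.≟ F q)) vs) vs
    where
    F : Vector → Fin 4
    F v = c ⟨$⟩ ⟦ v ⟧ᵖ
  ... | yes found = let p , found′ = Any.satisfied found
                        q , unit , eq = Any.satisfied found′
                    in ⟦ p ⟧ᵖ , ⟦ q ⟧ᵖ , unit-distance p q unit , eq
  ... | no none = ⊥-elim (uncolourable λ p∈ q∈ unit eq → none (lose p∈ (lose q∈ (unit , eq))))

plane-chromaticNumber≥5 :
  ((c : Colours ℝ² 4) → ∃[ p ] ∃[ q ] (UnitDistance p q × c ⟨$⟩ p ≡ c ⟨$⟩ q)) →
  ChromaticNumber≥ planeGraph 5
plane-chromaticNumber≥5 mono k (c , proper) = ℕ.≰⇒> λ k≤4 →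
  let p , q , unit , eq = mono (record
        { to   = λ p → inject≤ (c ⟨$⟩ (p , tt)) k≤4
        ; cong = λ p≈q → cong (λ i → inject≤ i k≤4) (Func.cong c p≈q) })
  in proper {p , tt} {q , tt} unit (Fin.inject≤-injective k≤4 k≤4 _ _ eq)

mainTheorem1 : ChromaticNumber≥ planeGraph 5
    × (Σ[ ps ∈ List Point ] ¬ Colourable 4 (unitDistanceGraph ⟦ ps ⟧))
    × ((c : Colours ℝ² 4) → ∃[ p ] ∃[ q ] (UnitDistance p q × c ⟨$⟩ p ≡ c ⟨$⟩ q))
mainTheorem1 =
  plane-chromaticNumber≥5 (monochromatic-unit vs λ {F} → contradiction {F}) ,
  (List.map ⟦_⟧ᵖ vs , not-4-colourable vs λ {F} → contradiction {F}) ,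
  monochromatic-unit vs λ {F} → contradiction {F}
  where
  vs : List Vector
  vs = pointsOf rotatedTriangles spindles
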